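{- Let $k,c\ge 2$ and $1\le s\le c-1$ be fixed, let $t=\lceil sk/c\rceil$ and let $\lambda\in[c]$ satisfy $\lambda\equiv sk\pmod c$. Then \[f_{c,s}(n,k)\ge(1-o(1))\frac{\binom{n}{t}}{\binom{k}{t}-m(k,t,\lambda;s+1,c-s+1)},\] where $o(1)\to0$ as $n\to\infty$.
   Context: $[m]=\{1,\dots,m\}$; $\binom{X}{k}$ is the family of $k$-subsets of $X$. A hypergraph $\mathcal{F}\subseteq 2^{[n]}$ is $(c,s)$-frameproof if for every $c+1$ edges $A_0,A_1,\dots,A_c\in\mathcal{F}$ with $A_0\neq A_j$ for each $j\in[c]$ ($A_1,\dots,A_c$ not necessarily distinct), there is some $i\in A_0$ with $|\{j\in[c]:i\in A_j\}|<s$. $f_{c,s}(n,k)$ is the maximum size of a $(c,s)$-frameproof $\mathcal{F}\subseteq\binom{[n]}{k}$. A sequence $A_1,\dots,A_\lambda$ of subsets of $[k]$ (repetitions allowed) is $(k_1,k_2)$-disjoint if $\bigcap_{i\in B}A_i=\emptyset$ for every $k_1$-subset $B\subseteq[\lambda]$ and $\bigcup_{i\in B}A_i=[k]$ for every $k_2$-subset $B\subseteq[\lambda]$ (each condition vacuous if the subset size exceeds $\lambda$). $m(k,t,\lambda;k_1,k_2)$ is the maximum size of $\mathcal{F}\subseteq\binom{[k]}{t}$ containing no $A_1,\dots,A_\lambda\in\mathcal{F}$ (not necessarily distinct) forming a $(k_1,k_2)$-disjoint sequence. -}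

module Defs where

open import Data.Nat using (ℕ; _≤_; _<_; _+_; _*_; _∸_)
open import Data.Fin using (Fin)
open import Data.Fin.Subset using (Subset; _∈_; _∉_; ∣_∣)
open import Data.Vec using (lookup; tabulate)
open import Data.List using (List; length)
open import Data.List.Relation.Unary.All using (All)
open import Data.List.Relation.Unary.Unique.Propositional using (Unique)
import Data.List.Membership.Propositional as L
open import Data.Product using (Σ; ∃; _×_)
open import Relation.Binary.PropositionalEquality using (_≡_; _≢_)
open import Relation.Nullary using (¬_)

IsUniform : (n k : ℕ) → List (Subset n) → Set
IsUniform n k F = Unique F × All (λ A → ∣ A ∣ ≡ k) F

count : {n c : ℕ} → (Fin c → Subset n) → Fin n → ℕ
count As i = ∣ tabulate (λ j → lookup (As j) i) ∣

Frameproof : (c s : ℕ) {n : ℕ} → List (Subset n) → Set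
Frameproof c s {n} F =
  (A₀ : Subset n) → A₀ L.∈ F →
  (As : Fin c → Subset n) → (∀ j → As j L.∈ F) →
  (∀ j → A₀ ≢ As j) →
  ∃ λ (i : Fin n) → i ∈ A₀ × count As i < s

Disjoint : {k lam : ℕ} (k₁ k₂ : ℕ) → (Fin lam → Subset k) → Set
Disjoint {k} {lam} k₁ k₂ A =
  ((B : Subset lam) → ∣ B ∣ ≡ k₁ →
     (x : Fin k) → ∃ λ i → i ∈ B × x ∉ A i)
  × ((B : Subset lam) → ∣ B ∣ ≡ k₂ →
     (x : Fin k) → ∃ λ i → i ∈ B × x ∈ A i)

DisjointFree : {k : ℕ} (lam k₁ k₂ : ℕ) → List (Subset k) → Set
DisjointFree {k} lam k₁ k₂ F =
  (A : Fin lam → Subset k) → (∀ j → A j L.∈ F) → ¬ Disjoint k₁ k₂ A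

IsMaxSize : {n : ℕ} → (List (Subset n) → Set) → ℕ → Set
IsMaxSize P v =
  (Σ _ λ F → P F × length F ≡ v) × (∀ F → P F → length F ≤ v)

IsFrameproofMax : (c s n k v : ℕ) → Set
IsFrameproofMax c s n k v =
  IsMaxSize {n} (λ F → IsUniform n k F × Frameproof c s F) v

IsDisjointFreeMax : (k t lam k₁ k₂ v : ℕ) → Set
IsDisjointFreeMax k t lam k₁ k₂ v =
  IsMaxSize {k} (λ F → IsUniform k t F × DisjointFree lam k₁ k₂ F) v

-- Fix an extremal disjoint-free family 𝓑 of t-subsets of [k] and call the other t-subsets of [k] own. A family of k-sets (blocks), each
-- identified with [k], is frameproof as soon as two blocks meet in at most t vertices and no own t-subset of a block lies in another
-- block: if A₁, …, A_c covered A₀ at least s times, then, truncating the coverage to exactly s, the total sk = λ + (t - 1)c would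
-- force λ of the traces on A₀ to be t-sets from 𝓑 forming an (s + 1, c - s + 1)-disjoint sequence.
--
-- So it remains to cover almost all t-sets (edges) by own t-subsets of such blocks. A small random set of edges is reserved for the
-- t-subsets in 𝓑. Then in each of boundedly many rounds, a random polynomial code with t free coordinates proposes blocks, every
-- edge picks at random the role in which it agrees to be covered, and a block is taken if all its edges agree, its own edges are still
-- free and the others are reserved. The codes are such that the blocks explored backwards from a typical edge never collide. Hence
-- the choices met there are independent, and the probability u that an edge is still free obeys u' = u - κ u ^ L exactly, where L is
-- the number of own t-sets and κ > 0 does not depend on n; thus u → 0 as the number of rounds grows.
--
-- The codes live on ℤ/N with N ≡ 1 modulo a large factorial: small integers are then invertible, which is all that the counting of
-- collisions needs, and N is as close to n as required.
module Submission where

open import Defs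
open import Algebra.Bundles using (CommutativeRing; CommutativeSemigroup)
open import Algebra.Core using (Op₂)
import Algebra.Properties.CommutativeSemigroup
import Algebra.Properties.Ring
import Algebra.Solver.Ring.NaturalCoefficients.Default as SemiringSolver
open import Algebra.Structures using (IsCommutativeMonoid; IsCommutativeRing)
open import Data.Bool using (Bool; true; false; if_then_else_; not; _∧_)
import Data.Bool.Properties as Bool
open import Data.Fin using (Fin; zero; suc; toℕ; fromℕ<)
import Data.Fin as F
import Data.Fin.Properties as F
open import Data.Fin.Subset using (Subset; _∈_; _∉_; ∣_∣; ∁; inside; outside) renaming (⊤ to everything)
import Data.Fin.Subset.Properties as Sub
import Data.Integer as ℤ
import Data.Integer.Properties as ℤ
open import Data.List using (List; []; _∷_; length; map; _++_; filter; concatMap; cartesianProduct; upTo; allFin)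
open import Data.List.Membership.Propositional using (find) renaming (_∈_ to _∈ˡ_; _∉_ to _∉ˡ_)
open import Data.List.Membership.Propositional.Properties
  using (∈-map⁺; ∈-map⁻; ∈-++⁺ˡ; ∈-++⁺ʳ; ∈-++⁻; ∈-filter⁺; ∈-filter⁻; ∈-concatMap⁺; ∈-concatMap⁻; ∈-allFin; ∈-∃++
        ; ∈-lookup; ∈-cartesianProduct⁺; ∈-cartesianProduct⁻; ∈-upTo⁺; ∈-upTo⁻)
import Data.List.Membership.DecPropositional as DecMembership
import Data.List.Properties as Lp
open import Data.List.Relation.Unary.All using (All; []; _∷_)
import Data.List.Relation.Unary.All as All
open import Data.List.Relation.Unary.All.Properties using (++⁺)
open import Data.List.Relation.Unary.AllPairs using (AllPairs; []; _∷_)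
import Data.List.Relation.Unary.AllPairs as AllPairs
import Data.List.Relation.Unary.AllPairs.Properties as AllPairs
open import Data.List.Relation.Unary.Any using (Any; here; there)
import Data.List.Relation.Unary.Any as Any
open import Data.List.Relation.Unary.Any.Properties using (lookup-index)
open import Data.List.Relation.Unary.Unique.Propositional using (Unique)
import Data.List.Relation.Unary.Unique.Propositional.Properties as Un
open import Data.Maybe using (Maybe; just; nothing)
import Data.Maybe as Maybe
import Data.Maybe.Properties as Maybe
open import Data.Nat using (ℕ; zero; suc; _+_; _*_; _∸_; _^_; _≤_; _<_; z≤n; s≤s; NonZero; _≤?_; _<?_; _≟_; _!; pred)
open import Data.Nat.Combinatorics using (_C_; nC1≡n; nCk+nC[k+1]≡[n+1]C[k+1]; k>n⇒nCk≡0)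
open import Data.Nat.DivMod
  using (_mod_; _%_; %-distribˡ-+; %-distribˡ-*; m<n⇒m%n≡m; m%n<n; [m+kn]%n≡m%n; m≡m%n+[m/n]*n; m<n*o⇒m/o<n)
  renaming (_/_ to _div_)
open import Data.Nat.Divisibility using (_∣_; divides; ∣-trans; m∣m*n; m≤n⇒m!∣n!)
open import Data.Nat.Properties
  using (≤-refl; ≤-trans; ≤-reflexive; <⇒≤; <⇒≱; ≰⇒>; ≮⇒≥; ≤∧≢⇒<; <-≤-trans; <-irrefl; <-trans; ≤-antisym; m≤m+n; m≤n+m
        ; n≤1+n; n<1+n; m≤n⇒m≤1+n; +-mono-≤; +-monoˡ-≤; +-monoʳ-≤; +-cancelˡ-≤; +-cancelʳ-≤; +-cancelˡ-≡
        ; *-mono-≤; *-monoˡ-≤; *-monoʳ-≤; +-comm; +-assoc; *-comm; *-assoc; *-distribˡ-+; *-distribʳ-+; +-identityʳ; +-suc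
        ; *-identityʳ; *-identityˡ; *-zeroʳ; +-0-isCommutativeMonoid; suc-injective; m∸n+n≡m; m+[n∸m]≡n; _!≢0; module ≤-Reasoning)
import Data.Nat.Properties as ℕ
open import Data.Nat.Tactic.RingSolver using (solve-∀)
open import Data.Product using (∃; _×_; _,_; proj₁; proj₂)
import Data.Product.Properties as Product
open import Data.Rational using (ℚ; 0ℚ; 1ℚ; _/_)
import Data.Rational as Q
import Data.Rational.Properties as Q
import Data.Rational.Unnormalised as Qᵘ
import Data.Rational.Unnormalised.Properties as Qᵘ
open import Data.Sum using (_⊎_; inj₁; inj₂)
open import Data.Unit using (⊤; tt)
open import Data.Vec using (Vec; []; _∷_; lookup; tabulate; _[_]≔_; zipWith; toList)
import Data.Vec as V
import Data.Vec.Properties as V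
import Data.Vec.Relation.Unary.All as VAll
import Data.Vec.Relation.Unary.Any as VAny
open import Function using (_∘_; id)
open import Relation.Binary.Definitions using (DecidableEquality; tri<; tri≈; tri>)
open import Relation.Binary.PropositionalEquality
  using (_≡_; _≢_; refl; sym; trans; cong; cong₂; subst; subst₂; isEquivalence; module ≡-Reasoning)
open import Relation.Nullary using (¬_; Dec; yes; no; contradiction; ¬?; _×-dec_; _→-dec_)
open import Relation.Nullary.Decidable using (⌊_⌋)

-- Finite sums

-- Codes replace arbitrary k-sets because a role on an edge then proposes exactly one block, which
-- is proposed by each of its t-subsets alike. All t-subsets of a block must agree, also those in 𝓑.
-- Hence blocks of one round share no t-set, and the events by which different roles cover an edge
-- exclude each other, so that their indicators simply add up.
--
-- The obstacle is independence. At every position a code is twisted by a random affine map v ↦ γ v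
-- + h, whose gain γ takes G values with invertible differences. Resampling a single twist shows
-- that any particular coincidence of explored vertices has probability at most 1/G. The number of
-- possible coincidences is bounded in terms of k, t and the number of rounds, so G can be fixed
-- before N. The codes are then chosen once, by averaging, and edges with a coincidence in their
-- history are given up.
--
-- The recursion for u closes only on products: for distinct edges with a common history free of
-- coincidences, the probability that those of E are free and those of F reserved is u ^ |E| δ ^
-- |F|. Expanding the edges of E one by one turns such a product after a round into products before
-- it.

module Sum {C : Set} {_⊕_ : Op₂ C} {𝟘 : C} (isMonoid : IsCommutativeMonoid _≡_ _⊕_ 𝟘) where
  private
    module M = IsCommutativeMonoid isMonoid
    semigroup : CommutativeSemigroup _ _
    semigroup = record { isCommutativeSemigroup = M.isCommutativeSemigroup }
  open Algebra.Properties.CommutativeSemigroup semigroup using (interchange)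

  ∑ : {A : Set} → List A → (A → C) → C
  ∑ [] f = 𝟘
  ∑ (x ∷ xs) f = f x ⊕ ∑ xs f

  module _ {A : Set} where
    ∑-cong-∈ : (xs : List A) {f g : A → C} → (∀ {x} → x ∈ˡ xs → f x ≡ g x) → ∑ xs f ≡ ∑ xs g
    ∑-cong-∈ [] e = refl
    ∑-cong-∈ (x ∷ xs) e = cong₂ _⊕_ (e (here refl)) (∑-cong-∈ xs (e ∘ there))

    ∑-cong : (xs : List A) {f g : A → C} → (∀ x → f x ≡ g x) → ∑ xs f ≡ ∑ xs g
    ∑-cong xs e = ∑-cong-∈ xs (λ {x} _ → e x)

    ∑-zero : (xs : List A) → ∑ xs (λ _ → 𝟘) ≡ 𝟘
    ∑-zero [] = refl
    ∑-zero (x ∷ xs) = trans (M.identityˡ _) (∑-zero xs)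

    ∑-⊕ : (xs : List A) (f g : A → C) → ∑ xs (λ x → f x ⊕ g x) ≡ ∑ xs f ⊕ ∑ xs g
    ∑-⊕ [] f g = sym (M.identityˡ 𝟘)
    ∑-⊕ (x ∷ xs) f g = trans (cong ((f x ⊕ g x) ⊕_) (∑-⊕ xs f g)) (interchange _ _ _ _)

    ∑-++ : (xs ys : List A) (f : A → C) → ∑ (xs ++ ys) f ≡ ∑ xs f ⊕ ∑ ys f
    ∑-++ [] ys f = sym (M.identityˡ _)
    ∑-++ (x ∷ xs) ys f = trans (cong (f x ⊕_) (∑-++ xs ys f)) (sym (M.assoc _ _ _))

  ∑-map : {A B : Set} (h : A → B) (xs : List A) (f : B → C) → ∑ (map h xs) f ≡ ∑ xs (f ∘ h)
  ∑-map h [] f = refl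
  ∑-map h (x ∷ xs) f = cong (f (h x) ⊕_) (∑-map h xs f)

  ∑-concatMap : {A B : Set} (h : A → List B) (xs : List A) (f : B → C) →
    ∑ (concatMap h xs) f ≡ ∑ xs (λ x → ∑ (h x) f)
  ∑-concatMap h [] f = refl
  ∑-concatMap h (x ∷ xs) f = trans (∑-++ (h x) (concatMap h xs) f) (cong (∑ (h x) f ⊕_) (∑-concatMap h xs f))

  ∑-swap : {A B : Set} (xs : List A) (ys : List B) (f : A → B → C) →
    ∑ xs (λ x → ∑ ys (f x)) ≡ ∑ ys (λ y → ∑ xs (λ x → f x y))
  ∑-swap [] ys f = sym (∑-zero ys)
  ∑-swap (x ∷ xs) ys f = trans (cong (∑ ys (f x) ⊕_) (∑-swap xs ys f)) (sym (∑-⊕ ys (f x) (λ y → ∑ xs (λ z → f z y))))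

open Sum +-0-isCommutativeMonoid

ind : {P : Set} → Dec P → ℕ
ind (yes _) = 1
ind (no _) = 0

ind-no : {P : Set} (p : Dec P) → ¬ P → ind p ≡ 0
ind-no (yes p) ¬p = contradiction p ¬p
ind-no (no _) _ = refl

ind≡0 : {P : Set} (p : Dec P) → ind p ≡ 0 → ¬ P
ind≡0 (no ¬p) _ = ¬p

module _ {A : Set} where
  ∑-mono-∈ : (xs : List A) {f g : A → ℕ} → (∀ {x} → x ∈ˡ xs → f x ≤ g x) → ∑ xs f ≤ ∑ xs g
  ∑-mono-∈ [] e = z≤n
  ∑-mono-∈ (x ∷ xs) e = +-mono-≤ (e (here refl)) (∑-mono-∈ xs (e ∘ there))

  ∑-mono : (xs : List A) {f g : A → ℕ} → (∀ x → f x ≤ g x) → ∑ xs f ≤ ∑ xs g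
  ∑-mono xs e = ∑-mono-∈ xs (λ {x} _ → e x)

  ∑-const : (xs : List A) (c : ℕ) → ∑ xs (λ _ → c) ≡ length xs * c
  ∑-const [] c = refl
  ∑-const (x ∷ xs) c = cong (c +_) (∑-const xs c)

  *-∑ : (c : ℕ) (xs : List A) (f : A → ℕ) → c * ∑ xs f ≡ ∑ xs (λ x → c * f x)
  *-∑ c [] f = *-zeroʳ c
  *-∑ c (x ∷ xs) f = trans (*-distribˡ-+ c (f x) (∑ xs f)) (cong (c * f x +_) (*-∑ c xs f))

  ∑≡0 : (xs : List A) (f : A → ℕ) → ∑ xs f ≡ 0 → ∀ {x} → x ∈ˡ xs → f x ≡ 0
  ∑≡0 (x ∷ xs) f e (here refl) with f x
  ... | zero = refl
  ∑≡0 (x ∷ xs) f e (there m) with f x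
  ... | zero = ∑≡0 xs f e m

  ∑-ind-filter : {P : A → Set} (P? : ∀ x → Dec (P x)) (xs : List A) → ∑ xs (λ x → ind (P? x)) ≡ length (filter P? xs)
  ∑-ind-filter P? [] = refl
  ∑-ind-filter P? (x ∷ xs) with P? x
  ... | yes _ = cong suc (∑-ind-filter P? xs)
  ... | no _ = ∑-ind-filter P? xs

  -- Averaging in a strict form: it rules out the empty list, and it survives the removal of an
  -- element above the mean. `∑-pigeonhole` reduces to it after inspecting one element.
  ∑-pigeonhole-< : (xs : List A) (f : A → ℕ) (K B : ℕ) → K * ∑ xs f < length xs * B → ∃ λ x → x ∈ˡ xs × K * f x ≤ B
  ∑-pigeonhole-< [] f K B ()
  ∑-pigeonhole-< (x ∷ xs) f K B lt with K * f x ≤? B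
  ... | yes le = x , here refl , le
  ... | no gt with ∑-pigeonhole-< xs f K B (≰⇒> λ ge → <⇒≱ lt
           (≤-trans (+-mono-≤ (<⇒≤ (≰⇒> gt)) ge) (≤-reflexive (sym (*-distribˡ-+ K (f x) (∑ xs f))))))
  ... | y , m , le = y , there m , le

  ∑-pigeonhole : (x : A) (xs : List A) (f : A → ℕ) (K B : ℕ) → K * ∑ (x ∷ xs) f ≤ length (x ∷ xs) * B →
    ∃ λ y → y ∈ˡ x ∷ xs × K * f y ≤ B
  ∑-pigeonhole x xs f K B le with K * f x ≤? B
  ... | yes p = x , here refl , p
  ... | no gt with ∑-pigeonhole-< xs f K B (≰⇒> λ ge → <⇒≱ (≰⇒> gt)
           (+-cancelʳ-≤ (length xs * B) _ _ (≤-trans (+-monoʳ-≤ (K * f x) ge)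
             (≤-trans (≤-reflexive (sym (*-distribˡ-+ K (f x) (∑ xs f)))) le))))
  ... | y , m , q = y , there m , q

  remove-∈ : (as : List A) {bs : List A} {x y : A} → y ∈ˡ as ++ x ∷ bs → y ≢ x → y ∈ˡ as ++ bs
  remove-∈ [] (here e) ne = contradiction e ne
  remove-∈ [] (there m) ne = m
  remove-∈ (a ∷ as) (here e) ne = here e
  remove-∈ (a ∷ as) (there m) ne = there (remove-∈ as m ne)

  length-mono-⊆ : (xs ys : List A) → Unique xs → (∀ {x} → x ∈ˡ xs → x ∈ˡ ys) → length xs ≤ length ys
  length-mono-⊆ [] ys _ _ = z≤n
  length-mono-⊆ (x ∷ xs) ys (x∉ ∷ u) sub with ∈-∃++ (sub (here refl))
  ... | as , bs , refl = ≤-trans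
          (s≤s (length-mono-⊆ xs (as ++ bs) u
            (λ m → remove-∈ as (sub (there m)) (λ e → All.lookup x∉ m (sym e)))))
          (≤-reflexive (begin
            suc (length (as ++ bs)) ≡⟨ cong suc (Lp.length-++ as) ⟩
            suc (length as + length bs) ≡⟨ sym (+-suc (length as) (length bs)) ⟩
            length as + length (x ∷ bs) ≡⟨ sym (Lp.length-++ as) ⟩
            length (as ++ x ∷ bs) ∎))
    where open ≡-Reasoning

  Unique-map-∈ : {B : Set} (f : A → B) (xs : List A) → (∀ {x y} → x ∈ˡ xs → y ∈ˡ xs → f x ≡ f y → x ≡ y) →
    Unique xs → Unique (map f xs)
  Unique-map-∈ f [] inj [] = []
  Unique-map-∈ f (x ∷ xs) inj (x∉ ∷ u) =
    All.tabulate (λ m e → case-map (∈-map⁻ f m) e) ∷ Unique-map-∈ f xs (λ p q → inj (there p) (there q)) u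
    where
    case-map : ∀ {y} → (∃ λ z → z ∈ˡ xs × y ≡ f z) → f x ≢ y
    case-map (z , m , refl) e = All.lookup x∉ m (inj (here refl) (there m) e)

-- All collision probabilities are bounded in this way: the twists in the event are determined by a
-- datum with only `M` values.
∑-ind-injective : {A : Set} {P : A → Set} (P? : ∀ x → Dec (P x)) (xs : List A) → Unique xs → (M : ℕ) (f : A → Fin M) →
  (∀ {x y} → P x → P y → f x ≡ f y → x ≡ y) → ∑ xs (λ x → ind (P? x)) ≤ M
∑-ind-injective P? xs u M f inj = begin
  ∑ xs (λ x → ind (P? x)) ≡⟨ ∑-ind-filter P? xs ⟩
  length (filter P? xs) ≡⟨ sym (Lp.length-map f (filter P? xs)) ⟩
  length (map f (filter P? xs)) ≤⟨ length-mono-⊆ _ (allFin M)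
    (Unique-map-∈ f _ (λ p q → inj (proj₂ (∈-filter⁻ P? {xs = xs} p)) (proj₂ (∈-filter⁻ P? {xs = xs} q))) (Un.filter⁺ P? u))
    (λ {y} _ → ∈-allFin y) ⟩
  length (allFin M) ≡⟨ Lp.length-tabulate id ⟩
  M ∎
  where open ≤-Reasoning

-- Sums over vectors

vectors : {A : Set} → List A → (n : ℕ) → List (Vec A n)
vectors L zero = [] ∷ []
vectors L (suc n) = concatMap (λ a → map (a ∷_) (vectors L n)) L

∑-vectors : {A : Set} (L : List A) (n : ℕ) (f : Vec A (suc n) → ℕ) →
  ∑ (vectors L (suc n)) f ≡ ∑ L (λ a → ∑ (vectors L n) (λ v → f (a ∷ v)))
∑-vectors L n f = trans (∑-concatMap _ L f) (∑-cong L (λ a → ∑-map (a ∷_) (vectors L n) f))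

length≡∑ : {A : Set} (xs : List A) → length xs ≡ ∑ xs (λ _ → 1)
length≡∑ xs = sym (trans (∑-const xs 1) (*-identityʳ (length xs)))

length-vectors : {A : Set} (L : List A) (n : ℕ) → length (vectors L n) ≡ length L ^ n
length-vectors L zero = refl
length-vectors L (suc n) = begin
  length (vectors L (suc n)) ≡⟨ length≡∑ (vectors L (suc n)) ⟩
  ∑ (vectors L (suc n)) (λ _ → 1) ≡⟨ ∑-vectors L n _ ⟩
  ∑ L (λ _ → ∑ (vectors L n) (λ _ → 1)) ≡⟨ ∑-cong L (λ _ → trans (sym (length≡∑ (vectors L n))) (length-vectors L n)) ⟩
  ∑ L (λ _ → length L ^ n) ≡⟨ ∑-const L _ ⟩
  length L * length L ^ n ∎
  where open ≡-Reasoning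

∈-vectors⁺ : {A : Set} {L : List A} {n : ℕ} (v : Vec A n) → (∀ i → lookup v i ∈ˡ L) → v ∈ˡ vectors L n
∈-vectors⁺ [] _ = here refl
∈-vectors⁺ {L = L} (a ∷ v) m =
  ∈-concatMap⁺ _ (Any.map (λ { refl → ∈-map⁺ (a ∷_) (∈-vectors⁺ v (m ∘ suc)) }) (m zero))

∈-vectors⁻ : {A : Set} {L : List A} (n : ℕ) {v : Vec A n} → v ∈ˡ vectors L n → ∀ i → lookup v i ∈ˡ L
∈-vectors⁻ {L = L} (suc n) {v} m i with find (∈-concatMap⁻ (λ a → map (a ∷_) (vectors L n)) {xs = L} m)
... | a , a∈ , m′ with ∈-map⁻ (a ∷_) m′
∈-vectors⁻ (suc n) m zero | a , a∈ , m′ | w , w∈ , refl = a∈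
∈-vectors⁻ (suc n) m (suc i) | a , a∈ , m′ | w , w∈ , refl = ∈-vectors⁻ n w∈ i

Unique-vectors : {A : Set} {L : List A} (n : ℕ) → Unique L → Unique (vectors L n)
Unique-vectors zero _ = [] ∷ []
Unique-vectors {A} {L} (suc n) u = go L u
  where
  go : (M : List A) → Unique M → Unique (concatMap (λ a → map (a ∷_) (vectors L n)) M)
  go [] _ = []
  go (a ∷ M) (a∉ ∷ uM) = Un.++⁺ (Un.map⁺ (λ { refl → refl }) (Unique-vectors n u)) (go M uM) disj
    where
    heads : (M′ : List A) → ∀ {v} → v ∈ˡ concatMap (λ b → map (b ∷_) (vectors L n)) M′ → V.head v ∈ˡ M′
    heads (b ∷ M′) m with ∈-++⁻ (map (b ∷_) (vectors L n)) m
    ... | inj₂ q = there (heads M′ q)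
    ... | inj₁ q with ∈-map⁻ (b ∷_) q
    ...   | _ , _ , refl = here refl
    disj : ∀ {v} → ¬ (v ∈ˡ map (a ∷_) (vectors L n) × v ∈ˡ concatMap (λ b → map (b ∷_) (vectors L n)) M)
    disj (p , q) with ∈-map⁻ (a ∷_) p
    ... | _ , _ , refl = All.lookup a∉ (heads M q) refl

-- Conditioning on all coordinates but one: a bound for the resampling of coordinate `i` that holds
-- whatever the others are also holds on average.
∑-vectors-resample : {A : Set} (L : List A) (n : ℕ) (i : Fin n) (K : ℕ) (f : Vec A n → ℕ) →
  (∀ v → K * ∑ L (λ a → f (v [ i ]≔ a)) ≤ length L) → K * ∑ (vectors L n) f ≤ length L ^ n
∑-vectors-resample L (suc n) zero K f h = begin
  K * ∑ (vectors L (suc n)) f ≡⟨ cong (K *_) (∑-vectors L n f) ⟩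
  K * ∑ L (λ a → ∑ (vectors L n) (λ v → f (a ∷ v))) ≡⟨ cong (K *_) (∑-swap L (vectors L n) (λ a v → f (a ∷ v))) ⟩
  K * ∑ (vectors L n) (λ v → ∑ L (λ a → f (a ∷ v))) ≡⟨ *-∑ K (vectors L n) _ ⟩
  ∑ (vectors L n) (λ v → K * ∑ L (λ a → f (a ∷ v))) ≤⟨ ∑-mono-∈ (vectors L n) (λ {v} _ → small v) ⟩
  ∑ (vectors L n) (λ _ → length L) ≡⟨ ∑-const (vectors L n) (length L) ⟩
  length (vectors L n) * length L ≡⟨ cong (_* length L) (length-vectors L n) ⟩
  length L ^ n * length L ≡⟨ *-comm (length L ^ n) (length L) ⟩
  length L ^ suc n ∎
  where
  open ≤-Reasoning
  small : ∀ v → K * ∑ L (λ a → f (a ∷ v)) ≤ length L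
  small v = helper L refl
    where
    -- The hypothesis speaks of a whole vector whose first entry gets overwritten. Any member of `L`
    -- may fill that entry, and an empty `L` gives an empty sum.
    helper : ∀ M → M ≡ L → K * ∑ L (λ a → f (a ∷ v)) ≤ length L
    helper [] refl = ≤-reflexive (*-zeroʳ K)
    helper (a ∷ _) refl = h (a ∷ v)
∑-vectors-resample L (suc n) (suc i) K f h = begin
  K * ∑ (vectors L (suc n)) f ≡⟨ cong (K *_) (∑-vectors L n f) ⟩
  K * ∑ L (λ a → ∑ (vectors L n) (λ v → f (a ∷ v))) ≡⟨ *-∑ K L _ ⟩
  ∑ L (λ a → K * ∑ (vectors L n) (λ v → f (a ∷ v))) ≤⟨ ∑-mono L (λ a → ∑-vectors-resample L n i K (λ v → f (a ∷ v)) (λ v → h (a ∷ v))) ⟩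
  ∑ L (λ _ → length L ^ n) ≡⟨ ∑-const L _ ⟩
  length L ^ suc n ∎
  where open ≤-Reasoning

-- Residues modulo N

module Residues (M : ℕ) where
  N : ℕ
  N = suc M

  ν : ℕ → Fin N
  ν a = a mod N

  infixl 6 _⊕_
  infixl 7 _⊗_
  _⊕_ _⊗_ : Op₂ (Fin N)
  x ⊕ y = ν (toℕ x + toℕ y)
  x ⊗ y = ν (toℕ x * toℕ y)

  ⊖_ : Fin N → Fin N
  ⊖ x = ν (N ∸ toℕ x)

  toℕ-ν : ∀ a → toℕ (ν a) ≡ a % N
  toℕ-ν a = F.toℕ-fromℕ< (m%n<n a N)

  ν-cong : ∀ a b → a % N ≡ b % N → ν a ≡ ν b
  ν-cong a b e = F.toℕ-injective (trans (toℕ-ν a) (trans e (sym (toℕ-ν b))))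

  ν-toℕ : ∀ x → ν (toℕ x) ≡ x
  ν-toℕ x = F.toℕ-injective (trans (toℕ-ν (toℕ x)) (m<n⇒m%n≡m (F.toℕ<n x)))

  ν-+ : ∀ a b → ν a ⊕ ν b ≡ ν (a + b)
  ν-+ a b = trans (cong₂ (λ x y → ν (x + y)) (toℕ-ν a) (toℕ-ν b)) (ν-cong (a % N + b % N) (a + b) (sym (%-distribˡ-+ a b N)))

  ν-* : ∀ a b → ν a ⊗ ν b ≡ ν (a * b)
  ν-* a b = trans (cong₂ (λ x y → ν (x * y)) (toℕ-ν a) (toℕ-ν b)) (ν-cong (a % N * (b % N)) (a * b) (sym (%-distribˡ-* a b N)))

  ν-N* : ∀ c → ν (c * N) ≡ ν 0
  ν-N* c = ν-cong (c * N) 0 ([m+kn]%n≡m%n 0 c N)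

  -- Since `ν` is onto, ring identities need to be checked on representatives only, where they are
  -- identities of natural numbers.
  reflect₂ : {P : Fin N → Fin N → Set} → (∀ a b → P (ν a) (ν b)) → ∀ x y → P x y
  reflect₂ {P} h x y = subst₂ P (ν-toℕ x) (ν-toℕ y) (h (toℕ x) (toℕ y))

  reflect₃ : {P : Fin N → Fin N → Fin N → Set} → (∀ a b c → P (ν a) (ν b) (ν c)) → ∀ x y z → P x y z
  reflect₃ {P} h x y z = subst (P x y) (ν-toℕ z) (reflect₂ {λ x y → P x y (ν (toℕ z))} (λ a b → h a b (toℕ z)) x y)

  ⊕-assoc : ∀ x y z → (x ⊕ y) ⊕ z ≡ x ⊕ (y ⊕ z)
  ⊕-assoc = reflect₃ λ a b c → begin
    (ν a ⊕ ν b) ⊕ ν c ≡⟨ cong (_⊕ ν c) (ν-+ a b) ⟩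
    ν (a + b) ⊕ ν c ≡⟨ ν-+ (a + b) c ⟩
    ν (a + b + c) ≡⟨ cong ν (+-assoc a b c) ⟩
    ν (a + (b + c)) ≡⟨ sym (ν-+ a (b + c)) ⟩
    ν a ⊕ ν (b + c) ≡⟨ cong (ν a ⊕_) (sym (ν-+ b c)) ⟩
    ν a ⊕ (ν b ⊕ ν c) ∎
    where open ≡-Reasoning

  ⊗-assoc : ∀ x y z → (x ⊗ y) ⊗ z ≡ x ⊗ (y ⊗ z)
  ⊗-assoc = reflect₃ λ a b c → begin
    (ν a ⊗ ν b) ⊗ ν c ≡⟨ cong (_⊗ ν c) (ν-* a b) ⟩
    ν (a * b) ⊗ ν c ≡⟨ ν-* (a * b) c ⟩
    ν (a * b * c) ≡⟨ cong ν (*-assoc a b c) ⟩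
    ν (a * (b * c)) ≡⟨ sym (ν-* a (b * c)) ⟩
    ν a ⊗ ν (b * c) ≡⟨ cong (ν a ⊗_) (sym (ν-* b c)) ⟩
    ν a ⊗ (ν b ⊗ ν c) ∎
    where open ≡-Reasoning

  ⊕-comm : ∀ x y → x ⊕ y ≡ y ⊕ x
  ⊕-comm x y = cong ν (+-comm (toℕ x) (toℕ y))

  ⊗-comm : ∀ x y → x ⊗ y ≡ y ⊗ x
  ⊗-comm x y = cong ν (*-comm (toℕ x) (toℕ y))

  ⊗-distribˡ : ∀ x y z → x ⊗ (y ⊕ z) ≡ (x ⊗ y) ⊕ (x ⊗ z)
  ⊗-distribˡ = reflect₃ λ a b c → begin
    ν a ⊗ (ν b ⊕ ν c) ≡⟨ cong (ν a ⊗_) (ν-+ b c) ⟩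
    ν a ⊗ ν (b + c) ≡⟨ ν-* a (b + c) ⟩
    ν (a * (b + c)) ≡⟨ cong ν (*-distribˡ-+ a b c) ⟩
    ν (a * b + a * c) ≡⟨ sym (ν-+ (a * b) (a * c)) ⟩
    ν (a * b) ⊕ ν (a * c) ≡⟨ sym (cong₂ _⊕_ (ν-* a b) (ν-* a c)) ⟩
    (ν a ⊗ ν b) ⊕ (ν a ⊗ ν c) ∎
    where open ≡-Reasoning

  ⊕-identityˡ : ∀ x → ν 0 ⊕ x ≡ x
  ⊕-identityˡ x = trans (cong (ν 0 ⊕_) (sym (ν-toℕ x))) (trans (ν-+ 0 (toℕ x)) (ν-toℕ x))

  ⊗-identityˡ : ∀ x → ν 1 ⊗ x ≡ x
  ⊗-identityˡ x = trans (cong (ν 1 ⊗_) (sym (ν-toℕ x)))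
    (trans (ν-* 1 (toℕ x)) (trans (cong ν (*-identityˡ (toℕ x))) (ν-toℕ x)))

  ⊖-inverseˡ : ∀ x → (⊖ x) ⊕ x ≡ ν 0
  ⊖-inverseˡ x = begin
    ν (N ∸ toℕ x) ⊕ x ≡⟨ cong (ν (N ∸ toℕ x) ⊕_) (sym (ν-toℕ x)) ⟩
    ν (N ∸ toℕ x) ⊕ ν (toℕ x) ≡⟨ ν-+ (N ∸ toℕ x) (toℕ x) ⟩
    ν (N ∸ toℕ x + toℕ x) ≡⟨ cong ν (m∸n+n≡m (<⇒≤ (F.toℕ<n x))) ⟩
    ν N ≡⟨ cong ν (sym (*-identityˡ N)) ⟩
    ν (1 * N) ≡⟨ ν-N* 1 ⟩
    ν 0 ∎
    where open ≡-Reasoning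

  private
    comm⇒ʳ : {_·_ : Op₂ (Fin N)} → (∀ x y → x · y ≡ y · x) → ∀ {e} → (∀ x → e · x ≡ x) → ∀ x → x · e ≡ x
    comm⇒ʳ comm id x = trans (comm x _) (id x)

  isCommutativeRing : IsCommutativeRing _≡_ _⊕_ _⊗_ ⊖_ (ν 0) (ν 1)
  isCommutativeRing = record
    { isRing = record
      { +-isAbelianGroup = record
        { isGroup = record
          { isMonoid = record
            { isSemigroup = record
              { isMagma = record { isEquivalence = isEquivalence ; ∙-cong = cong₂ _⊕_ }
              ; assoc = ⊕-assoc }
            ; identity = ⊕-identityˡ , comm⇒ʳ {_⊕_} ⊕-comm ⊕-identityˡ }
          ; inverse = ⊖-inverseˡ , λ x → trans (⊕-comm x (⊖ x)) (⊖-inverseˡ x)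
          ; ⁻¹-cong = cong ⊖_ }
        ; comm = ⊕-comm }
      ; *-cong = cong₂ _⊗_
      ; *-assoc = ⊗-assoc
      ; *-identity = ⊗-identityˡ , comm⇒ʳ {_⊗_} ⊗-comm ⊗-identityˡ
      ; distrib = ⊗-distribˡ , λ x y z → trans (⊗-comm (y ⊕ z) x)
          (trans (⊗-distribˡ x y z) (cong₂ _⊕_ (⊗-comm x y) (⊗-comm x z))) }
    ; *-comm = ⊗-comm }

  commutativeRing : CommutativeRing _ _
  commutativeRing = record { isCommutativeRing = isCommutativeRing }
  private module R = CommutativeRing commutativeRing
  open Algebra.Properties.Ring R.ring using (-‿distribʳ-*; -‿distribˡ-*; ⁻¹-anti-homo‿-; -‿involutive)

  add-sub : ∀ x y → (x ⊕ y) ⊕ (⊖ y) ≡ x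
  add-sub x y = trans (⊕-assoc x y (⊖ y)) (trans (cong (x ⊕_) (R.-‿inverseʳ y)) (R.+-identityʳ x))

  sub-ν : ∀ a b → b ≤ a → ν a ⊕ (⊖ ν b) ≡ ν (a ∸ b)
  sub-ν a b le = trans (cong (_⊕ (⊖ ν b)) (trans (cong ν (sym (m∸n+n≡m le))) (sym (ν-+ (a ∸ b) b)))) (add-sub (ν (a ∸ b)) (ν b))

  -- N ≡ 1 (mod K!) makes 1, …, K invertible: if K! = d e and N - 1 = q K!, then d · (- e q) = - (N - 1) = 1.
  unit : ∀ {K} → K ! ∣ M → ∀ d → 1 ≤ d → d ≤ K → ∃ λ u → ν d ⊗ u ≡ ν 1
  unit {K} dvd (suc d) _ d≤K with ∣-trans (∣-trans (m∣m*n {suc d} (d !)) (m≤n⇒m!∣n! d≤K)) dvd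
  ... | divides w e = ⊖ ν w , (begin
    ν (suc d) ⊗ (⊖ ν w) ≡⟨ sym (-‿distribʳ-* (ν (suc d)) (ν w)) ⟩
    ⊖ (ν (suc d) ⊗ ν w) ≡⟨ cong ⊖_ (trans (ν-* (suc d) w) (cong ν (trans (*-comm (suc d) w) (sym e)))) ⟩
    ⊖ ν M ≡⟨ sym (⊕-identityˡ _) ⟩
    ν 0 ⊕ (⊖ ν M) ≡⟨ cong (_⊕ (⊖ ν M)) (trans (sym (ν-N* 1)) (cong ν (*-identityˡ N))) ⟩
    ν N ⊕ (⊖ ν M) ≡⟨ cong (_⊕ (⊖ ν M)) (sym (ν-+ 1 M)) ⟩
    (ν 1 ⊕ ν M) ⊕ (⊖ ν M) ≡⟨ add-sub (ν 1) (ν M) ⟩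
    ν 1 ∎)
    where
    open ≡-Reasoning

  -- Up to sign the difference is one of 1, ..., K; if a < b the sign passes to the inverse.
  unit-diff : ∀ {K} → K ! ∣ M → ∀ a b → a ≢ b → a < K → b < K → ∃ λ u → (ν a ⊕ (⊖ ν b)) ⊗ u ≡ ν 1
  unit-diff {K} dvd a b a≢b a<K b<K with ℕ.≤-total b a
  ... | inj₁ b≤a with unit dvd (a ∸ b) (ℕ.m<n⇒0<n∸m (≤∧≢⇒< b≤a (a≢b ∘ sym))) (≤-trans (ℕ.m∸n≤m a b) (<⇒≤ a<K))
  ...   | u , e = u , trans (cong (_⊗ u) (sub-ν a b b≤a)) e
  unit-diff {K} dvd a b a≢b a<K b<K | inj₂ a≤b with unit dvd (b ∸ a) (ℕ.m<n⇒0<n∸m (≤∧≢⇒< a≤b a≢b)) (≤-trans (ℕ.m∸n≤m b a) (<⇒≤ b<K))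
  ...   | u , e = ⊖ u , (begin
    (ν a ⊕ (⊖ ν b)) ⊗ (⊖ u) ≡⟨ cong (λ z → z ⊗ (⊖ u)) (sym (⁻¹-anti-homo‿- (ν b) (ν a))) ⟩
    (⊖ (ν b ⊕ (⊖ ν a))) ⊗ (⊖ u) ≡⟨ sym (-‿distribˡ-* (ν b ⊕ (⊖ ν a)) (⊖ u)) ⟩
    ⊖ ((ν b ⊕ (⊖ ν a)) ⊗ (⊖ u)) ≡⟨ -‿distribʳ-* (ν b ⊕ (⊖ ν a)) (⊖ u) ⟩
    (ν b ⊕ (⊖ ν a)) ⊗ (⊖ (⊖ u)) ≡⟨ cong₂ _⊗_ (sub-ν b a a≤b) (-‿involutive u) ⟩
    ν (b ∸ a) ⊗ u ≡⟨ e ⟩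
    ν 1 ∎)
    where open ≡-Reasoning

-- Polynomial codes

-- A ring with sufficiently many units in place of a field: interpolation divides by differences of
-- the points `pt` only, and the twists by the gains `γ` and their differences.
record CodeField (k G N : ℕ) : Set where
  infixl 6 _⊕_
  infixl 7 _⊗_
  V : Set
  V = Fin N
  field
    _⊕_ _⊗_ : Op₂ V
    ⊖_ : V → V
    𝟘 𝟙 : V
    isCommutativeRing : IsCommutativeRing _≡_ _⊕_ _⊗_ ⊖_ 𝟘 𝟙
    pt : Fin k → V
    dinv : Fin k → Fin k → V
    dinv-inverse : ∀ {i j} → i ≢ j → (pt i ⊕ (⊖ pt j)) ⊗ dinv i j ≡ 𝟙
    γ γinv : Fin G → V
    γ-inverse : ∀ g → γ g ⊗ γinv g ≡ 𝟙
    γ-diff : ∀ {g g′} → g ≢ g′ → ∃ λ u → (γ g ⊕ (⊖ γ g′)) ⊗ u ≡ 𝟙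

module Codes {k G N : ℕ} (codeField : CodeField k G N) where
  open CodeField codeField public
  private
    commutativeRing : CommutativeRing _ _
    commutativeRing = record { isCommutativeRing = isCommutativeRing }
    module R = CommutativeRing commutativeRing
  open Algebra.Properties.Ring R.ring using (-‿distribʳ-*; -‿distribˡ-*; x∙y⁻¹≈ε⇒x≈y; -‿anti-homo-+; -‿involutive; +-cancelˡ; +-cancelʳ; xyx⁻¹≈y)
  open SemiringSolver R.commutativeSemiring using (solve; _:+_; _:*_; _:=_)

  sub-add : ∀ x y → x ⊕ (y ⊕ (⊖ x)) ≡ y
  sub-add x y = trans (sym (R.+-assoc x y (⊖ x))) (xyx⁻¹≈y x y)

  unit-cancel : ∀ {w u} → w ⊗ u ≡ 𝟙 → ∀ {x y} → w ⊗ x ≡ w ⊗ y → x ≡ y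
  unit-cancel {w} {u} e {x} {y} h = trans (expand x) (trans (cong (u ⊗_) h) (sym (expand y)))
    where
    expand : ∀ z → z ≡ u ⊗ (w ⊗ z)
    expand z = begin
      z ≡⟨ sym (R.*-identityˡ z) ⟩
      𝟙 ⊗ z ≡⟨ cong (_⊗ z) (sym e) ⟩
      (w ⊗ u) ⊗ z ≡⟨ solve 3 (λ w u z → (w :* u) :* z := u :* (w :* z)) refl w u z ⟩
      u ⊗ (w ⊗ z) ∎
      where open ≡-Reasoning

  -- A list of coefficients c₀, c₁, … stands for the polynomial c₀ + c₁ z + ….
  ev : List V → V → V
  ev [] z = 𝟘
  ev (c ∷ cs) z = c ⊕ z ⊗ ev cs z

  -- Synthetic division: the coefficients of (c(z) - c(a)) / (z - a).
  quotient : List V → V → List V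
  quotient [] a = []
  quotient (c ∷ []) a = []
  quotient (c ∷ cs@(_ ∷ _)) a = ev cs a ∷ quotient cs a

  -- Writing the point as a + w keeps c(z) = c(a) + (z - a) q(z) free of subtraction, so that the
  -- semiring solver applies.
  ev-quotient : ∀ cs a w → ev cs (a ⊕ w) ≡ ev cs a ⊕ w ⊗ ev (quotient cs a) (a ⊕ w)
  ev-quotient [] a w = sym (trans (R.+-identityˡ _) (R.zeroʳ w))
  ev-quotient (c ∷ []) a w = begin
    c ⊕ (a ⊕ w) ⊗ 𝟘 ≡⟨ cong (c ⊕_) (trans (R.zeroʳ _) (sym (R.zeroʳ a))) ⟩
    c ⊕ a ⊗ 𝟘 ≡⟨ sym (R.+-identityʳ _) ⟩
    (c ⊕ a ⊗ 𝟘) ⊕ 𝟘 ≡⟨ cong ((c ⊕ a ⊗ 𝟘) ⊕_) (sym (R.zeroʳ w)) ⟩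
    (c ⊕ a ⊗ 𝟘) ⊕ w ⊗ 𝟘 ∎
    where open ≡-Reasoning
  ev-quotient (c ∷ cs@(_ ∷ _)) a w = begin
    c ⊕ (a ⊕ w) ⊗ ev cs (a ⊕ w) ≡⟨ cong (λ e → c ⊕ (a ⊕ w) ⊗ e) (ev-quotient cs a w) ⟩
    c ⊕ (a ⊕ w) ⊗ (ev cs a ⊕ w ⊗ q)
      ≡⟨ solve 5 (λ c a w e q → c :+ (a :+ w) :* (e :+ w :* q) := (c :+ a :* e) :+ w :* (e :+ (a :+ w) :* q)) refl c a w (ev cs a) q ⟩
    (c ⊕ a ⊗ ev cs a) ⊕ w ⊗ (ev cs a ⊕ (a ⊕ w) ⊗ q) ∎
    where
    open ≡-Reasoning
    q = ev (quotient cs a) (a ⊕ w)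

  length-quotient : ∀ cs a → length (quotient cs a) ≡ pred (length cs)
  length-quotient [] a = refl
  length-quotient (c ∷ []) a = refl
  length-quotient (c ∷ cs@(_ ∷ _)) a = cong suc (length-quotient cs a)

  -- Divide both polynomials by z - `pt i` for the first point i of `S`: the quotients agree at the
  -- other points because differences of points are units, so zero divisors do no harm. Equality of
  -- functions is all that is claimed, and it suffices.
  ev-unique : (S : List (Fin k)) → Unique S → ∀ cs ds → length cs ≤ length S → length ds ≤ length S →
    (∀ {i} → i ∈ˡ S → ev cs (pt i) ≡ ev ds (pt i)) → ∀ z → ev cs z ≡ ev ds z
  ev-unique [] u [] [] _ _ h z = refl
  ev-unique (i ∷ S) (i∉ ∷ u) cs ds l₁ l₂ h z = begin
    ev cs z ≡⟨ cong (ev cs) (sym (sub-add a z)) ⟩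
    ev cs (a ⊕ w z) ≡⟨ ev-quotient cs a (w z) ⟩
    ev cs a ⊕ w z ⊗ ev (quotient cs a) (a ⊕ w z) ≡⟨ cong₂ (λ x y → x ⊕ w z ⊗ y) (h (here refl)) (ih (a ⊕ w z)) ⟩
    ev ds a ⊕ w z ⊗ ev (quotient ds a) (a ⊕ w z) ≡⟨ sym (ev-quotient ds a (w z)) ⟩
    ev ds (a ⊕ w z) ≡⟨ cong (ev ds) (sub-add a z) ⟩
    ev ds z ∎
    where
    open ≡-Reasoning
    a = pt i
    w : V → V
    w z = z ⊕ (⊖ a)
    ih : ∀ z → ev (quotient cs a) z ≡ ev (quotient ds a) z
    ih = ev-unique S u (quotient cs a) (quotient ds a)
      (≤-trans (≤-reflexive (length-quotient cs a)) (ℕ.pred-mono-≤ l₁))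
      (≤-trans (≤-reflexive (length-quotient ds a)) (ℕ.pred-mono-≤ l₂))
      (λ {j} m → unit-cancel (dinv-inverse {j} {i} (λ e → All.lookup i∉ m (sym e)))
        (+-cancelˡ (ev cs a) _ _ (begin
          ev cs a ⊕ w (pt j) ⊗ ev (quotient cs a) (pt j) ≡⟨ cong (λ y → ev cs a ⊕ w (pt j) ⊗ ev (quotient cs a) y) (sym (sub-add a (pt j))) ⟩
          ev cs a ⊕ w (pt j) ⊗ ev (quotient cs a) (a ⊕ w (pt j)) ≡⟨ sym (ev-quotient cs a (w (pt j))) ⟩
          ev cs (a ⊕ w (pt j)) ≡⟨ cong (ev cs) (sub-add a (pt j)) ⟩
          ev cs (pt j) ≡⟨ h (there m) ⟩
          ev ds (pt j) ≡⟨ cong (ev ds) (sym (sub-add a (pt j))) ⟩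
          ev ds (a ⊕ w (pt j)) ≡⟨ ev-quotient ds a (w (pt j)) ⟩
          ev ds a ⊕ w (pt j) ⊗ ev (quotient ds a) (a ⊕ w (pt j)) ≡⟨ cong₂ (λ x y → x ⊕ w (pt j) ⊗ ev (quotient ds a) y) (sym (h (here refl))) (sub-add a (pt j)) ⟩
          ev cs a ⊕ w (pt j) ⊗ ev (quotient ds a) (pt j) ∎)))

  -- The coefficients of y + (z + m) c(z).
  linear : V → V → List V → List V
  linear m y [] = y ∷ []
  linear m y (c ∷ cs) = (y ⊕ m ⊗ c) ∷ linear m c cs

  ev-linear : ∀ m y cs z → ev (linear m y cs) z ≡ y ⊕ (z ⊕ m) ⊗ ev cs z
  ev-linear m y [] z = cong (y ⊕_) (trans (R.zeroʳ z) (sym (R.zeroʳ (z ⊕ m))))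
  ev-linear m y (c ∷ cs) z = trans (cong (λ e → (y ⊕ m ⊗ c) ⊕ z ⊗ e) (ev-linear m c cs z))
    (solve 5 (λ m y c z e → (y :+ m :* c) :+ z :* (c :+ (z :+ m) :* e) := y :+ (z :+ m) :* (c :+ z :* e)) refl m y c z (ev cs z))

  length-linear : ∀ m y cs → length (linear m y cs) ≡ suc (length cs)
  length-linear m y [] = refl
  length-linear m y (c ∷ cs) = cong suc (length-linear m c cs)

  -- Newton's form: y + (z - `pt i`) times the interpolant of the divided differences at the
  -- remaining points.
  interpolate : ∀ {n} → Vec (Fin k × V) n → List V
  divided : Fin k → V → Fin k × V → Fin k × V
  divided i y (j , y′) = j , dinv j i ⊗ (y′ ⊕ (⊖ y))
  interpolate [] = []
  interpolate ((i , y) ∷ ps) = linear (⊖ pt i) y (interpolate (V.map (divided i y) ps))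

  length-interpolate : ∀ {n} (ps : Vec (Fin k × V) n) → length (interpolate ps) ≡ n
  length-interpolate [] = refl
  length-interpolate ((i , y) ∷ ps) = trans (length-linear (⊖ pt i) y (interpolate ps′)) (cong suc (length-interpolate ps′))
    where ps′ = V.map (divided i y) ps

  ev-interpolate : ∀ {n} (ps : Vec (Fin k × V) n) → (∀ {r s} → proj₁ (lookup ps r) ≡ proj₁ (lookup ps s) → r ≡ s) →
    ∀ r → ev (interpolate ps) (pt (proj₁ (lookup ps r))) ≡ proj₂ (lookup ps r)
  ev-interpolate ((i , y) ∷ ps) inj zero = begin
    ev (linear (⊖ pt i) y cs) (pt i) ≡⟨ ev-linear (⊖ pt i) y cs (pt i) ⟩
    y ⊕ (pt i ⊕ (⊖ pt i)) ⊗ e ≡⟨ cong (λ x → y ⊕ x ⊗ e) (R.-‿inverseʳ (pt i)) ⟩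
    y ⊕ 𝟘 ⊗ e ≡⟨ cong (y ⊕_) (R.zeroˡ e) ⟩
    y ⊕ 𝟘 ≡⟨ R.+-identityʳ y ⟩
    y ∎
    where
    open ≡-Reasoning
    cs = interpolate (V.map (divided i y) ps)
    e = ev cs (pt i)

  ev-interpolate ((i , y) ∷ ps) inj (suc r) = begin
    ev (linear (⊖ pt i) y cs) (pt j) ≡⟨ ev-linear (⊖ pt i) y cs (pt j) ⟩
    y ⊕ (pt j ⊕ (⊖ pt i)) ⊗ ev cs (pt j) ≡⟨ cong (λ x → y ⊕ (pt j ⊕ (⊖ pt i)) ⊗ x) ih ⟩
    y ⊕ (pt j ⊕ (⊖ pt i)) ⊗ (dinv j i ⊗ d) ≡⟨ cong (y ⊕_) (trans (sym (R.*-assoc _ _ d)) (cong (_⊗ d) (dinv-inverse j≢i))) ⟩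
    y ⊕ 𝟙 ⊗ d ≡⟨ cong (y ⊕_) (R.*-identityˡ d) ⟩
    y ⊕ (y′ ⊕ (⊖ y)) ≡⟨ sub-add y y′ ⟩
    y′ ∎
    where
    open ≡-Reasoning
    j = proj₁ (lookup ps r)
    y′ = proj₂ (lookup ps r)
    d = y′ ⊕ (⊖ y)
    j≢i : j ≢ i
    j≢i e with inj {suc r} {zero} e
    ... | ()
    qs = V.map (divided i y) ps
    cs = interpolate qs
    qs≡ : ∀ s → lookup qs s ≡ divided i y (lookup ps s)
    qs≡ s = V.lookup-map s (divided i y) ps
    ih : ev cs (pt j) ≡ dinv j i ⊗ d
    ih = trans (cong (ev cs ∘ pt) (sym (cong proj₁ (qs≡ r)))) (trans
      (ev-interpolate qs (λ {r} {s} e → F.suc-injective (inj (trans (sym (cong proj₁ (qs≡ r))) (trans e (cong proj₁ (qs≡ s)))))) r)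
      (cong proj₂ (qs≡ r)))

  Twist : Set
  Twist = Fin G × V

  π : Twist → V → V
  π (g , h) v = γ g ⊗ v ⊕ h

  π⁻¹ : Twist → V → V
  π⁻¹ (g , h) y = γinv g ⊗ (y ⊕ (⊖ h))

  π-π⁻¹ : ∀ p y → π p (π⁻¹ p y) ≡ y
  π-π⁻¹ (g , h) y = begin
    γ g ⊗ (γinv g ⊗ (y ⊕ (⊖ h))) ⊕ h ≡⟨ cong (_⊕ h) (trans (sym (R.*-assoc _ _ _)) (trans (cong (_⊗ (y ⊕ (⊖ h))) (γ-inverse g)) (R.*-identityˡ _))) ⟩
    (y ⊕ (⊖ h)) ⊕ h ≡⟨ R.+-comm _ h ⟩
    h ⊕ (y ⊕ (⊖ h)) ≡⟨ sub-add h y ⟩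
    y ∎
    where open ≡-Reasoning

  π-injective : ∀ p {v w} → π p v ≡ π p w → v ≡ w
  π-injective (g , h) e = unit-cancel (γ-inverse g) (+-cancelʳ h _ _ e)

  π⁻¹-π : ∀ p v → π⁻¹ p (π p v) ≡ v
  π⁻¹-π p v = π-injective p (π-π⁻¹ p (π p v))

  same-gain : ∀ {g h h′} v → π (g , h) v ≡ π (g , h′) v → h ≡ h′
  same-gain {g} v e = +-cancelˡ (γ g ⊗ v) _ _ e

  -- Maps with gains a and b that agree at v and w satisfy (v - w)(a - b) = 0, and a - b is a unit
  -- if a and b are different gains. This is why twists have gains besides shifts: fixing the image
  -- of one vertex still leaves a choice of gain, which moves every other vertex.
  two-point : ∀ {p p′ v w} → v ≢ w → π p v ≡ π p′ v → π p w ≡ π p′ w → p ≡ p′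
  two-point {g , h} {g′ , h′} {v} {w} v≢w e₁ e₂ with g F.≟ g′
  ... | yes refl = cong (g ,_) (same-gain v e₁)
  ... | no g≢g′ = contradiction (x∙y⁻¹≈ε⇒x≈y v w (unit-cancel (proj₂ (γ-diff g≢g′))
          (trans (R.*-comm _ _) (trans prod (sym (R.zeroʳ _)))))) v≢w
    where
    open ≡-Reasoning
    a = γ g
    b = γ g′
    cross : a ⊗ v ⊕ b ⊗ w ≡ b ⊗ v ⊕ a ⊗ w
    cross = +-cancelʳ (h ⊕ h′) _ _ (begin
      (a ⊗ v ⊕ b ⊗ w) ⊕ (h ⊕ h′) ≡⟨ solve 4 (λ x y h i → (x :+ y) :+ (h :+ i) := (x :+ h) :+ (y :+ i)) refl (a ⊗ v) (b ⊗ w) h h′ ⟩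
      (a ⊗ v ⊕ h) ⊕ (b ⊗ w ⊕ h′) ≡⟨ cong₂ _⊕_ e₁ (sym e₂) ⟩
      (b ⊗ v ⊕ h′) ⊕ (a ⊗ w ⊕ h) ≡⟨ solve 4 (λ x y h i → (x :+ i) :+ (y :+ h) := (x :+ y) :+ (h :+ i)) refl (b ⊗ v) (a ⊗ w) h h′ ⟩
      (b ⊗ v ⊕ a ⊗ w) ⊕ (h ⊕ h′) ∎)
    prod : (v ⊕ (⊖ w)) ⊗ (a ⊕ (⊖ b)) ≡ 𝟘
    prod = begin
      (v ⊕ (⊖ w)) ⊗ (a ⊕ (⊖ b))
        ≡⟨ solve 4 (λ v w a b → (v :+ w) :* (a :+ b) := (a :* v :+ b :* v) :+ (w :* a :+ w :* b)) refl v (⊖ w) a (⊖ b) ⟩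
      (a ⊗ v ⊕ (⊖ b) ⊗ v) ⊕ ((⊖ w) ⊗ a ⊕ (⊖ w) ⊗ (⊖ b))
        ≡⟨ cong₂ (λ x y → (a ⊗ v ⊕ x) ⊕ y) (sym (-‿distribˡ-* b v)) (cong₂ _⊕_ (trans (sym (-‿distribˡ-* w a)) (cong ⊖_ (R.*-comm w a))) negneg) ⟩
      (a ⊗ v ⊕ (⊖ (b ⊗ v))) ⊕ ((⊖ (a ⊗ w)) ⊕ b ⊗ w)
        ≡⟨ solve 4 (λ p q r s → (p :+ q) :+ (r :+ s) := (p :+ s) :+ (r :+ q)) refl (a ⊗ v) (⊖ (b ⊗ v)) (⊖ (a ⊗ w)) (b ⊗ w) ⟩
      (a ⊗ v ⊕ b ⊗ w) ⊕ ((⊖ (a ⊗ w)) ⊕ (⊖ (b ⊗ v)))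
        ≡⟨ cong₂ _⊕_ cross (sym (-‿anti-homo-+ (b ⊗ v) (a ⊗ w))) ⟩
      (b ⊗ v ⊕ a ⊗ w) ⊕ (⊖ (b ⊗ v ⊕ a ⊗ w))
        ≡⟨ R.-‿inverseʳ _ ⟩
      𝟘 ∎
      where
      negneg : (⊖ w) ⊗ (⊖ b) ≡ b ⊗ w
      negneg = trans (sym (-‿distribˡ-* w (⊖ b))) (trans (cong ⊖_ (trans (sym (-‿distribʳ-* w b)) (cong ⊖_ (R.*-comm w b)))) (-‿involutive (b ⊗ w)))

-- Partial vectors and their completions

justs : ∀ {A : Set} {n} → Vec (Maybe A) n → List (Fin n × A)
justs [] = []
justs (nothing ∷ P) = map (λ (i , v) → suc i , v) (justs P)
justs (just v ∷ P) = (zero , v) ∷ map (λ (i , v) → suc i , v) (justs P)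

supp : ∀ {A : Set} {n} → Vec (Maybe A) n → Subset n
supp = V.map Maybe.is-just

module _ {A : Set} where
  length-justs : ∀ {n} (P : Vec (Maybe A) n) → length (justs P) ≡ ∣ supp P ∣
  length-justs [] = refl
  length-justs (nothing ∷ P) = trans (Lp.length-map _ (justs P)) (length-justs P)
  length-justs (just v ∷ P) = cong suc (trans (Lp.length-map _ (justs P)) (length-justs P))

  ∈-justs⁺ : ∀ {n} (P : Vec (Maybe A) n) i {v} → lookup P i ≡ just v → (i , v) ∈ˡ justs P
  ∈-justs⁺ (just v ∷ P) zero refl = here refl
  ∈-justs⁺ (nothing ∷ P) (suc i) e = ∈-map⁺ _ (∈-justs⁺ P i e)
  ∈-justs⁺ (just _ ∷ P) (suc i) e = there (∈-map⁺ _ (∈-justs⁺ P i e))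

  ∈-justs⁻ : ∀ {n} (P : Vec (Maybe A) n) {i v} → (i , v) ∈ˡ justs P → lookup P i ≡ just v
  ∈-justs⁻ (nothing ∷ P) m with ∈-map⁻ _ m
  ... | (i , v) , m′ , refl = ∈-justs⁻ P m′
  ∈-justs⁻ (just v ∷ P) (here refl) = refl
  ∈-justs⁻ (just v ∷ P) (there m) with ∈-map⁻ _ m
  ... | (i , v) , m′ , refl = ∈-justs⁻ P m′

  Unique-keys : ∀ {n} (P : Vec (Maybe A) n) → Unique (map proj₁ (justs P))
  Unique-keys [] = []
  Unique-keys (nothing ∷ P) = subst Unique (trans (sym (Lp.map-∘ (justs P))) (Lp.map-∘ (justs P))) (Un.map⁺ F.suc-injective (Unique-keys P))
  Unique-keys (just v ∷ P) = All.tabulate zero∉ ∷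
    subst Unique (trans (sym (Lp.map-∘ (justs P))) (Lp.map-∘ (justs P))) (Un.map⁺ F.suc-injective (Unique-keys P))
    where
    zero∉ : ∀ {i} → i ∈ˡ map proj₁ (map (λ (i , v) → suc i , v) (justs P)) → zero ≢ i
    zero∉ m p with ∈-map⁻ proj₁ m
    ... | _ , m′ , e with ∈-map⁻ _ m′
    ...   | _ , _ , refl = F.0≢1+n (trans p e)

  lookup-Unique : ∀ {xs : List A} → Unique xs → ∀ {r s} → Data.List.lookup xs r ≡ Data.List.lookup xs s → r ≡ s
  lookup-Unique (x∉ ∷ u) {zero} {zero} e = refl
  lookup-Unique {x ∷ xs} (x∉ ∷ u) {zero} {suc s} e = contradiction e (All.lookup x∉ (∈-lookup s))
  lookup-Unique {x ∷ xs} (x∉ ∷ u) {suc r} {zero} e = contradiction (sym e) (All.lookup x∉ (∈-lookup r))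
  lookup-Unique (x∉ ∷ u) {suc r} {suc s} e = cong suc (lookup-Unique u e)

  lookup-fromList : (xs : List A) (r : Fin (length xs)) → lookup (V.fromList xs) r ≡ Data.List.lookup xs r
  lookup-fromList (x ∷ xs) zero = refl
  lookup-fromList (x ∷ xs) (suc r) = lookup-fromList xs r

restrict : ∀ {A : Set} {k} → Vec A k → Subset k → Vec (Maybe A) k
restrict x T = zipWith (λ b v → if b then just v else nothing) T x

lookup-restrict : ∀ {A : Set} {k} (x : Vec A k) (T : Subset k) {i v} → lookup (restrict x T) i ≡ just v → lookup x i ≡ v
lookup-restrict x T {i} e with trans (sym (V.lookup-zipWith _ i T x)) e
... | e′ with lookup T i
lookup-restrict x T e | refl | true = refl

lookup-restrict⁺ : ∀ {A : Set} {k} (x : Vec A k) (T : Subset k) {i} → lookup T i ≡ true → lookup (restrict x T) i ≡ just (lookup x i)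
lookup-restrict⁺ x T {i} e = trans (V.lookup-zipWith _ i T x) (cong (λ b → if b then just (lookup x i) else nothing) e)

lookup-restrict⁻ : ∀ {A : Set} {k} (x : Vec A k) (T : Subset k) {i} → lookup T i ≡ false → lookup (restrict x T) i ≡ nothing
lookup-restrict⁻ x T {i} e = trans (V.lookup-zipWith _ i T x) (cong (λ b → if b then just (lookup x i) else nothing) e)

supp-restrict : ∀ {A : Set} {k} (x : Vec A k) (T : Subset k) → supp (restrict x T) ≡ T
supp-restrict [] [] = refl
supp-restrict (v ∷ x) (true ∷ T) = cong (true ∷_) (supp-restrict x T)
supp-restrict (v ∷ x) (false ∷ T) = cong (false ∷_) (supp-restrict x T)

vec-ext : ∀ {A : Set} {n} {x y : Vec A n} → (∀ i → lookup x i ≡ lookup y i) → x ≡ y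
vec-ext {x = x} {y} h = trans (sym (V.tabulate∘lookup x)) (trans (V.tabulate-cong h) (V.tabulate∘lookup y))

vec-differ : ∀ {A : Set} → (∀ (a b : A) → Dec (a ≡ b)) → ∀ {n} (x y : Vec A n) → x ≢ y → ∃ λ i → lookup x i ≢ lookup y i
vec-differ _≟_ [] [] ne = contradiction refl ne
vec-differ _≟_ (a ∷ x) (b ∷ y) ne with a ≟ b
... | no a≢b = zero , a≢b
... | yes refl with vec-differ _≟_ x y (ne ∘ cong (a ∷_))
...   | i , d = suc i , d

module Completion {k G N : ℕ} (codeField : CodeField k G N) where
  open Codes codeField public

  Placement : Set
  Placement = Vec (Maybe V) k

  Twists : Set
  Twists = Vec Twist k

  values : Twists → Placement → List (Fin k × V)
  values θ P = map (λ (i , v) → i , π (lookup θ i) v) (justs P)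

  word : Twists → Placement → List V
  word θ P = interpolate (V.fromList (values θ P))

  -- The code of θ: the x for which π (θ i) (x i), i < k, are the values at k fixed points of a polynomial of degree < t.
  -- A placement of exactly t vertices extends to exactly one word x.
  opaque
    complete : Twists → Placement → Vec V k
    complete θ P = tabulate (λ i → π⁻¹ (lookup θ i) (ev (word θ P) (pt i)))

    lookup-complete : ∀ θ P i → lookup (complete θ P) i ≡ π⁻¹ (lookup θ i) (ev (word θ P) (pt i))
    lookup-complete θ P i = V.lookup∘tabulate _ i

  π-complete : ∀ θ P i → π (lookup θ i) (lookup (complete θ P) i) ≡ ev (word θ P) (pt i)
  π-complete θ P i = trans (cong (π (lookup θ i)) (lookup-complete θ P i)) (π-π⁻¹ _ _)

  length-word : ∀ θ P → length (word θ P) ≡ ∣ supp P ∣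
  length-word θ P = trans (length-interpolate (V.fromList (values θ P))) (trans (Lp.length-map _ (justs P)) (length-justs P))

  ev-word : ∀ θ P {i v} → lookup P i ≡ just v → ev (word θ P) (pt i) ≡ π (lookup θ i) v
  ev-word θ P {i} {v} e = begin
    ev (word θ P) (pt i) ≡⟨ cong (λ q → ev (word θ P) (pt (proj₁ q))) (sym at-r) ⟩
    ev (word θ P) (pt (proj₁ (lookup ps r))) ≡⟨ ev-interpolate ps inj r ⟩
    proj₂ (lookup ps r) ≡⟨ cong proj₂ at-r ⟩
    π (lookup θ i) v ∎
    where
    open ≡-Reasoning
    ps = V.fromList (values θ P)
    m : (i , π (lookup θ i) v) ∈ˡ values θ P
    m = ∈-map⁺ _ (∈-justs⁺ P i e)
    r = Any.index m
    at-r : lookup ps r ≡ (i , π (lookup θ i) v)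
    at-r = trans (lookup-fromList (values θ P) r) (sym (lookup-index m))
    keys : Unique (map proj₁ (values θ P))
    keys = subst Unique (Lp.map-∘ (justs P)) (Unique-keys P)
    keyAt : ∀ r → Data.List.lookup (map proj₁ (values θ P)) (F.cast (sym (Lp.length-map proj₁ (values θ P))) r) ≡ proj₁ (lookup ps r)
    keyAt r = trans (cast-lookup (values θ P) r) (cong proj₁ (sym (lookup-fromList (values θ P) r)))
      where
      cast-lookup : ∀ (xs : List (Fin k × V)) r → Data.List.lookup (map proj₁ xs) (F.cast (sym (Lp.length-map proj₁ xs)) r) ≡ proj₁ (Data.List.lookup xs r)
      cast-lookup (x ∷ xs) zero = refl
      cast-lookup (x ∷ xs) (suc r) = cast-lookup xs r
    inj : ∀ {r s} → proj₁ (lookup ps r) ≡ proj₁ (lookup ps s) → r ≡ s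
    inj {r} {s} eq = F.toℕ-injective (trans (sym (F.toℕ-cast _ r)) (trans
      (cong toℕ (lookup-Unique keys (trans (keyAt r) (trans eq (sym (keyAt s)))))) (F.toℕ-cast _ s)))

  complete-extends : ∀ θ P {i v} → lookup P i ≡ just v → lookup (complete θ P) i ≡ v
  complete-extends θ P {i} e = trans (lookup-complete θ P i) (trans (cong (π⁻¹ (lookup θ i)) (ev-word θ P e)) (π⁻¹-π _ _))

  word-cong : ∀ {θ θ′} P → (∀ {i v} → lookup P i ≡ just v → π (lookup θ i) v ≡ π (lookup θ′ i) v) → word θ P ≡ word θ′ P
  word-cong {θ} {θ′} P h = cong (λ ps → interpolate (V.fromList ps)) same
    where
    same : values θ P ≡ values θ′ P
    same = Lp.map-cong-local (All.tabulate (λ {(i , v)} m → cong (i ,_) (h (∈-justs⁻ P m))))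

  supp-true : ∀ {P : Placement} {i v} → lookup P i ≡ just v → lookup (supp P) i ≡ true
  supp-true {P} {i} e = trans (V.lookup-map i Maybe.is-just P) (cong Maybe.is-just e)

  length-keys : ∀ (P : Placement) → length (map proj₁ (justs P)) ≡ ∣ supp P ∣
  length-keys P = trans (Lp.length-map proj₁ (justs P)) (length-justs P)

  -- The code is MDS: a codeword is recovered from its restriction to any set of positions of the
  -- right size, as the twisted values there determine the polynomial.
  complete-unique : ∀ θ P P′ → ∣ supp P ∣ ≡ ∣ supp P′ ∣ → (∀ {i v} → lookup P′ i ≡ just v → lookup (complete θ P) i ≡ v) →
    complete θ P′ ≡ complete θ P
  complete-unique θ P P′ e sub = vec-ext λ i → trans (lookup-complete θ P′ i)
    (trans (cong (π⁻¹ (lookup θ i)) (agree (pt i))) (sym (lookup-complete θ P i)))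
    where
    agree : ∀ z → ev (word θ P′) z ≡ ev (word θ P) z
    agree = ev-unique (map proj₁ (justs P′)) (Unique-keys P′) (word θ P′) (word θ P)
      (≤-reflexive (trans (length-word θ P′) (sym (length-keys P′))))
      (≤-reflexive (trans (length-word θ P) (trans e (sym (length-keys P′)))))
      (λ m → at m)
      where
      at : ∀ {i} → i ∈ˡ map proj₁ (justs P′) → ev (word θ P′) (pt i) ≡ ev (word θ P) (pt i)
      at m with ∈-map⁻ proj₁ m
      ... | (i , v) , m′ , refl = trans (ev-word θ P′ (∈-justs⁻ P′ m′))
              (trans (cong (π (lookup θ i)) (sym (sub (∈-justs⁻ P′ m′)))) (π-complete θ P i))

  complete-restrict : ∀ θ P T → ∣ supp P ∣ ≡ ∣ T ∣ → complete θ (restrict (complete θ P) T) ≡ complete θ P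
  complete-restrict θ P T e = complete-unique θ P (restrict (complete θ P) T)
    (trans e (cong ∣_∣ (sym (supp-restrict (complete θ P) T)))) (lookup-restrict (complete θ P) T)

  -- Exchange i for b in the set of interpolation points: the values at b and at the placed
  -- positions other than i determine the polynomial, hence also its value at i.
  word-injective : ∀ {θ θ′} P {i b v} → lookup P i ≡ just v → lookup P b ≡ nothing →
    (∀ {j w} → j ≢ i → lookup P j ≡ just w → π (lookup θ j) w ≡ π (lookup θ′ j) w) →
    ev (word θ P) (pt b) ≡ ev (word θ′ P) (pt b) → π (lookup θ i) v ≡ π (lookup θ′ i) v
  word-injective {θ} {θ′} P {i} {b} {v} ei eb h e =
    trans (sym (ev-word θ P ei)) (trans (agree (pt i)) (ev-word θ′ P ei))
    where
    keys = map proj₁ (justs P)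
    ≢i? = λ j → ¬? (j F.≟ i)
    S = b ∷ filter ≢i? keys
    key⁻ : ∀ {j} → j ∈ˡ keys → ∃ λ w → lookup P j ≡ just w
    key⁻ m with ∈-map⁻ proj₁ m
    ... | (j , w) , m′ , refl = w , ∈-justs⁻ P m′
    b∉ : ∀ {j} → j ∈ˡ filter ≢i? keys → b ≢ j
    b∉ m refl with key⁻ (proj₁ (∈-filter⁻ ≢i? {xs = keys} m))
    ... | w , ew with trans (sym eb) ew
    ...   | ()
    long : length keys ≤ length S
    long = length-mono-⊆ keys (i ∷ filter ≢i? keys) (Unique-keys P) cover
      where
      cover : ∀ {j} → j ∈ˡ keys → j ∈ˡ i ∷ filter ≢i? keys
      cover {j} m with j F.≟ i
      ... | yes eq = here eq
      ... | no ne = there (∈-filter⁺ ≢i? m ne)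
    at : ∀ {j} → j ∈ˡ S → ev (word θ P) (pt j) ≡ ev (word θ′ P) (pt j)
    at (here refl) = e
    at {j} (there m) with ∈-filter⁻ ≢i? {xs = keys} m
    ... | m′ , ne with key⁻ m′
    ...   | w , ew = trans (ev-word θ P ew) (trans (h ne ew) (sym (ev-word θ′ P ew)))
    bound : ∀ θ → length (word θ P) ≤ length S
    bound θ = ≤-trans (≤-reflexive (trans (length-word θ P) (sym (length-keys P)))) long
    agree : ∀ z → ev (word θ P) z ≡ ev (word θ′ P) z
    agree = ev-unique S (All.tabulate b∉ ∷ Un.filter⁺ ≢i? (Unique-keys P)) (word θ P) (word θ′ P) (bound θ) (bound θ′) at

-- Collisions between completions of placements

length-allFin : ∀ n → length (allFin n) ≡ n
length-allFin n = Lp.length-tabulate id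

length-cartesianProduct : {A B : Set} (xs : List A) (ys : List B) → length (cartesianProduct xs ys) ≡ length xs * length ys
length-cartesianProduct [] ys = refl
length-cartesianProduct (x ∷ xs) ys = trans (Lp.length-++ (map (x ,_) ys)) (cong₂ _+_ (Lp.length-map (x ,_) ys) (length-cartesianProduct xs ys))

-- Neither N nor the number of gains enters, so both can be chosen after these bounds. In
-- `itemBound`, each of the k positions of a placement carries one of s vertices or none, and a
-- further factor k accounts for the free position.
module Bounds (k : ℕ) where
  itemBound : ℕ → ℕ
  itemBound s = suc s ^ k * k

  conflictBound : ℕ → ℕ
  conflictBound s = itemBound s * s + itemBound s * itemBound s

  badnessBound : ℕ → ℕ → ℕ
  badnessBound zero s = 0
  badnessBound (suc r) s = conflictBound s + badnessBound r (s + itemBound s)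

module Collisions {k G N : ℕ} (codeField : CodeField k G N) (t : ℕ) (G≤N : G ≤ N) where
  open Completion codeField public

  open DecMembership (F._≟_ {N}) using () renaming (_∈?_ to _∈ˡ?_) public

  _≟M_ : (a b : Maybe V) → Dec (a ≡ b)
  _≟M_ = Maybe.≡-dec F._≟_

  _≟P_ : (P Q : Placement) → Dec (P ≡ Q)
  _≟P_ = V.≡-dec _≟M_

  twists : List Twist
  twists = cartesianProduct (allFin G) (allFin N)

  length-twists : length twists ≡ G * N
  length-twists = trans (length-cartesianProduct (allFin G) (allFin N)) (cong₂ _*_ (length-allFin G) (length-allFin N))

  Unique-twists : Unique twists
  Unique-twists = Un.cartesianProduct⁺ (Un.allFin⁺ G) (Un.allFin⁺ N)

  allTwists : List Twists
  allTwists = vectors twists k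

  -- A placement together with a position that it leaves free, at which `value` reads off a new
  -- vertex of the completed block.
  Item : Set
  Item = Placement × Fin k

  _≟I_ : (I J : Item) → Dec (I ≡ J)
  _≟I_ = Product.≡-dec _≟P_ F._≟_

  placements : List V → List Placement
  placements W = filter (λ P → ∣ supp P ∣ ≟ t) (vectors (nothing ∷ map just W) k)

  free? : (I : Item) → Dec (lookup (proj₁ I) (proj₂ I) ≡ nothing)
  free? (P , b) = lookup P b ≟M nothing

  items : List V → List Item
  items W = filter free? (cartesianProduct (placements W) (allFin k))

  record IsItem (W : List V) (P : Placement) (b : Fin k) : Set where
    field
      size : ∣ supp P ∣ ≡ t
      within : ∀ {i v} → lookup P i ≡ just v → v ∈ˡ W
      free : lookup P b ≡ nothing
  open IsItem

  ∈-items⁺ : ∀ {W P b} → IsItem W P b → (P , b) ∈ˡ items W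
  ∈-items⁺ {W} {P} {b} it = ∈-filter⁺ free? (∈-cartesianProduct⁺
    (∈-filter⁺ (λ P → ∣ supp P ∣ ≟ t) (∈-vectors⁺ P entry) (it .size)) (∈-allFin b)) (it .free)
    where
    entry : ∀ i → lookup P i ∈ˡ nothing ∷ map just W
    entry i with lookup P i in eq
    ... | nothing = here refl
    ... | just v = there (∈-map⁺ just (it .within eq))

  ∈-items⁻ : ∀ {W P b} → (P , b) ∈ˡ items W → IsItem W P b
  ∈-items⁻ {W} {P} {b} m with ∈-filter⁻ free? {xs = cartesianProduct (placements W) (allFin k)} m
  ... | m′ , fr with ∈-filter⁻ (λ P → ∣ supp P ∣ ≟ t) {xs = vectors (nothing ∷ map just W) k} (proj₁ (∈-cartesianProduct⁻ (placements W) (allFin k) m′))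
  ...   | m″ , sz = record { size = sz ; within = λ {i} e → entry (subst (_∈ˡ nothing ∷ map just W) e (∈-vectors⁻ k m″ i)) ; free = fr }
    where
    entry : ∀ {v} → just v ∈ˡ nothing ∷ map just W → v ∈ˡ W
    entry (there m) with ∈-map⁻ just m
    ... | _ , v∈ , refl = v∈

  value : Twists → Item → V
  value θ (P , b) = lookup (complete θ P) b

  lookup-set : ∀ (θ : Twists) b p → lookup (θ [ b ]≔ p) b ≡ p
  lookup-set θ b p = V.lookup∘update b θ p

  lookup-other : ∀ (θ : Twists) {b j} p → j ≢ b → lookup (θ [ b ]≔ p) j ≡ lookup θ j
  lookup-other θ p ne = V.lookup∘update′ ne θ p

  module _ (θ : Twists) (b : Fin k) where
    word-set : ∀ P p q → (∀ {v} → lookup P b ≡ just v → π p v ≡ π q v) → word (θ [ b ]≔ p) P ≡ word (θ [ b ]≔ q) P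
    word-set P p q h = word-cong {θ [ b ]≔ p} {θ [ b ]≔ q} P go
      where
      go : ∀ {i v} → lookup P i ≡ just v → π (lookup (θ [ b ]≔ p) i) v ≡ π (lookup (θ [ b ]≔ q) i) v
      go {i} {v} e with i F.≟ b
      ... | yes refl = trans (cong (λ r → π r v) (lookup-set θ b p)) (trans (h e) (cong (λ r → π r v) (sym (lookup-set θ b q))))
      ... | no ne = cong (λ r → π r v) (trans (lookup-other θ p ne) (sym (lookup-other θ q ne)))

    word-free : ∀ P p q → lookup P b ≡ nothing → word (θ [ b ]≔ p) P ≡ word (θ [ b ]≔ q) P
    word-free P p q fr = word-set P p q λ e → contradiction (trans (sym fr) e) λ ()

    -- The twist at `b` enters only through the image of the vertex that P places there, if there is
    -- one.
    value-other : ∀ P {c} p q → c ≢ b → (∀ {v} → lookup P b ≡ just v → π p v ≡ π q v) →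
      value (θ [ b ]≔ p) (P , c) ≡ value (θ [ b ]≔ q) (P , c)
    value-other P {c} p q c≢b h = trans (lookup-complete (θ [ b ]≔ p) P c) (trans
      (cong₂ (λ r w → π⁻¹ r (ev w (pt c))) (trans (lookup-other θ p c≢b) (sym (lookup-other θ q c≢b))) (word-set P p q h))
      (sym (lookup-complete (θ [ b ]≔ q) P c)))

    -- If `b` is free, the polynomial does not depend on the twist at `b`; a twist that produces the
    -- value w must therefore send w to one fixed element.
    value-image : ∀ P {w} p q → lookup P b ≡ nothing → value (θ [ b ]≔ p) (P , b) ≡ w → value (θ [ b ]≔ q) (P , b) ≡ w → π p w ≡ π q w
    value-image P {w} p q fr e₁ e₂ = trans (image p e₁) (trans (cong (λ y → ev y (pt b)) (word-free P p q fr)) (sym (image q e₂)))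
      where
      image : ∀ p → value (θ [ b ]≔ p) (P , b) ≡ w → π p w ≡ ev (word (θ [ b ]≔ p) P) (pt b)
      image p e = trans (cong₂ π (sym (lookup-set θ b p)) (sym e)) (π-complete (θ [ b ]≔ p) P b)

    twist-injective : ∀ w {p q : Twist} → proj₁ p ≡ proj₁ q → π p w ≡ π q w → p ≡ q
    twist-injective w {g , h} {.g , h′} refl e = cong (g ,_) (same-gain w e)

    -- At most `G` of the `G * N` twists satisfy `Q`, a fraction of 1/N, and `G≤N` weakens it to the
    -- common bound 1/G. In `count-by-image` at most `N` twists remain, a fraction of 1/G.
    count-by-gain : ∀ {Q : Twist → Set} (Q? : ∀ p → Dec (Q p)) → (∀ {p q} → Q p → Q q → proj₁ p ≡ proj₁ q → p ≡ q) →
      G * ∑ twists (λ p → ind (Q? p)) ≤ length twists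
    count-by-gain Q? inj = ≤-trans (*-monoʳ-≤ G (≤-trans (∑-ind-injective Q? twists Unique-twists G proj₁ (λ {p} {q} → inj {p} {q})) G≤N)) (≤-reflexive (sym length-twists))

    count-by-image : ∀ {Q : Twist → Set} (Q? : ∀ p → Dec (Q p)) v → (∀ {p q} → Q p → Q q → π p v ≡ π q v → p ≡ q) →
      G * ∑ twists (λ p → ind (Q? p)) ≤ length twists
    count-by-image Q? v inj = ≤-trans (*-monoʳ-≤ G (∑-ind-injective Q? twists Unique-twists N (λ p → π p v) (λ {p} {q} → inj {p} {q}))) (≤-reflexive (sym length-twists))

  length^ : length twists ^ k ≡ length allTwists
  length^ = sym (length-vectors twists k)

  resample : ∀ b (f : Twists → ℕ) → (∀ θ → G * ∑ twists (λ p → f (θ [ b ]≔ p)) ≤ length twists) → G * ∑ allTwists f ≤ length allTwists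
  resample b f h = ≤-trans (∑-vectors-resample twists k b G f h) (≤-reflexive length^)

  hit-rare : ∀ {P b} → lookup P b ≡ nothing → ∀ w → G * ∑ allTwists (λ θ → ind (value θ (P , b) F.≟ w)) ≤ length allTwists
  hit-rare {P} {b} fr w = resample b _ λ θ → count-by-gain θ b (λ p → value (θ [ b ]≔ p) (P , b) F.≟ w)
    λ {p} {q} e₁ e₂ g → twist-injective θ b w g (value-image θ b P p q fr e₁ e₂)

  -- A common value inside W is already counted as a hit of W. Excluding it here makes the common
  -- value differ from all vertices of W, as `two-point` requires.
  Collide : List V → Item → Item → Twists → Set
  Collide W I J θ = I ≢ J × value θ I ≡ value θ J × value θ J ∉ˡ W

  collide? : ∀ W I J θ → Dec (Collide W I J θ)
  collide? W I J θ = ¬? (I ≟I J) ×-dec (value θ I F.≟ value θ J) ×-dec ¬? (value θ J ∈ˡ? W)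

  -- Resample the twist at b. If P′ leaves b free, its value does not change, and the twist is
  -- determined by its gain. If P′ places v at b, fix the image of v: then the common value w is
  -- fixed and so is its image, and w ≠ v because v lies in W while w does not.
  collide-rare-≢ : ∀ {W P b P′ b′} → IsItem W P b → IsItem W P′ b′ → b ≢ b′ →
    (Q? : ∀ θ → Dec (Collide W (P , b) (P′ , b′) θ)) → G * ∑ allTwists (λ θ → ind (Q? θ)) ≤ length allTwists
  collide-rare-≢ {W} {P} {b} {P′} {b′} it it′ b≢b′ Q? with lookup P′ b in eq
  ... | nothing = resample b _ λ θ → count-by-gain θ b (λ p → Q? (θ [ b ]≔ p))
    λ {p} {q} (_ , e₁ , _) (_ , e₂ , _) g → twist-injective θ b (value (θ [ b ]≔ p) (P′ , b′)) g
      (value-image θ b P p q (it .free) e₁ (trans e₂ (value-other θ b P′ q p (b≢b′ ∘ sym)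
        λ e → contradiction (trans (sym eq) e) λ ())))
  ... | just v = resample b _ λ θ → count-by-image θ b (λ p → Q? (θ [ b ]≔ p)) v
    λ {p} {q} (_ , e₁ , ∉₁) (_ , e₂ , _) im →
      let same : ∀ {u} → lookup P′ b ≡ just u → π q u ≡ π p u
          same e = subst (λ u → π q u ≡ π p u) (Maybe.just-injective (trans (sym eq) e)) (sym im)
      in two-point (λ e → ∉₁ (subst (_∈ˡ W) e (it′ .within eq))) im
        (value-image θ b P p q (it .free) e₁ (trans e₂ (value-other θ b P′ q p (b≢b′ ∘ sym) same)))

  -- At the same position equal values mean equal values of the two polynomials. Resample the twist
  -- at a position i where the placements differ. Once the polynomial of P′ is fixed, by fixing the
  -- image of its vertex at i if it has one, the exchange in `word-injective` determines the image
  -- of v.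
  same-position-rare : ∀ P P′ {b i v} → lookup P b ≡ nothing → lookup P′ b ≡ nothing → lookup P i ≡ just v → lookup P′ i ≢ just v →
    (Q : Twists → Set) (Q? : ∀ θ → Dec (Q θ)) → (∀ {θ} → Q θ → value θ (P , b) ≡ value θ (P′ , b)) →
    G * ∑ allTwists (λ θ → ind (Q? θ)) ≤ length allTwists
  same-position-rare P P′ {b} {i} {v} fr fr′ e ne Q Q? h = resample i _ λ θ → by θ (lookup P′ i) refl
    where
    words : ∀ θ → Q θ → ev (word θ P) (pt b) ≡ ev (word θ P′) (pt b)
    words θ q = trans (sym (π-complete θ P b)) (trans (cong (π (lookup θ b)) (h q)) (π-complete θ P′ b))
    image : ∀ θ p q → Q (θ [ i ]≔ p) → Q (θ [ i ]≔ q) → word (θ [ i ]≔ p) P′ ≡ word (θ [ i ]≔ q) P′ → π p v ≡ π q v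
    image θ p q Qp Qq w = trans (cong (λ r → π r v) (sym (lookup-set θ i p))) (trans
      (word-injective {θ [ i ]≔ p} {θ [ i ]≔ q} P e fr (λ {j} {u} j≢i _ → cong (λ r → π r u) (trans (lookup-other θ p j≢i) (sym (lookup-other θ q j≢i))))
        (trans (words _ Qp) (trans (cong (λ y → ev y (pt b)) w) (sym (words _ Qq)))))
      (cong (λ r → π r v) (lookup-set θ i q)))
    by : ∀ θ m → lookup P′ i ≡ m → G * ∑ twists (λ p → ind (Q? (θ [ i ]≔ p))) ≤ length twists
    by θ nothing eq = count-by-gain θ i (λ p → Q? (θ [ i ]≔ p)) λ {p} {q} Qp Qq g →
      twist-injective θ i v g (image θ p q Qp Qq (word-free θ i P′ p q eq))
    by θ (just v′) eq = count-by-image θ i (λ p → Q? (θ [ i ]≔ p)) v′ λ {p} {q} Qp Qq im →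
      two-point (λ v′≡v → ne (trans eq (cong just v′≡v))) im
        (image θ p q Qp Qq (word-set θ i P′ p q λ {u} e′ → subst (λ u → π p u ≡ π q u) (Maybe.just-injective (trans (sym eq) e′)) im))

  collide-rare : ∀ {W I J} → I ∈ˡ items W → J ∈ˡ items W → (Q? : ∀ θ → Dec (Collide W I J θ)) →
    G * ∑ allTwists (λ θ → ind (Q? θ)) ≤ length allTwists
  collide-rare {W} {P , b} {P′ , b′} mI mJ Q? with b F.≟ b′
  ... | no b≢b′ = collide-rare-≢ (∈-items⁻ mI) (∈-items⁻ mJ) b≢b′ Q?
  ... | yes refl with P ≟P P′
  ...   | yes refl = ≤-trans (≤-reflexive (trans (cong (G *_) (trans
            (∑-cong allTwists (λ θ → ind-no (Q? θ) (λ (ne , _) → ne refl))) (∑-zero allTwists))) (*-zeroʳ G))) z≤n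
  ...   | no P≢P′ with vec-differ _≟M_ P P′ P≢P′
  ...     | i , d with lookup P i in e | lookup P′ i in e′
  ...       | just v | _ = same-position-rare P P′ (∈-items⁻ mI .free) (∈-items⁻ mJ .free) e (λ q → d (trans (sym q) e′))
                (Collide W (P , b) (P′ , b)) Q? (λ (_ , q , _) → q)
  ...       | nothing | just v = same-position-rare P′ P (∈-items⁻ mJ .free) (∈-items⁻ mI .free) e′ (λ q → contradiction (trans (sym e) q) λ ())
                (Collide W (P , b) (P′ , b)) Q? (λ (_ , q , _) → sym q)
  ...       | nothing | nothing = contradiction refl d

  conflicts : Twists → List V → ℕ
  conflicts θ W = ∑ (items W) (λ I → ∑ W (λ w → ind (value θ I F.≟ w)))
                + ∑ (items W) (λ I → ∑ (items W) (λ J → ind (collide? W I J θ)))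

  record Fresh (θ : Twists) (W : List V) : Set where
    field
      new : ∀ {I} → I ∈ˡ items W → value θ I ∉ˡ W
      distinct : ∀ {I J} → I ∈ˡ items W → J ∈ˡ items W → value θ I ≡ value θ J → I ≡ J

  no-conflicts⇒Fresh : ∀ θ W → conflicts θ W ≡ 0 → Fresh θ W
  no-conflicts⇒Fresh θ W e = record { new = new ; distinct = distinct }
    where
    new : ∀ {I} → I ∈ˡ items W → value θ I ∉ˡ W
    new {I} m w∈ = ind≡0 (value θ I F.≟ value θ I)
      (∑≡0 W (λ w → ind (value θ I F.≟ w)) (∑≡0 (items W) (λ I → ∑ W (λ w → ind (value θ I F.≟ w))) (ℕ.m+n≡0⇒m≡0 _ e) m) w∈) refl
    distinct : ∀ {I J} → I ∈ˡ items W → J ∈ˡ items W → value θ I ≡ value θ J → I ≡ J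
    distinct {I} {J} mI mJ eq with I ≟I J
    ... | yes p = p
    ... | no ne = contradiction (ne , eq , new mJ) (ind≡0 (collide? W I J θ)
      (∑≡0 (items W) (λ J → ind (collide? W I J θ)) (∑≡0 (items W) (λ I → ∑ (items W) (λ J → ind (collide? W I J θ))) (ℕ.m+n≡0⇒n≡0 _ e) mI) mJ))

  closure : Twists → List V → List V
  closure θ W = W ++ map (value θ) (items W)

  -- The head of the list is the last round of the process, which is explored first.
  Good : ∀ {r} → List V → Vec Twists r → Set
  Good W [] = ⊤
  Good W (θ ∷ θs) = Fresh θ W × Good (closure θ W) θs

  badness : ∀ {r} → List V → Vec Twists r → ℕ
  badness W [] = 0
  badness W (θ ∷ θs) = conflicts θ W + badness (closure θ W) θs

  badness≡0⇒Good : ∀ {r} W (θs : Vec Twists r) → badness W θs ≡ 0 → Good W θs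
  badness≡0⇒Good W [] e = tt
  badness≡0⇒Good W (θ ∷ θs) e = no-conflicts⇒Fresh θ W (ℕ.m+n≡0⇒m≡0 _ e) , badness≡0⇒Good (closure θ W) θs (ℕ.m+n≡0⇒n≡0 _ e)

  open Bounds k public

  length-items : ∀ {s} W → length W ≤ s → length (items W) ≤ itemBound s
  length-items {s} W le = begin
    length (items W) ≤⟨ Lp.length-filter free? (cartesianProduct (placements W) (allFin k)) ⟩
    length (cartesianProduct (placements W) (allFin k)) ≡⟨ length-cartesianProduct (placements W) (allFin k) ⟩
    length (placements W) * length (allFin k) ≤⟨ *-mono-≤ (Lp.length-filter (λ P → ∣ supp P ∣ ≟ t) (vectors _ k)) (≤-reflexive (length-allFin k)) ⟩
    length (vectors (nothing ∷ map just W) k) * k ≡⟨ cong (_* k) (length-vectors (nothing ∷ map just W) k) ⟩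
    suc (length (map just W)) ^ k * k ≤⟨ *-monoˡ-≤ k (ℕ.^-monoˡ-≤ k (s≤s (≤-trans (≤-reflexive (Lp.length-map just W)) le))) ⟩
    itemBound s ∎
    where open ≤-Reasoning

  length-closure : ∀ {s} θ W → length W ≤ s → length (closure θ W) ≤ s + itemBound s
  length-closure θ W le = ≤-trans (≤-reflexive (trans (Lp.length-++ W) (cong (length W +_) (Lp.length-map (value θ) (items W)))))
    (+-mono-≤ le (length-items W le))

  ∑-∑-rare : {A B : Set} (xs : List A) (ys : List B) (f : A → B → Twists → ℕ) →
    (∀ {x y} → x ∈ˡ xs → y ∈ˡ ys → G * ∑ allTwists (f x y) ≤ length allTwists) →
    G * ∑ allTwists (λ θ → ∑ xs (λ x → ∑ ys (λ y → f x y θ))) ≤ length xs * length ys * length allTwists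
  ∑-∑-rare xs ys f h = begin
    G * ∑ allTwists (λ θ → ∑ xs (λ x → ∑ ys (λ y → f x y θ))) ≡⟨ cong (G *_) (trans (∑-swap allTwists xs (λ θ x → ∑ ys (λ y → f x y θ)))
                                                                      (∑-cong xs (λ x → ∑-swap allTwists ys (λ θ y → f x y θ)))) ⟩
    G * ∑ xs (λ x → ∑ ys (λ y → ∑ allTwists (f x y))) ≡⟨ trans (*-∑ G xs _) (∑-cong xs (λ x → *-∑ G ys _)) ⟩
    ∑ xs (λ x → ∑ ys (λ y → G * ∑ allTwists (f x y))) ≤⟨ ∑-mono-∈ xs (λ m → ∑-mono-∈ ys (λ m′ → h m m′)) ⟩
    ∑ xs (λ _ → ∑ ys (λ _ → length allTwists)) ≡⟨ trans (∑-cong xs (λ _ → ∑-const ys _)) (∑-const xs _) ⟩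
    length xs * (length ys * length allTwists) ≡⟨ sym (*-assoc (length xs) (length ys) _) ⟩
    length xs * length ys * length allTwists ∎
    where open ≤-Reasoning

  conflicts-rare : ∀ {s} W → length W ≤ s → G * ∑ allTwists (λ θ → conflicts θ W) ≤ conflictBound s * length allTwists
  conflicts-rare {s} W le = begin
    G * ∑ allTwists (λ θ → conflicts θ W)
      ≡⟨ trans (cong (G *_) (∑-⊕ allTwists _ _)) (*-distribˡ-+ G _ _) ⟩
    G * ∑ allTwists (λ θ → ∑ (items W) (λ I → ∑ W (λ w → ind (value θ I F.≟ w))))
      + G * ∑ allTwists (λ θ → ∑ (items W) (λ I → ∑ (items W) (λ J → ind (collide? W I J θ))))
      ≤⟨ +-mono-≤
        (∑-∑-rare (items W) W (λ I w θ → ind (value θ I F.≟ w)) (λ {I} m _ → hit-rare {proj₁ I} (∈-items⁻ m .free) _))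
        (∑-∑-rare (items W) (items W) (λ I J θ → ind (collide? W I J θ)) (λ {I} {J} m m′ → collide-rare m m′ (collide? W I J))) ⟩
    length (items W) * length W * length allTwists + length (items W) * length (items W) * length allTwists
      ≡⟨ sym (*-distribʳ-+ (length allTwists) (length (items W) * length W) (length (items W) * length (items W))) ⟩
    (length (items W) * length W + length (items W) * length (items W)) * length allTwists
      ≤⟨ *-monoˡ-≤ (length allTwists) (+-mono-≤ (*-mono-≤ (length-items W le) le) (*-mono-≤ (length-items W le) (length-items W le))) ⟩
    conflictBound s * length allTwists ∎
    where open ≤-Reasoning

  -- Given the first code, the closure of W is a fixed list whose length is bounded independently of
  -- that code, so the induction hypothesis applies to the other codes.
  badness-rare : ∀ r {s} W → length W ≤ s →
    G * ∑ (vectors allTwists r) (badness W) ≤ badnessBound r s * length (vectors allTwists r)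
  badness-rare zero W le = ≤-reflexive (*-zeroʳ G)
  badness-rare (suc r) {s} W le = begin
    G * ∑ (vectors allTwists (suc r)) (badness W)
      ≡⟨ cong (G *_) (trans (∑-vectors allTwists r (badness W)) (∑-cong allTwists (λ θ → trans (∑-⊕ Θ _ _) (cong (_+ ∑ Θ (badness (closure θ W))) (∑-const Θ _))))) ⟩
    G * ∑ allTwists (λ θ → length Θ * conflicts θ W + ∑ Θ (badness (closure θ W)))
      ≡⟨ trans (cong (G *_) (∑-⊕ allTwists _ _)) (*-distribˡ-+ G _ _) ⟩
    G * ∑ allTwists (λ θ → length Θ * conflicts θ W) + G * ∑ allTwists (λ θ → ∑ Θ (badness (closure θ W)))
      ≤⟨ +-mono-≤ first second ⟩
    length Θ * (conflictBound s * T) + T * (badnessBound r s′ * length Θ)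
      ≡⟨ lemma (length Θ) (conflictBound s) T (badnessBound r s′) ⟩
    badnessBound (suc r) s * (T * length Θ)
      ≡⟨ cong (badnessBound (suc r) s *_) (sym (trans (length-vectors allTwists (suc r)) (cong (T *_) (sym (length-vectors allTwists r))))) ⟩
    badnessBound (suc r) s * length (vectors allTwists (suc r)) ∎
    where
    open ≤-Reasoning
    Θ = vectors allTwists r
    T = length allTwists
    s′ = s + itemBound s
    first : G * ∑ allTwists (λ θ → length Θ * conflicts θ W) ≤ length Θ * (conflictBound s * T)
    first = ≤-trans (≤-reflexive (trans (cong (G *_) (sym (*-∑ (length Θ) allTwists (λ θ → conflicts θ W))))
      (trans (sym (*-assoc G (length Θ) _)) (trans (cong (_* ∑ allTwists (λ θ → conflicts θ W)) (*-comm G (length Θ))) (*-assoc (length Θ) G _)))))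
      (*-monoʳ-≤ (length Θ) (conflicts-rare W le))
    second : G * ∑ allTwists (λ θ → ∑ Θ (badness (closure θ W))) ≤ T * (badnessBound r s′ * length Θ)
    second = ≤-trans (≤-reflexive (*-∑ G allTwists _)) (≤-trans
      (∑-mono allTwists (λ θ → badness-rare r (closure θ W) (length-closure θ W le))) (≤-reflexive (∑-const allTwists _)))
    lemma : ∀ a b c d → a * (b * c) + c * (d * a) ≡ (b + d) * (c * a)
    lemma = solve-∀

  items-mono : ∀ {W W′} → (∀ {v} → v ∈ˡ W → v ∈ˡ W′) → ∀ {I} → I ∈ˡ items W → I ∈ˡ items W′
  items-mono sub m = ∈-items⁺ (record { size = ∈-items⁻ m .size ; within = sub ∘ ∈-items⁻ m .within ; free = ∈-items⁻ m .free })

-- Subsets, edges and roles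

subsets : (n t : ℕ) → List (Subset n)
subsets zero zero = [] ∷ []
subsets zero (suc t) = []
subsets (suc n) zero = map (outside ∷_) (subsets n zero)
subsets (suc n) (suc t) = map (inside ∷_) (subsets n t) ++ map (outside ∷_) (subsets n (suc t))

length-subsets : ∀ n t → length (subsets n t) ≡ n C t
length-subsets zero zero = refl
length-subsets zero (suc t) = sym (k>n⇒nCk≡0 {0} {suc t} (s≤s z≤n))
length-subsets (suc n) zero = trans (Lp.length-map _ (subsets n zero)) (length-subsets n zero)
length-subsets (suc n) (suc t) = begin
  length (subsets (suc n) (suc t)) ≡⟨ Lp.length-++ (map (inside ∷_) (subsets n t)) ⟩
  length (map (inside ∷_) (subsets n t)) + length (map (outside ∷_) (subsets n (suc t)))
    ≡⟨ cong₂ _+_ (trans (Lp.length-map _ (subsets n t)) (length-subsets n t)) (trans (Lp.length-map _ (subsets n (suc t))) (length-subsets n (suc t))) ⟩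
  n C t + n C suc t ≡⟨ nCk+nC[k+1]≡[n+1]C[k+1] n t ⟩
  suc n C suc t ∎
  where open ≡-Reasoning

∈-subsets⁺ : ∀ {n t} (e : Subset n) → ∣ e ∣ ≡ t → e ∈ˡ subsets n t
∈-subsets⁺ {t = zero} [] refl = here refl
∈-subsets⁺ {t = suc t} (true ∷ e) eq = ∈-++⁺ˡ (∈-map⁺ _ (∈-subsets⁺ e (suc-injective eq)))
∈-subsets⁺ {t = zero} (false ∷ e) eq = ∈-map⁺ _ (∈-subsets⁺ e eq)
∈-subsets⁺ {t = suc t} (false ∷ e) eq = ∈-++⁺ʳ (map (inside ∷_) (subsets _ t)) (∈-map⁺ _ (∈-subsets⁺ e eq))

∈-subsets⁻ : ∀ n t {e : Subset n} → e ∈ˡ subsets n t → ∣ e ∣ ≡ t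
∈-subsets⁻ zero zero (here refl) = refl
∈-subsets⁻ (suc n) zero m with ∈-map⁻ (outside ∷_) m
... | e , m′ , refl = ∈-subsets⁻ n zero m′
∈-subsets⁻ (suc n) (suc t) m with ∈-++⁻ (map (inside ∷_) (subsets n t)) m
... | inj₁ m₁ with ∈-map⁻ (inside ∷_) m₁
...   | e , m′ , refl = cong suc (∈-subsets⁻ n t m′)
∈-subsets⁻ (suc n) (suc t) m | inj₂ m₂ with ∈-map⁻ (outside ∷_) m₂
...   | e , m′ , refl = ∈-subsets⁻ n (suc t) m′

Unique-subsets : ∀ n t → Unique (subsets n t)
Unique-subsets zero zero = [] ∷ []
Unique-subsets zero (suc t) = []
Unique-subsets (suc n) zero = Un.map⁺ V.∷-injectiveʳ (Unique-subsets n zero)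
Unique-subsets (suc n) (suc t) = Un.++⁺ (Un.map⁺ V.∷-injectiveʳ (Unique-subsets n t)) (Un.map⁺ V.∷-injectiveʳ (Unique-subsets n (suc t))) disjoint
  where
  disjoint : ∀ {e} → ¬ (e ∈ˡ map (inside ∷_) (subsets n t) × e ∈ˡ map (outside ∷_) (subsets n (suc t)))
  disjoint (p , q) with ∈-map⁻ (inside ∷_) p | ∈-map⁻ (outside ∷_) q
  ... | _ , _ , refl | _ , _ , ()

infix 4 _∋_
_∋_ : ∀ {n} → Subset n → Fin n → Set
e ∋ v = lookup e v ≡ true

⊆⇒∣∣≤ : ∀ {n} (p q : Subset n) → (∀ {i} → p ∋ i → q ∋ i) → ∣ p ∣ ≤ ∣ q ∣
⊆⇒∣∣≤ p q h = Sub.p⊆q⇒∣p∣≤∣q∣ {p = p} {q = q} (λ {i} m → V.lookup⇒[]= i q (h (V.[]=⇒lookup m)))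

⊆-full : ∀ {n} (p q : Subset n) → (∀ {i} → p ∋ i → q ∋ i) → ∣ q ∣ ≤ ∣ p ∣ → p ≡ q
⊆-full [] [] h le = refl
⊆-full (true ∷ p) (true ∷ q) h (s≤s le) = cong (true ∷_) (⊆-full p q (λ {i} → h {suc i}) le)
⊆-full (true ∷ p) (false ∷ q) h le = contradiction (h {zero} refl) λ ()
⊆-full (false ∷ p) (true ∷ q) h le = contradiction (≤-trans le (⊆⇒∣∣≤ p q (λ {i} → h {suc i}))) (<-irrefl refl)
⊆-full (false ∷ p) (false ∷ q) h le = cong (false ∷_) (⊆-full p q (λ {i} → h {suc i}) le)

opaque
  elements : ∀ {n} → Subset n → List (Fin n)
  elements e = map proj₁ (justs (restrict e e))

  ∈-elements⁺ : ∀ {n} (e : Subset n) {i} → e ∋ i → i ∈ˡ elements e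
  ∈-elements⁺ e {i} m = ∈-map⁺ proj₁ (∈-justs⁺ (restrict e e) i (lookup-restrict⁺ e e m))

  ∈-elements⁻ : ∀ {n} (e : Subset n) {i} → i ∈ˡ elements e → e ∋ i
  ∈-elements⁻ e m with ∈-map⁻ proj₁ m
  ... | (i , b) , m′ , refl with lookup e i in eq
  ...   | true = refl
  ...   | false = contradiction (trans (sym (lookup-restrict⁻ e e {i} eq)) (∈-justs⁻ (restrict e e) m′)) λ ()

  Unique-elements : ∀ {n} (e : Subset n) → Unique (elements e)
  Unique-elements e = Unique-keys (restrict e e)

  length-elements : ∀ {n} (e : Subset n) → length (elements e) ≡ ∣ e ∣
  length-elements e = trans (Lp.length-map proj₁ (justs (restrict e e))) (trans (length-justs (restrict e e)) (cong ∣_∣ (supp-restrict e e)))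

Injective : ∀ {A : Set} {k} → Vec (Maybe A) k → Set
Injective P = ∀ i j → lookup P i ≡ lookup P j → lookup P i ≢ nothing → i ≡ j

injective? : ∀ {A : Set} (_≟_ : ∀ (a b : A) → Dec (a ≡ b)) {k} (P : Vec (Maybe A) k) → Dec (Injective P)
injective? _≟_ P = F.all? λ i → F.all? λ j →
  Maybe.≡-dec _≟_ (lookup P i) (lookup P j) →-dec (¬? (Maybe.≡-dec _≟_ (lookup P i) nothing) →-dec (i F.≟ j))

⌊⌋-true : ∀ {A : Set} (d : Dec A) → A → ⌊ d ⌋ ≡ true
⌊⌋-true (yes _) _ = refl
⌊⌋-true (no ¬a) a = contradiction a ¬a

⌊⌋-true⁻ : ∀ {A : Set} (d : Dec A) → ⌊ d ⌋ ≡ true → A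
⌊⌋-true⁻ (yes a) _ = a

module _ {N k : ℕ} where
  vertex? : (P : Vec (Maybe (Fin N)) k) (v : Fin N) → Dec (∃ λ i → lookup P i ≡ just v)
  vertex? P v = F.any? λ i → Maybe.≡-dec F._≟_ (lookup P i) (just v)

  opaque
    vertices : Vec (Maybe (Fin N)) k → Subset N
    vertices P = tabulate (λ v → ⌊ vertex? P v ⌋)

    lookup-vertices : ∀ P v → lookup (vertices P) v ≡ ⌊ vertex? P v ⌋
    lookup-vertices P v = V.lookup∘tabulate _ v

  ∋-vertices⁺ : ∀ P {i v} → lookup P i ≡ just v → vertices P ∋ v
  ∋-vertices⁺ P {i} {v} e = trans (lookup-vertices P v) (⌊⌋-true (vertex? P v) (i , e))

  ∋-vertices⁻ : ∀ P {v} → vertices P ∋ v → ∃ λ i → lookup P i ≡ just v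
  ∋-vertices⁻ P {v} m = ⌊⌋-true⁻ (vertex? P v) (trans (sym (lookup-vertices P v)) m)

  ∣vertices∣ : ∀ P → Injective P → ∣ vertices P ∣ ≡ ∣ supp P ∣
  ∣vertices∣ P inj = begin
    ∣ vertices P ∣ ≡⟨ sym (length-elements (vertices P)) ⟩
    length (elements (vertices P)) ≡⟨ ≤-antisym (length-mono-⊆ _ _ (Unique-elements (vertices P)) to) (length-mono-⊆ _ _ unique from) ⟩
    length (map proj₂ (justs P)) ≡⟨ trans (Lp.length-map proj₂ (justs P)) (length-justs P) ⟩
    ∣ supp P ∣ ∎
    where
    open ≡-Reasoning
    to : ∀ {v} → v ∈ˡ elements (vertices P) → v ∈ˡ map proj₂ (justs P)
    to m with ∋-vertices⁻ P (∈-elements⁻ (vertices P) m)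
    ... | i , e = ∈-map⁺ proj₂ (∈-justs⁺ P i e)
    from : ∀ {v} → v ∈ˡ map proj₂ (justs P) → v ∈ˡ elements (vertices P)
    from m with ∈-map⁻ proj₂ m
    ... | (i , v) , m′ , refl = ∈-elements⁺ (vertices P) (∋-vertices⁺ P (∈-justs⁻ P m′))
    unique : Unique (map proj₂ (justs P))
    unique = Unique-map-∈ proj₂ (justs P) inj′ (Un.map⁻ (Unique-keys P))
      where
      inj′ : ∀ {p q} → p ∈ˡ justs P → q ∈ˡ justs P → proj₂ p ≡ proj₂ q → p ≡ q
      inj′ {i , v} {j , .v} m m′ refl = cong (_, v) (inj i j (trans (∈-justs⁻ P m) (sym (∈-justs⁻ P m′)))
        (λ e → contradiction (trans (sym e) (∈-justs⁻ P m)) λ ()))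

nth : ∀ {A : Set} → A → List A → ℕ → A
nth d [] r = d
nth d (x ∷ l) zero = x
nth d (x ∷ l) (suc r) = nth d l r

nth-∈ : ∀ {A : Set} (d : A) l {r} → r < length l → nth d l r ∈ˡ l
nth-∈ d (x ∷ l) {zero} _ = here refl
nth-∈ d (x ∷ l) {suc r} (s≤s lt) = there (nth-∈ d l lt)

module _ {N : ℕ} where
  rank : List (Fin N) → Fin N → ℕ
  rank [] v = 0
  rank (x ∷ l) v with x F.≟ v
  ... | yes _ = 0
  ... | no _ = suc (rank l v)

  rank-< : ∀ l {v} → v ∈ˡ l → rank l v < length l
  rank-< (x ∷ l) {v} m with x F.≟ v
  ... | yes _ = s≤s z≤n
  rank-< (x ∷ l) (here e) | no ne = contradiction (sym e) ne
  rank-< (x ∷ l) (there m) | no ne = s≤s (rank-< l m)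

  nth-rank : ∀ d l {v} → v ∈ˡ l → nth d l (rank l v) ≡ v
  nth-rank d (x ∷ l) {v} m with x F.≟ v
  ... | yes e = e
  nth-rank d (x ∷ l) (here e) | no ne = contradiction (sym e) ne
  nth-rank d (x ∷ l) (there m) | no ne = nth-rank d l m

  rank-nth : ∀ d l → Unique l → ∀ {r} → r < length l → rank l (nth d l r) ≡ r
  rank-nth d (x ∷ l) u {zero} lt with x F.≟ x
  ... | yes _ = refl
  ... | no ne = contradiction refl ne
  rank-nth d (x ∷ l) (x∉ ∷ u) {suc r} (s≤s lt) with x F.≟ nth d l r
  ... | yes e = contradiction e (All.lookup x∉ (nth-∈ d l lt))
  ... | no _ = cong suc (rank-nth d l u lt)

-- A role tells, for each position of a block, the rank in the edge e of the vertex of e placed there.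
Role : ℕ → Set
Role k = Vec (Maybe ℕ) k

-- All vectors over `nothing` and the ranks below t serve as colours, so that every edge has the
-- same colours. Those that are not injective of size t just never agree with a block.
roles : (k t : ℕ) → List (Role k)
roles k t = vectors (nothing ∷ map just (upTo t)) k

_≟R_ : ∀ {k} (a b : Role k) → Dec (a ≡ b)
_≟R_ = V.≡-dec (Maybe.≡-dec _≟_)

Unique-roles : ∀ k t → Unique (roles k t)
Unique-roles k t = Unique-vectors k (All.tabulate nothing∉ ∷ Un.map⁺ Maybe.just-injective (Un.upTo⁺ t))
  where
  nothing∉ : ∀ {m} → m ∈ˡ map just (upTo t) → nothing ≢ m
  nothing∉ m refl with ∈-map⁻ just m
  ... | _ , _ , ()

module Roles {N k : ℕ} (t : ℕ) (v₀ : Fin N) where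
  Edge : Set
  Edge = Subset N

  place : Role k → Edge → Vec (Maybe (Fin N)) k
  place a e = V.map (Maybe.map (nth v₀ (elements e))) a

  roleOf : Vec (Maybe (Fin N)) k → Edge → Role k
  roleOf P e = V.map (Maybe.map (rank (elements e))) P

  lookup-place : ∀ a e {i r} → lookup a i ≡ just r → lookup (place a e) i ≡ just (nth v₀ (elements e) r)
  lookup-place a e {i} eq = trans (V.lookup-map i _ a) (cong (Maybe.map (nth v₀ (elements e))) eq)

  lookup-place⁻ : ∀ a e {i v} → lookup (place a e) i ≡ just v → ∃ λ r → lookup a i ≡ just r × nth v₀ (elements e) r ≡ v
  lookup-place⁻ a e {i} eq with lookup a i | trans (sym (V.lookup-map i (Maybe.map (nth v₀ (elements e))) a)) eq
  ... | just r | refl = r , refl , refl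

  supp-place : ∀ a e → supp (place a e) ≡ supp a
  supp-place a e = trans (sym (V.map-∘ Maybe.is-just _ a)) (V.map-cong (λ { (just _) → refl ; nothing → refl }) a)

  supp-roleOf : ∀ P e → supp (roleOf P e) ≡ supp P
  supp-roleOf P e = trans (sym (V.map-∘ Maybe.is-just _ P)) (V.map-cong (λ { (just _) → refl ; nothing → refl }) P)

  place-roleOf : ∀ P {e} → vertices P ≡ e → place (roleOf P e) e ≡ P
  place-roleOf P {e} refl = vec-ext λ i → trans (V.lookup-map i _ (roleOf P e)) (trans (cong (Maybe.map _) (V.lookup-map i _ P)) (at i))
    where
    at : ∀ i → Maybe.map (nth v₀ (elements e)) (Maybe.map (rank (elements e)) (lookup P i)) ≡ lookup P i
    at i with lookup P i in eq
    ... | nothing = refl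
    ... | just v = cong just (nth-rank v₀ (elements e) (∈-elements⁺ e (∋-vertices⁺ P eq)))

  record IsRole (a : Role k) : Set where
    field
      bounded : ∀ {i r} → lookup a i ≡ just r → r < t
      size : ∣ supp a ∣ ≡ t
      injective : Injective a

  module _ {a : Role k} (isRole : IsRole a) {e : Edge} (∣e∣ : ∣ e ∣ ≡ t) where
    open IsRole isRole

    private
      in-range : ∀ {i r} → lookup a i ≡ just r → r < length (elements e)
      in-range eq = ≤-trans (bounded eq) (≤-reflexive (sym (trans (length-elements e) ∣e∣)))

    place-within : ∀ {i v} → lookup (place a e) i ≡ just v → e ∋ v
    place-within {i} eq with lookup-place⁻ a e eq
    ... | r , er , refl = ∈-elements⁻ e (nth-∈ v₀ (elements e) (in-range er))

    roleOf-place : roleOf (place a e) e ≡ a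
    roleOf-place = vec-ext λ i → trans (V.lookup-map i _ (place a e)) (trans (cong (Maybe.map _) (V.lookup-map i _ a)) (at i))
      where
      at : ∀ i → Maybe.map (rank (elements e)) (Maybe.map (nth v₀ (elements e)) (lookup a i)) ≡ lookup a i
      at i with lookup a i in eq
      ... | nothing = refl
      ... | just r = cong just (rank-nth v₀ (elements e) (Unique-elements e) (in-range eq))

    place-injective : Injective (place a e)
    place-injective i j eq ne with lookup a i in ei
    ... | nothing = contradiction (trans (V.lookup-map i _ a) (cong (Maybe.map _) ei)) ne
    ... | just r with lookup-place⁻ a e {j} (trans (sym eq) (lookup-place a e ei))
    ...   | r′ , ej , q = injective i j (trans ei (trans (cong just r≡r′) (sym ej))) (λ n → contradiction (trans (sym ei) n) λ ())
      where
      r≡r′ : r ≡ r′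
      r≡r′ = trans (sym (rank-nth v₀ (elements e) (Unique-elements e) (in-range ei)))
        (trans (cong (rank (elements e)) (sym q)) (rank-nth v₀ (elements e) (Unique-elements e) (in-range ej)))

    vertices-place : vertices (place a e) ≡ e
    vertices-place = ⊆-full _ _ (λ m → place-within (proj₂ (∋-vertices⁻ (place a e) m)))
      (≤-reflexive (trans ∣e∣ (sym (trans (∣vertices∣ (place a e) place-injective) (trans (cong ∣_∣ (supp-place a e)) size)))))

  isRole-roleOf : ∀ P → Injective P → ∣ supp P ∣ ≡ t → IsRole (roleOf P (vertices P))
  isRole-roleOf P inj sz = record
    { bounded = bounded
    ; size = trans (cong ∣_∣ (supp-roleOf P e)) sz
    ; injective = λ i j eq ne → inj i j (from i j eq ne) (λ n → ne (trans (V.lookup-map i _ P) (cong (Maybe.map _) n))) }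
    where
    e = vertices P
    rk = rank (elements e)
    bounded : ∀ {i r} → lookup (roleOf P e) i ≡ just r → r < t
    bounded {i} eq with lookup P i in ei | trans (sym (V.lookup-map i (Maybe.map rk) P)) eq
    ... | just v | refl = ≤-trans (rank-< (elements e) (∈-elements⁺ e (∋-vertices⁺ P ei)))
            (≤-reflexive (trans (length-elements e) (trans (∣vertices∣ P inj) sz)))
    from : ∀ i j → lookup (roleOf P e) i ≡ lookup (roleOf P e) j → lookup (roleOf P e) i ≢ nothing → lookup P i ≡ lookup P j
    from i j eq ne = trans (sym (cong (λ Q → lookup Q i) pr)) (trans (trans (V.lookup-map i _ (roleOf P e))
      (trans (cong (Maybe.map _) eq) (sym (V.lookup-map j _ (roleOf P e))))) (cong (λ Q → lookup Q j) pr))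
      where pr = place-roleOf P refl

  IsRole⇒∈roles : ∀ {a} → IsRole a → a ∈ˡ roles k t
  IsRole⇒∈roles {a} isRole = ∈-vectors⁺ a entry
    where
    entry : ∀ i → lookup a i ∈ˡ nothing ∷ map just (upTo t)
    entry i with lookup a i in eq
    ... | nothing = here refl
    ... | just r = there (∈-map⁺ just (∈-upTo⁺ (IsRole.bounded isRole eq)))

  ∈roles⇒bounded : ∀ {a} → a ∈ˡ roles k t → ∀ {i r} → lookup a i ≡ just r → r < t
  ∈roles⇒bounded {a} m {i} {r} eq = entry (subst (_∈ˡ nothing ∷ map just (upTo t)) eq (∈-vectors⁻ k m i))
    where
    entry : just r ∈ˡ nothing ∷ map just (upTo t) → r < t
    entry (there m′) with ∈-map⁻ just m′
    ... | _ , r∈ , refl = ∈-upTo⁻ r∈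

-- Blocks and their edges

AllPairs-∈ : ∀ {A : Set} {R : A → A → Set} {xs : List A} → Unique xs →
  (∀ {x y} → x ∈ˡ xs → y ∈ˡ xs → x ≢ y → R x y) → AllPairs R xs
AllPairs-∈ [] h = []
AllPairs-∈ (x∉ ∷ u) h = All.tabulate (λ m → h (here refl) (there m) (All.lookup x∉ m)) ∷ AllPairs-∈ u (λ p q → h (there p) (there q))

AllPairs-++ : ∀ {A : Set} {R : A → A → Set} {xs ys : List A} → AllPairs R xs → AllPairs R ys →
  (∀ {x y} → x ∈ˡ xs → y ∈ˡ ys → R x y) → AllPairs R (xs ++ ys)
AllPairs-++ p q h = AllPairs.++⁺ p q (All.tabulate (λ m → All.tabulate (λ m′ → h m m′)))

∈-toList⁺ : ∀ {A : Set} {n} (x : Vec A n) i → lookup x i ∈ˡ toList x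
∈-toList⁺ (a ∷ x) zero = here refl
∈-toList⁺ (a ∷ x) (suc i) = there (∈-toList⁺ x i)

∈-toList⁻ : ∀ {A : Set} {n} (x : Vec A n) {v} → v ∈ˡ toList x → ∃ λ i → lookup x i ≡ v
∈-toList⁻ (a ∷ x) (here e) = zero , sym e
∈-toList⁻ (a ∷ x) (there m) with ∈-toList⁻ x m
... | i , e = suc i , e

bool-split : (b : Bool) → b ≡ true ⊎ b ≡ false
bool-split true = inj₁ refl
bool-split false = inj₂ refl

true≢false : ∀ {b : Bool} → b ≡ true → b ≢ false
true≢false refl ()

InjectiveBlock : ∀ {A : Set} {k} → Vec A k → Set
InjectiveBlock x = ∀ i j → lookup x i ≡ lookup x j → i ≡ j

lookup-restrict⇒∋ : ∀ {A : Set} {k} (x : Vec A k) (T : Subset k) {i v} → lookup (restrict x T) i ≡ just v → T ∋ i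
lookup-restrict⇒∋ x T {i} e with lookup T i in eq
... | true = refl
... | false = contradiction (trans (sym (lookup-restrict⁻ x T {i} eq)) e) λ ()

restrict-injective : ∀ {A : Set} {k} (x : Vec A k) → InjectiveBlock x → ∀ T → Injective (restrict x T)
restrict-injective x inj T i j eq ne with lookup (restrict x T) i in ei
... | nothing = contradiction refl ne
... | just v = inj i j (trans (lookup-restrict x T ei) (sym (lookup-restrict x T (sym eq))))

module _ {N k : ℕ} where
  edge : Vec (Fin N) k → Subset k → Subset N
  edge x T = vertices (restrict x T)

  ∋-edge⁺ : ∀ x T {i} → T ∋ i → edge x T ∋ lookup x i
  ∋-edge⁺ x T {i} m = ∋-vertices⁺ (restrict x T) (lookup-restrict⁺ x T m)

  ∋-edge⁻ : ∀ x T {v} → edge x T ∋ v → ∃ λ i → T ∋ i × lookup x i ≡ v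
  ∋-edge⁻ x T m with ∋-vertices⁻ (restrict x T) m
  ... | i , e = i , lookup-restrict⇒∋ x T e , lookup-restrict x T e

  ∣edge∣ : ∀ {x} → InjectiveBlock x → ∀ T → ∣ edge x T ∣ ≡ ∣ T ∣
  ∣edge∣ {x} inj T = trans (∣vertices∣ (restrict x T) (restrict-injective x inj T)) (cong ∣_∣ (supp-restrict x T))

  edge-injective : ∀ {x} → InjectiveBlock x → ∀ {T T′} → edge x T ≡ edge x T′ → T ≡ T′
  edge-injective {x} inj {T} {T′} e = ⊆-full T T′ (λ {i} → sub {T} {T′} e i)
    (≤-reflexive (trans (sym (∣edge∣ inj T′)) (trans (cong ∣_∣ (sym e)) (∣edge∣ inj T))))
    where
    sub : ∀ {T T′} → edge x T ≡ edge x T′ → ∀ i → T ∋ i → T′ ∋ i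
    sub {T} {T′} e i m with ∋-edge⁻ x T′ (subst (_∋ lookup x i) e (∋-edge⁺ x T m))
    ... | j , m′ , q = subst (T′ ∋_) (inj j i q) m′

-- No further vertex is common to blocks sharing a t-set, so any two blocks meet in at most t vertices.
Separated : ∀ {N k} (t : ℕ) (𝓑 : List (Subset k)) → Vec (Fin N) k → Vec (Fin N) k → Set
Separated t 𝓑 x y = ∀ T T′ → ∣ T ∣ ≡ t → ∣ T′ ∣ ≡ t → edge x T ≡ edge y T′ →
  T ∈ˡ 𝓑 × T′ ∈ˡ 𝓑 × (∀ i j → lookup T i ≡ false → lookup T′ j ≡ false → lookup x i ≢ lookup y j)

-- 𝓑 is an extremal disjoint-free family; a block may share its t-subsets in 𝓑 with other blocks, but not its own ones.
module Own {k : ℕ} (t : ℕ) (𝓑 : List (Subset k)) where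
  open DecMembership (V.≡-dec {n = k} Bool._≟_) using () renaming (_∈?_ to _∈𝓑?_) public

  own? : ∀ T → Dec (¬ T ∈ˡ 𝓑)
  own? T = ¬? (T ∈𝓑? 𝓑)

  own non : List (Subset k)
  own = filter own? (subsets k t)
  non = filter (_∈𝓑? 𝓑) (subsets k t)

  OwnRole : Role k → Set
  OwnRole a = ∣ supp a ∣ ≡ t × Injective a × ¬ supp a ∈ˡ 𝓑

  ownRole? : ∀ a → Dec (OwnRole a)
  ownRole? a = (∣ supp a ∣ ≟ t) ×-dec injective? _≟_ a ×-dec own? (supp a)

  ownRoles : List (Role k)
  ownRoles = filter ownRole? (roles k t)

-- Finite expectations

module QR = CommutativeRing Q.+-*-commutativeRing
module QSolver = SemiringSolver QR.commutativeSemiring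

opaque
  ι : ℕ → ℚ
  ι n = (ℤ.+ n) / 1

  ι≡ : ∀ n → ι n ≡ (ℤ.+ n) / 1
  ι≡ n = refl

  inv : ℕ → ℚ
  inv zero = 0ℚ
  inv (suc n) = (ℤ.+ 1) / suc n

  private
    toℚᵘ-/ : ∀ z n → Q.toℚᵘ (z / suc n) Qᵘ.≃ Qᵘ.mkℚᵘ z n
    toℚᵘ-/ z n = Q.toℚᵘ-fromℚᵘ (Qᵘ.mkℚᵘ z n)

  ι-+ : ∀ a b → ι (a + b) ≡ ι a Q.+ ι b
  ι-+ a b = Q.toℚᵘ-injective (begin
    Q.toℚᵘ (ι (a + b)) ≈⟨ toℚᵘ-/ (ℤ.+ (a + b)) 0 ⟩
    Qᵘ.mkℚᵘ (ℤ.+ (a + b)) 0 ≈⟨ Qᵘ.*≡* (cong (ℤ._* (ℤ.+ 1)) (sym (cong₂ ℤ._+_ (ℤ.*-identityʳ (ℤ.+ a)) (ℤ.*-identityʳ (ℤ.+ b))))) ⟩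
    Qᵘ.mkℚᵘ (ℤ.+ a) 0 Qᵘ.+ Qᵘ.mkℚᵘ (ℤ.+ b) 0 ≈⟨ Qᵘ.≃-sym (Qᵘ.+-cong (toℚᵘ-/ (ℤ.+ a) 0) (toℚᵘ-/ (ℤ.+ b) 0)) ⟩
    Q.toℚᵘ (ι a) Qᵘ.+ Q.toℚᵘ (ι b) ≈⟨ Qᵘ.≃-sym (Q.toℚᵘ-homo-+ (ι a) (ι b)) ⟩
    Q.toℚᵘ (ι a Q.+ ι b) ∎)
    where open Qᵘ.≃-Reasoning

  ι-* : ∀ a b → ι (a * b) ≡ ι a Q.* ι b
  ι-* a b = Q.toℚᵘ-injective (begin
    Q.toℚᵘ (ι (a * b)) ≈⟨ toℚᵘ-/ (ℤ.+ (a * b)) 0 ⟩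
    Qᵘ.mkℚᵘ (ℤ.+ (a * b)) 0 ≈⟨ Qᵘ.*≡* (cong (ℤ._* (ℤ.+ 1)) (ℤ.pos-* a b)) ⟩
    Qᵘ.mkℚᵘ (ℤ.+ a) 0 Qᵘ.* Qᵘ.mkℚᵘ (ℤ.+ b) 0 ≈⟨ Qᵘ.≃-sym (Qᵘ.*-cong (toℚᵘ-/ (ℤ.+ a) 0) (toℚᵘ-/ (ℤ.+ b) 0)) ⟩
    Q.toℚᵘ (ι a) Qᵘ.* Q.toℚᵘ (ι b) ≈⟨ Qᵘ.≃-sym (Q.toℚᵘ-homo-* (ι a) (ι b)) ⟩
    Q.toℚᵘ (ι a Q.* ι b) ∎)
    where open Qᵘ.≃-Reasoning

  ι-mono : ∀ {a b} → a ≤ b → ι a Q.≤ ι b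
  ι-mono {a} {b} le = Q.toℚᵘ-cancel-≤ (begin
    Q.toℚᵘ (ι a) ≃⟨ toℚᵘ-/ (ℤ.+ a) 0 ⟩
    Qᵘ.mkℚᵘ (ℤ.+ a) 0 ≤⟨ Qᵘ.*≤* (ℤ.*-monoʳ-≤-nonNeg (ℤ.+ 1) (ℤ.+≤+ le)) ⟩
    Qᵘ.mkℚᵘ (ℤ.+ b) 0 ≃⟨ Qᵘ.≃-sym (toℚᵘ-/ (ℤ.+ b) 0) ⟩
    Q.toℚᵘ (ι b) ∎)
    where open Qᵘ.≤-Reasoning

  inv-ι : ∀ n → inv (suc n) Q.* ι (suc n) ≡ 1ℚ
  inv-ι n = Q.toℚᵘ-injective (begin
    Q.toℚᵘ (inv (suc n) Q.* ι (suc n)) ≈⟨ Q.toℚᵘ-homo-* (inv (suc n)) (ι (suc n)) ⟩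
    Q.toℚᵘ (inv (suc n)) Qᵘ.* Q.toℚᵘ (ι (suc n)) ≈⟨ Qᵘ.*-cong (toℚᵘ-/ (ℤ.+ 1) n) (toℚᵘ-/ (ℤ.+ suc n) 0) ⟩
    Qᵘ.mkℚᵘ (ℤ.+ 1) n Qᵘ.* Qᵘ.mkℚᵘ (ℤ.+ suc n) 0 ≈⟨ Qᵘ.*≡* (trans (ℤ.*-identityʳ _) (cong (λ z → (ℤ.+ 1) ℤ.* z) (cong ℤ.+_ (sym (*-identityʳ (suc n)))))) ⟩
    Qᵘ.1ℚᵘ ∎)
    where open Qᵘ.≃-Reasoning

  ι0 : ι 0 ≡ 0ℚ
  ι0 = refl

  ι1 : ι 1 ≡ 1ℚ
  ι1 = refl

  inv-nonNeg : ∀ n → 0ℚ Q.≤ inv n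
  inv-nonNeg zero = Q.≤-refl
  inv-nonNeg (suc n) = Q.nonNegative⁻¹ (inv (suc n)) {{Q.normalize-nonNeg 1 (suc n)}}

  inv-pos : ∀ n → 0ℚ Q.< inv (suc n)
  inv-pos n = Q.positive⁻¹ (inv (suc n)) {{Q.normalize-pos 1 (suc n)}}

ι-nonNeg : ∀ n → 0ℚ Q.≤ ι n
ι-nonNeg n = Q.≤-trans (Q.≤-reflexive (sym ι0)) (ι-mono z≤n)

ι-cancel-≤ : ∀ {a b} → ι a Q.≤ ι b → a ≤ b
ι-cancel-≤ {a} {b} le with a ≤? b
... | yes p = p
... | no np = contradiction (Q.≤-trans (ι-mono (≰⇒> np)) le) λ bad → Q.<-irrefl refl (Q.<-≤-trans strict bad)
  where
  strict : ι b Q.< ι (suc b)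
  strict = Q.<-≤-trans (Q.≤-<-trans (Q.≤-reflexive (sym (Q.+-identityˡ (ι b)))) (Q.+-monoˡ-< (ι b) {0ℚ} {1ℚ} (Q.*<* (ℤ.+<+ (s≤s z≤n)))))
    (Q.≤-reflexive (trans (cong (Q._+ ι b) (sym ι1)) (sym (ι-+ 1 b))))

*-mono-nonNegˡ : ∀ {r p q} → 0ℚ Q.≤ r → p Q.≤ q → r Q.* p Q.≤ r Q.* q
*-mono-nonNegˡ {r} h le = Q.*-monoˡ-≤-nonNeg r {{Q.nonNegative h}} le

*-mono-nonNegʳ : ∀ {r p q} → 0ℚ Q.≤ r → p Q.≤ q → p Q.* r Q.≤ q Q.* r
*-mono-nonNegʳ {r} h le = Q.*-monoʳ-≤-nonNeg r {{Q.nonNegative h}} le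

*-nonNeg : ∀ {p q} → 0ℚ Q.≤ p → 0ℚ Q.≤ q → 0ℚ Q.≤ p Q.* q
*-nonNeg {p} {q} hp hq = Q.≤-trans (Q.≤-reflexive (sym (Q.*-zeroʳ p))) (*-mono-nonNegˡ hp hq)

module ∑ℚ = Sum Q.+-0-isCommutativeMonoid
module ∏ℚ = Sum Q.*-1-isCommutativeMonoid
open ∑ℚ using () renaming (∑ to ∑ᵠ)
open ∏ℚ using () renaming (∑ to ∏)

module _ {A : Set} where
  *-∑ᵠ : ∀ r (xs : List A) (f : A → ℚ) → r Q.* ∑ᵠ xs f ≡ ∑ᵠ xs (λ x → r Q.* f x)
  *-∑ᵠ r [] f = Q.*-zeroʳ r
  *-∑ᵠ r (x ∷ xs) f = trans (Q.*-distribˡ-+ r (f x) (∑ᵠ xs f)) (cong (r Q.* f x Q.+_) (*-∑ᵠ r xs f))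

  ∑ᵠ-const : ∀ (xs : List A) r → ∑ᵠ xs (λ _ → r) ≡ ι (length xs) Q.* r
  ∑ᵠ-const [] r = sym (trans (cong (Q._* r) ι0) (Q.*-zeroˡ r))
  ∑ᵠ-const (x ∷ xs) r = sym (trans (cong (Q._* r) (trans (ι-+ 1 (length xs)) (cong (Q._+ ι (length xs)) ι1)))
    (trans (Q.*-distribʳ-+ r 1ℚ (ι (length xs))) (cong₂ Q._+_ (Q.*-identityˡ r) (sym (∑ᵠ-const xs r)))))

  ∑ᵠ-mono-∈ : ∀ (xs : List A) {f g} → (∀ {x} → x ∈ˡ xs → f x Q.≤ g x) → ∑ᵠ xs f Q.≤ ∑ᵠ xs g
  ∑ᵠ-mono-∈ [] h = Q.≤-refl
  ∑ᵠ-mono-∈ (x ∷ xs) h = Q.+-mono-≤ (h (here refl)) (∑ᵠ-mono-∈ xs (h ∘ there))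

  ι-∑ : ∀ (xs : List A) (f : A → ℕ) → ι (∑ xs f) ≡ ∑ᵠ xs (ι ∘ f)
  ι-∑ [] f = ι0
  ι-∑ (x ∷ xs) f = trans (ι-+ (f x) (∑ xs f)) (cong (ι (f x) Q.+_) (ι-∑ xs f))

  -- The mean over the empty list is 0.
  mean : List A → (A → ℚ) → ℚ
  mean xs f = inv (length xs) Q.* ∑ᵠ xs f

  mean-≤-witness : ∀ x (xs : List A) (f : A → ℚ) y → mean (x ∷ xs) f Q.≤ y → ∃ λ z → z ∈ˡ x ∷ xs × f z Q.≤ y
  mean-≤-witness x xs f y h = search (x ∷ xs) (λ all> → Q.<-irrefl refl (Q.<-≤-trans (lower all>) h))
    where
    search : ∀ zs → ¬ (∀ {z} → z ∈ˡ zs → y Q.< f z) → ∃ λ z → z ∈ˡ zs × f z Q.≤ y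
    search [] k = contradiction (λ ()) k
    search (z ∷ zs) k with f z Q.≤? y
    ... | yes le = z , here refl , le
    ... | no nle with search zs (λ all> → k λ { (here refl) → Q.≰⇒> nle ; (there m) → all> m })
    ...   | w , m , le = w , there m , le
    n = length xs
    lower : (∀ {z} → z ∈ˡ x ∷ xs → y Q.< f z) → y Q.< mean (x ∷ xs) f
    lower all> = begin-strict
      y ≡⟨ sym (trans (sym (Q.*-assoc (inv (suc n)) (ι (suc n)) y)) (trans (cong (Q._* y) (inv-ι n)) (Q.*-identityˡ y))) ⟩
      inv (suc n) Q.* (ι (suc n) Q.* y) ≡⟨ cong (inv (suc n) Q.*_) (sym (∑ᵠ-const (x ∷ xs) y)) ⟩
      inv (suc n) Q.* ∑ᵠ (x ∷ xs) (λ _ → y) <⟨ Q.*-monoʳ-<-pos (inv (suc n)) {{Q.positive (inv-pos n)}}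
        (Q.+-mono-<-≤ (all> (here refl)) (∑ᵠ-mono-∈ xs (λ m → Q.<⇒≤ (all> (there m))))) ⟩
      inv (suc n) Q.* ∑ᵠ (x ∷ xs) f ∎
      where open Q.≤-Reasoning

record Linear {X : Set} (𝔼 : (X → ℚ) → ℚ) : Set where
  field
    ext : ∀ {f g} → (∀ x → f x ≡ g x) → 𝔼 f ≡ 𝔼 g
    add : ∀ f g → 𝔼 (λ x → f x Q.+ g x) ≡ 𝔼 f Q.+ 𝔼 g
    scale : ∀ r f → 𝔼 (λ x → r Q.* f x) ≡ r Q.* 𝔼 f

  neg : ∀ f → 𝔼 (λ x → Q.- f x) ≡ Q.- 𝔼 f
  neg f = trans (ext (λ x → minus (f x))) (trans (scale (Q.- 1ℚ) f) (sym (minus (𝔼 f))))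
    where
    minus : ∀ p → Q.- p ≡ (Q.- 1ℚ) Q.* p
    minus p = trans (cong Q.-_ (sym (Q.*-identityˡ p))) (Q.neg-distribˡ-* 1ℚ p)

  zero-mean : 𝔼 (λ _ → 0ℚ) ≡ 0ℚ
  zero-mean = trans (ext (λ _ → sym (Q.*-zeroˡ 0ℚ))) (trans (scale 0ℚ (λ _ → 0ℚ)) (Q.*-zeroˡ (𝔼 (λ _ → 0ℚ))))

  sum : ∀ {A : Set} (xs : List A) (f : A → X → ℚ) → 𝔼 (λ x → ∑ᵠ xs (λ a → f a x)) ≡ ∑ᵠ xs (λ a → 𝔼 (f a))
  sum [] f = zero-mean
  sum (a ∷ xs) f = trans (add (f a) _) (cong (𝔼 (f a) Q.+_) (sum xs f))

mean-linear : ∀ {A : Set} (xs : List A) → Linear (mean xs)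
mean-linear xs = record
  { ext = λ h → cong (inv (length xs) Q.*_) (∑ℚ.∑-cong xs h)
  ; add = λ f g → trans (cong (inv (length xs) Q.*_) (∑ℚ.∑-⊕ xs f g)) (Q.*-distribˡ-+ (inv (length xs)) _ _)
  ; scale = λ r f → trans (cong (inv (length xs) Q.*_) (sym (*-∑ᵠ r xs f)))
      (QSolver.solve 3 (λ w r s → w QSolver.:* (r QSolver.:* s) QSolver.:= r QSolver.:* (w QSolver.:* s)) refl (inv (length xs)) r (∑ᵠ xs f)) }

⟦_⟧ : Bool → ℚ
⟦ true ⟧ = 1ℚ
⟦ false ⟧ = 0ℚ

⟦not⟧ : ∀ b → ⟦ not b ⟧ ≡ 1ℚ Q.- ⟦ b ⟧
⟦not⟧ true = refl
⟦not⟧ false = refl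

⟦⟧-yes : ∀ {P : Set} (d : Dec P) → P → ⟦ ⌊ d ⌋ ⟧ ≡ 1ℚ
⟦⟧-yes (yes _) _ = refl
⟦⟧-yes (no ¬p) p = contradiction p ¬p

⟦⟧-no : ∀ {P : Set} (d : Dec P) → ¬ P → ⟦ ⌊ d ⌋ ⟧ ≡ 0ℚ
⟦⟧-no (yes p) ¬p = contradiction p ¬p
⟦⟧-no (no _) _ = refl

∏-one-or-zero : ∀ {A : Set} (xs : List A) (g : A → Bool) → All (λ x → g x ≡ true) xs ⊎ ∏ xs (λ x → ⟦ g x ⟧) ≡ 0ℚ
∏-one-or-zero [] g = inj₁ []
∏-one-or-zero (x ∷ xs) g with bool-split (g x) | ∏-one-or-zero xs g
... | inj₂ f | _ = inj₂ (trans (cong (λ b → ⟦ b ⟧ Q.* ∏ xs (λ x → ⟦ g x ⟧)) f) (Q.*-zeroˡ (∏ xs (λ x → ⟦ g x ⟧))))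
... | inj₁ _ | inj₂ z = inj₂ (trans (cong (⟦ g x ⟧ Q.*_) z) (Q.*-zeroʳ ⟦ g x ⟧))
... | inj₁ t | inj₁ ts = inj₁ (t ∷ ts)

∏-one : ∀ {A : Set} {xs : List A} {g : A → Bool} → All (λ x → g x ≡ true) xs → ∏ xs (λ x → ⟦ g x ⟧) ≡ 1ℚ
∏-one [] = refl
∏-one {xs = x ∷ xs} {g} (t ∷ ts) = trans (cong₂ Q._*_ (cong ⟦_⟧ t) (∏-one ts)) (Q.*-identityˡ 1ℚ)

∑ᵠ-one : ∀ {A : Set} {xs : List A} {x₀} → Unique xs → x₀ ∈ˡ xs → (f : A → ℚ) → f x₀ ≡ 1ℚ →
  (∀ {x} → x ∈ˡ xs → x ≢ x₀ → f x ≡ 0ℚ) → ∑ᵠ xs f ≡ 1ℚ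
∑ᵠ-one {xs = x ∷ xs} (x∉ ∷ u) (here refl) f e z = trans (cong₂ Q._+_ e
  (trans (∑ℚ.∑-cong-∈ xs (λ m → z (there m) (λ q → All.lookup x∉ m (sym q)))) (∑ℚ.∑-zero xs))) (Q.+-identityʳ 1ℚ)
∑ᵠ-one {xs = x ∷ xs} (x∉ ∷ u) (there m) f e z = trans (cong₂ Q._+_ (z (here refl) (λ q → All.lookup x∉ m q))
  (∑ᵠ-one u m f e (z ∘ there))) (Q.+-identityˡ 1ℚ)

infixr 8 _^ᵠ_
_^ᵠ_ : ℚ → ℕ → ℚ
p ^ᵠ zero = 1ℚ
p ^ᵠ suc n = p Q.* p ^ᵠ n

^ᵠ-+ : ∀ p m n → p ^ᵠ (m + n) ≡ p ^ᵠ m Q.* p ^ᵠ n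
^ᵠ-+ p zero n = sym (Q.*-identityˡ _)
^ᵠ-+ p (suc m) n = trans (cong (p Q.*_) (^ᵠ-+ p m n)) (sym (Q.*-assoc p _ _))

module Colourings {X C : Set} (_≟X_ : DecidableEquality X) (_≟C_ : DecidableEquality C) (L : List C) (unique : Unique L) (base : C) where
  recolour : X → C → (X → C) → X → C
  recolour d a c x = if ⌊ x ≟X d ⌋ then a else c x

  recolour-same : ∀ d a c → recolour d a c d ≡ a
  recolour-same d a c = cong (λ b → if b then a else c d) (⌊⌋-true (d ≟X d) refl)

  recolour-other : ∀ d a c x → x ≢ d → recolour d a c x ≡ c x
  recolour-other d a c x ne with x ≟X d
  ... | yes e = contradiction e ne
  ... | no _ = refl

  -- Colourings are total functions, constantly `base` outside the listed points, so that
  -- expectations over them need no proofs of membership.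
  colourings : List X → List (X → C)
  colourings [] = (λ _ → base) ∷ []
  colourings (d ∷ ds) = concatMap (λ c → map (λ a → recolour d a c) L) (colourings ds)

  ∑-colourings : ∀ d ds f → ∑ᵠ (colourings (d ∷ ds)) f ≡ ∑ᵠ (colourings ds) (λ c → ∑ᵠ L (λ a → f (recolour d a c)))
  ∑-colourings d ds f = trans (∑ℚ.∑-concatMap _ (colourings ds) f) (∑ℚ.∑-cong (colourings ds) (λ c → ∑ℚ.∑-map _ L f))

  IgnoresColourOf : X → ((X → C) → ℚ) → Set
  IgnoresColourOf d f = ∀ c c′ → (∀ x → x ≢ d → c x ≡ c′ x) → f c ≡ f c′

  hit : X → C → (X → C) → ℚ
  hit d a c = ⟦ ⌊ c d ≟C a ⌋ ⟧

  -- The colour of `d` is uniform and independent of whatever ignores it: exactly one of the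
  -- recolourings of `d` hits `a`. Only the first occurrence of `d` in the list matters, as it
  -- overwrites the later ones.
  ∑-hit : ∀ {d a} ds → d ∈ˡ ds → a ∈ˡ L → ∀ f → IgnoresColourOf d f →
    ι (length L) Q.* ∑ᵠ (colourings ds) (λ c → hit d a c Q.* f c) ≡ ∑ᵠ (colourings ds) f
  ∑-hit {d} {a} (d′ ∷ ds) m ma f ign with d′ ≟X d
  ... | yes refl = begin
    ℓ Q.* ∑ᵠ (colourings (d ∷ ds)) (λ c → hit d a c Q.* f c)
      ≡⟨ cong (ℓ Q.*_) (∑-colourings d ds _) ⟩
    ℓ Q.* ∑ᵠ (colourings ds) (λ c → ∑ᵠ L (λ b → hit d a (recolour d b c) Q.* f (recolour d b c)))
      ≡⟨ cong (ℓ Q.*_) (∑ℚ.∑-cong (colourings ds) (λ c → begin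
           ∑ᵠ L (λ b → hit d a (recolour d b c) Q.* f (recolour d b c))
             ≡⟨ ∑ℚ.∑-cong L (λ b → trans (cong₂ Q._*_ (cong (λ z → ⟦ ⌊ z ≟C a ⌋ ⟧) (recolour-same d b c)) (swap c b a)) (Q.*-comm ⟦ ⌊ b ≟C a ⌋ ⟧ (f (recolour d a c)))) ⟩
           ∑ᵠ L (λ b → f (recolour d a c) Q.* ⟦ ⌊ b ≟C a ⌋ ⟧)
             ≡⟨ sym (*-∑ᵠ (f (recolour d a c)) L _) ⟩
           f (recolour d a c) Q.* ∑ᵠ L (λ b → ⟦ ⌊ b ≟C a ⌋ ⟧)
             ≡⟨ cong (f (recolour d a c) Q.*_) (∑ᵠ-one unique ma _ (⟦⟧-yes (a ≟C a) refl) (λ {b} _ ne → ⟦⟧-no (b ≟C a) ne)) ⟩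
           f (recolour d a c) Q.* 1ℚ
             ≡⟨ Q.*-identityʳ _ ⟩
           f (recolour d a c) ∎)) ⟩
    ℓ Q.* ∑ᵠ (colourings ds) (λ c → f (recolour d a c))
      ≡⟨ *-∑ᵠ ℓ (colourings ds) _ ⟩
    ∑ᵠ (colourings ds) (λ c → ℓ Q.* f (recolour d a c))
      ≡⟨ ∑ℚ.∑-cong (colourings ds) (λ c → trans (sym (∑ᵠ-const L _)) (∑ℚ.∑-cong L (λ b → swap c a b))) ⟩
    ∑ᵠ (colourings ds) (λ c → ∑ᵠ L (λ b → f (recolour d b c)))
      ≡⟨ sym (∑-colourings d ds f) ⟩
    ∑ᵠ (colourings (d ∷ ds)) f ∎
    where
    open ≡-Reasoning
    ℓ = ι (length L)
    swap : ∀ c b b′ → f (recolour d b c) ≡ f (recolour d b′ c)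
    swap c b b′ = ign _ _ (λ x ne → trans (recolour-other d b c x ne) (sym (recolour-other d b′ c x ne)))
  ∑-hit {d} {a} (d′ ∷ ds) (here e) ma f ign | no ne = contradiction (sym e) ne
  ∑-hit {d} {a} (d′ ∷ ds) (there m) ma f ign | no ne = begin
    ℓ Q.* ∑ᵠ (colourings (d′ ∷ ds)) (λ c → hit d a c Q.* f c)
      ≡⟨ cong (ℓ Q.*_) (trans (∑-colourings d′ ds _) (∑ℚ.∑-cong (colourings ds) (λ c → trans
           (∑ℚ.∑-cong L (λ b → cong (λ z → ⟦ ⌊ z ≟C a ⌋ ⟧ Q.* f (recolour d′ b c)) (recolour-other d′ b c d (ne ∘ sym))))
           (sym (*-∑ᵠ (hit d a c) L _))))) ⟩
    ℓ Q.* ∑ᵠ (colourings ds) (λ c → hit d a c Q.* ∑ᵠ L (λ b → f (recolour d′ b c)))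
      ≡⟨ ∑-hit ds m ma (λ c → ∑ᵠ L (λ b → f (recolour d′ b c))) (λ c c′ h → ∑ℚ.∑-cong L (λ b → ign _ _ (agree c c′ b h))) ⟩
    ∑ᵠ (colourings ds) (λ c → ∑ᵠ L (λ b → f (recolour d′ b c)))
      ≡⟨ sym (∑-colourings d′ ds f) ⟩
    ∑ᵠ (colourings (d′ ∷ ds)) f ∎
    where
    open ≡-Reasoning
    ℓ = ι (length L)
    agree : ∀ c c′ b → (∀ x → x ≢ d → c x ≡ c′ x) → ∀ x → x ≢ d → recolour d′ b c x ≡ recolour d′ b c′ x
    agree c c′ b h x ne′ with x ≟X d′
    ... | yes _ = refl
    ... | no _ = h x ne′

  module _ (points : List X) (a₀ : C) (a₀∈ : a₀ ∈ˡ L) where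
    ρ : ℚ
    ρ = inv (length L)

    ρ-ι : ρ Q.* ι (length L) ≡ 1ℚ
    ρ-ι = nonempty a₀∈
      where
      nonempty : ∀ {M : List C} → a₀ ∈ˡ M → inv (length M) Q.* ι (length M) ≡ 1ℚ
      nonempty {_ ∷ M} _ = inv-ι (length M)

    mean-hit : ∀ {d a} → d ∈ˡ points → a ∈ˡ L → ∀ f → IgnoresColourOf d f →
      mean (colourings points) (λ c → hit d a c Q.* f c) ≡ ρ Q.* mean (colourings points) f
    mean-hit {d} {a} m ma f ign = begin
      w Q.* s ≡⟨ sym (Q.*-identityˡ _) ⟩
      1ℚ Q.* (w Q.* s) ≡⟨ cong (Q._* (w Q.* s)) (sym ρ-ι) ⟩
      (ρ Q.* ι (length L)) Q.* (w Q.* s) ≡⟨ QSolver.solve 4 (λ r l w s → (r QSolver.:* l) QSolver.:* (w QSolver.:* s) QSolver.:= r QSolver.:* (w QSolver.:* (l QSolver.:* s))) refl ρ (ι (length L)) w s ⟩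
      ρ Q.* (w Q.* (ι (length L) Q.* s)) ≡⟨ cong (λ z → ρ Q.* (w Q.* z)) (∑-hit points m ma f ign) ⟩
      ρ Q.* (w Q.* ∑ᵠ (colourings points) f) ∎
      where
      open ≡-Reasoning
      w = inv (length (colourings points))
      s = ∑ᵠ (colourings points) (λ c → hit d a c Q.* f c)

    nonempty-colourings : ∀ ds → ∃ λ c → ∃ λ cs → colourings ds ≡ c ∷ cs
    nonempty-colourings [] = _ , _ , refl
    nonempty-colourings (d ∷ ds) with colourings ds | nonempty-colourings ds
    ... | .(c ∷ cs) | c , cs , refl = head L a₀∈
      where
      head : ∀ M → a₀ ∈ˡ M → ∃ λ c′ → ∃ λ cs′ → concatMap (λ c → map (λ a → recolour d a c) M) (c ∷ cs) ≡ c′ ∷ cs′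
      head (b ∷ M) _ = _ , _ , refl

    mean-const : ∀ r → mean (colourings points) (λ _ → r) ≡ r
    mean-const r with colourings points | nonempty-colourings points
    ... | .(c ∷ cs) | c , cs , refl = trans (cong (inv (suc (length cs)) Q.*_) (∑ᵠ-const (c ∷ cs) r))
          (trans (sym (Q.*-assoc (inv (suc (length cs))) (ι (suc (length cs))) r)) (trans (cong (Q._* r) (inv-ι (length cs))) (Q.*-identityˡ r)))

    -- Colours of distinct points are independent: the product over the remaining points ignores the
    -- colour of the first one.
    mean-hits : (D : List (X × C)) → Unique (map proj₁ D) → All (λ (d , a) → d ∈ˡ points × a ∈ˡ L) D →
      mean (colourings points) (λ c → ∏ D (λ (d , a) → hit d a c)) ≡ ρ ^ᵠ length D
    mean-hits [] _ _ = mean-const 1ℚ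
    mean-hits ((d , a) ∷ D) (d∉ ∷ u) ((m , ma) ∷ ms) = trans
      (mean-hit m ma (λ c → ∏ D (λ (d , a) → hit d a c)) (λ c c′ h → ∏ℚ.∑-cong-∈ D (λ {(d′ , a′)} m′ →
        cong (λ z → ⟦ ⌊ z ≟C a′ ⌋ ⟧) (h d′ (λ e → All.lookup d∉ (∈-map⁺ proj₁ m′) (sym e))))))
      (cong (ρ Q.*_) (mean-hits D u ms))

module Rates {k : ℕ} (t : ℕ) (𝓑 : List (Subset k)) (d : ℕ) where
  open Own t 𝓑

  -- δ is the probability that an edge is reserved, and ρ that it picks a given role. κ collects,
  -- over all own roles of an edge, the probability that every edge of the proposed block agrees and
  -- those in 𝓑 are reserved; that the own edges are free contributes the remaining factor u ^ L.
  δ ρ κ : ℚ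
  δ = inv (suc d)
  ρ = inv (length (roles k t))
  κ = ι (length ownRoles) Q.* (ρ ^ᵠ length (subsets k t) Q.* δ ^ᵠ length non)

  -- The probability that an edge is still free after r rounds, if its surroundings are tree-like.
  u : ℕ → ℚ
  u zero = 1ℚ Q.- δ
  u (suc r) = u r Q.- κ Q.* u r ^ᵠ length own

-- Decay of the number of free edges

opaque
  unfolding inv
  -- The denominator of p serves, since a positive numerator is at least 1.
  archimedean : ∀ p → 0ℚ Q.< p → ∃ λ n → inv (suc n) Q.≤ p
  archimedean p@(Q.mkℚ (ℤ.+_ (suc a)) n _) _ = n , Q.toℚᵘ-cancel-≤ (begin
    Q.toℚᵘ (inv (suc n)) ≃⟨ Q.toℚᵘ-fromℚᵘ (Qᵘ.mkℚᵘ (ℤ.+ 1) n) ⟩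
    Qᵘ.mkℚᵘ (ℤ.+ 1) n ≤⟨ Qᵘ.*≤* (ℤ.*-monoʳ-≤-nonNeg (ℤ.+ suc n) {ℤ.+ 1} {ℤ.+ suc a} (ℤ.+≤+ (s≤s z≤n))) ⟩
    Qᵘ.mkℚᵘ (ℤ.+ suc a) n ∎)
    where open Qᵘ.≤-Reasoning
  archimedean (Q.mkℚ (ℤ.+_ zero) n _) (Q.*<* (ℤ.+<+ ()))
  archimedean (Q.mkℚ ℤ.-[1+ a ] n _) (Q.*<* ())

*-pos : ∀ {p q} → 0ℚ Q.< p → 0ℚ Q.< q → 0ℚ Q.< p Q.* q
*-pos {p} {q} hp hq = Q.≤-<-trans (Q.≤-reflexive (sym (Q.*-zeroʳ p))) (Q.*-monoʳ-<-pos p {{Q.positive hp}} hq)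

^ᵠ-pos : ∀ {p} n → 0ℚ Q.< p → 0ℚ Q.< p ^ᵠ n
^ᵠ-pos zero h = Q.*<* (ℤ.+<+ (s≤s z≤n))
^ᵠ-pos (suc n) h = *-pos h (^ᵠ-pos n h)

^ᵠ-nonNeg : ∀ {p} n → 0ℚ Q.≤ p → 0ℚ Q.≤ p ^ᵠ n
^ᵠ-nonNeg zero h = Q.*≤* (ℤ.+≤+ z≤n)
^ᵠ-nonNeg (suc n) h = *-nonNeg h (^ᵠ-nonNeg n h)

^ᵠ-mono : ∀ {p q} n → 0ℚ Q.≤ p → p Q.≤ q → p ^ᵠ n Q.≤ q ^ᵠ n
^ᵠ-mono zero h le = Q.≤-refl
^ᵠ-mono {p} {q} (suc n) h le = Q.≤-trans (*-mono-nonNegˡ h (^ᵠ-mono n h le)) (*-mono-nonNegʳ (^ᵠ-nonNeg n (Q.≤-trans h le)) le)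

^ᵠ-≤1 : ∀ {p} n → 0ℚ Q.≤ p → p Q.≤ 1ℚ → p ^ᵠ n Q.≤ 1ℚ
^ᵠ-≤1 {p} n h le = Q.≤-trans (^ᵠ-mono n h le) (Q.≤-reflexive (one n))
  where
  one : ∀ n → 1ℚ ^ᵠ n ≡ 1ℚ
  one zero = refl
  one (suc n) = trans (Q.*-identityˡ _) (one n)

inv-≤1 : ∀ n → inv (suc n) Q.≤ 1ℚ
inv-≤1 n = Q.≤-trans (Q.≤-reflexive (sym (Q.*-identityʳ (inv (suc n)))))
  (Q.≤-trans (*-mono-nonNegˡ (inv-nonNeg (suc n)) (Q.≤-trans (Q.≤-reflexive (sym ι1)) (ι-mono (s≤s z≤n)))) (Q.≤-reflexive (inv-ι n)))

sub-≤ : ∀ {p q} → 0ℚ Q.≤ q → p Q.- q Q.≤ p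
sub-≤ {p} h = Q.≤-trans (Q.+-monoʳ-≤ p (Q.neg-antimono-≤ h)) (Q.≤-reflexive (Q.+-identityʳ p))

sub-nonNeg : ∀ {p q} → q Q.≤ p → 0ℚ Q.≤ p Q.- q
sub-nonNeg {p} {q} h = Q.≤-trans (Q.≤-reflexive (sym (Q.+-inverseʳ q))) (Q.+-monoˡ-≤ (Q.- q) h)

-- While u exceeds η it drops by at least κ η ^ L in every step.
module Decay (κ : ℚ) (L′ : ℕ) (κ>0 : 0ℚ Q.< κ) (κ≤1 : κ Q.≤ 1ℚ) (u : ℕ → ℚ) (0≤u₀ : 0ℚ Q.≤ u 0) (u₀≤1 : u 0 Q.≤ 1ℚ)
  (u-suc : ∀ r → u (suc r) ≡ u r Q.- κ Q.* u r ^ᵠ suc L′) where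

  private
    drop-nonNeg : ∀ {p} → 0ℚ Q.≤ p → 0ℚ Q.≤ κ Q.* p ^ᵠ suc L′
    drop-nonNeg h = *-nonNeg (Q.<⇒≤ κ>0) (^ᵠ-nonNeg (suc L′) h)

    drop-≤ : ∀ {p} → 0ℚ Q.≤ p → p Q.≤ 1ℚ → κ Q.* p ^ᵠ suc L′ Q.≤ p
    drop-≤ {p} h le = begin
      κ Q.* (p Q.* p ^ᵠ L′) ≤⟨ *-mono-nonNegʳ (^ᵠ-nonNeg (suc L′) h) κ≤1 ⟩
      1ℚ Q.* (p Q.* p ^ᵠ L′) ≡⟨ Q.*-identityˡ _ ⟩
      p Q.* p ^ᵠ L′ ≤⟨ *-mono-nonNegˡ h (^ᵠ-≤1 L′ h le) ⟩
      p Q.* 1ℚ ≡⟨ Q.*-identityʳ p ⟩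
      p ∎
      where open Q.≤-Reasoning

  u-bounds : ∀ r → 0ℚ Q.≤ u r × u r Q.≤ 1ℚ
  u-bounds zero = 0≤u₀ , u₀≤1
  u-bounds (suc r) with u-bounds r
  ... | lo , hi = subst (0ℚ Q.≤_) (sym (u-suc r)) (sub-nonNeg (drop-≤ lo hi))
    , Q.≤-trans (Q.≤-reflexive (u-suc r)) (Q.≤-trans (sub-≤ (drop-nonNeg lo)) hi)

  decays : ∀ η → 0ℚ Q.< η → ∃ λ R → u R Q.≤ η
  decays η η>0 with archimedean (κ Q.* η ^ᵠ suc L′) (*-pos κ>0 (^ᵠ-pos (suc L′) η>0))
  -- A step above η lowers u by at least β ≥ 1/(n + 1), so n + 1 such steps use up the initial
  -- value, which is at most 1.
  ... | n , small = suc n , conclude (progress (suc n))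
    where
    open Q.≤-Reasoning
    β = κ Q.* η ^ᵠ suc L′
    progress : ∀ r → u r Q.≤ η ⊎ u r Q.+ ι r Q.* β Q.≤ 1ℚ
    progress zero = inj₂ (begin
      u 0 Q.+ ι 0 Q.* β ≡⟨ cong (u 0 Q.+_) (trans (cong (Q._* β) ι0) (Q.*-zeroˡ β)) ⟩
      u 0 Q.+ 0ℚ ≡⟨ Q.+-identityʳ (u 0) ⟩
      u 0 ≤⟨ u₀≤1 ⟩
      1ℚ ∎)
    progress (suc r) with u r Q.≤? η
    ... | yes le = inj₁ (Q.≤-trans (Q.≤-reflexive (u-suc r)) (Q.≤-trans (sub-≤ (drop-nonNeg (proj₁ (u-bounds r)))) le))
    ... | no nle with progress r
    ...   | inj₁ le = contradiction le nle
    ...   | inj₂ le = inj₂ (begin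
      u (suc r) Q.+ ι (suc r) Q.* β
        ≡⟨ cong₂ Q._+_ (u-suc r) (trans (cong (Q._* β) (trans (ι-+ 1 r) (cong (Q._+ ι r) ι1))) (trans (Q.*-distribʳ-+ β 1ℚ (ι r)) (cong (Q._+ ι r Q.* β) (Q.*-identityˡ β)))) ⟩
      (u r Q.- κ Q.* u r ^ᵠ suc L′) Q.+ (β Q.+ ι r Q.* β)
        ≤⟨ Q.+-monoˡ-≤ (β Q.+ ι r Q.* β) (Q.+-monoʳ-≤ (u r) (Q.neg-antimono-≤ (*-mono-nonNegˡ (Q.<⇒≤ κ>0) (^ᵠ-mono (suc L′) (Q.<⇒≤ η>0) (Q.<⇒≤ (Q.≰⇒> nle)))))) ⟩
      (u r Q.- β) Q.+ (β Q.+ ι r Q.* β)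
        ≡⟨ trans (QSolver.solve 4 (λ a b c x → (a QSolver.:+ x) QSolver.:+ (b QSolver.:+ c) QSolver.:= (a QSolver.:+ c) QSolver.:+ (x QSolver.:+ b)) refl (u r) β (ι r Q.* β) (Q.- β))
             (trans (cong ((u r Q.+ ι r Q.* β) Q.+_) (Q.+-inverseˡ β)) (Q.+-identityʳ _)) ⟩
      u r Q.+ ι r Q.* β
        ≤⟨ le ⟩
      1ℚ ∎)
    conclude : u (suc n) Q.≤ η ⊎ u (suc n) Q.+ ι (suc n) Q.* β Q.≤ 1ℚ → u (suc n) Q.≤ η
    conclude (inj₁ le) = le
    conclude (inj₂ le) = Q.≤-trans (begin
      u (suc n) ≡⟨ sym (trans (Q.+-assoc (u (suc n)) 1ℚ (Q.- 1ℚ)) (Q.+-identityʳ (u (suc n)))) ⟩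
      (u (suc n) Q.+ 1ℚ) Q.- 1ℚ ≤⟨ Q.+-monoˡ-≤ (Q.- 1ℚ) (Q.+-monoʳ-≤ (u (suc n)) large) ⟩
      (u (suc n) Q.+ ι (suc n) Q.* β) Q.- 1ℚ ≤⟨ Q.+-monoˡ-≤ (Q.- 1ℚ) le ⟩
      0ℚ ∎) (Q.<⇒≤ η>0)
      where
      large : 1ℚ Q.≤ ι (suc n) Q.* β
      large = Q.≤-trans (Q.≤-reflexive (trans (sym (inv-ι n)) (Q.*-comm (inv (suc n)) (ι (suc n))))) (*-mono-nonNegˡ (ι-nonNeg (suc n)) small)

module RateBounds {k : ℕ} (t : ℕ) (𝓑 : List (Subset k)) (d : ℕ) (T : Subset k) (T∈ : T ∈ˡ Own.own t 𝓑) (v₀ : Fin k) where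
  open Own t 𝓑
  open Rates t 𝓑 d
  private
    module R = Roles {k} {k} t v₀
    size : ∣ T ∣ ≡ t
    size = ∈-subsets⁻ k t (proj₁ (∈-filter⁻ own? {xs = subsets k t} T∈))
    -- A sample own role, read off from T in the block 0, ..., k - 1; its existence gives κ > 0.
    P = restrict (V.allFin k) T
    a = R.roleOf P (vertices P)
    isRole : R.IsRole a
    isRole = R.isRole-roleOf P (restrict-injective (V.allFin k) (λ i j e → trans (sym (V.lookup-allFin i)) (trans e (V.lookup-allFin j))) T)
      (trans (cong ∣_∣ (supp-restrict (V.allFin k) T)) size)
    own-a : ¬ supp a ∈ˡ 𝓑
    own-a m = proj₂ (∈-filter⁻ own? {xs = subsets k t} T∈)
      (subst (_∈ˡ 𝓑) (trans (R.supp-roleOf P (vertices P)) (supp-restrict (V.allFin k) T)) m)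

    nonempty : ∀ {A : Set} {x : A} {xs} → x ∈ˡ xs → ∃ λ n → length xs ≡ suc n
    nonempty {xs = _ ∷ xs} _ = length xs , refl

    inv-pos′ : ∀ {n} → (∃ λ m → n ≡ suc m) → 0ℚ Q.< inv n
    inv-pos′ (m , refl) = inv-pos m

    inv-≤1′ : ∀ {n} → (∃ λ m → n ≡ suc m) → inv n Q.≤ 1ℚ
    inv-≤1′ (m , refl) = inv-≤1 m

    a∈roles : a ∈ˡ roles k t
    a∈roles = R.IsRole⇒∈roles isRole

  own-nonempty : ∃ λ L′ → length own ≡ suc L′
  own-nonempty = nonempty T∈

  κ>0 : 0ℚ Q.< κ
  κ>0 with nonempty (∈-filter⁺ ownRole? a∈roles (R.IsRole.size isRole , R.IsRole.injective isRole , own-a))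
  ... | n , eq = *-pos (subst (λ z → 0ℚ Q.< ι z) (sym eq) (Q.<-≤-trans (Q.*<* (ℤ.+<+ (s≤s z≤n))) (Q.≤-trans (Q.≤-reflexive (sym ι1)) (ι-mono (s≤s z≤n)))))
    (*-pos (^ᵠ-pos (length (subsets k t)) (inv-pos′ (nonempty a∈roles))) (^ᵠ-pos (length non) (inv-pos d)))

  -- There are at most 1/ρ own roles, and one factor ρ already compensates for them.
  κ≤1 : κ Q.≤ 1ℚ
  κ≤1 with nonempty (∈-subsets⁺ T size) | nonempty a∈roles
  ... | ℓ , eqℓ | m , eqm = begin
    ι (length ownRoles) Q.* (ρ ^ᵠ length (subsets k t) Q.* δ ^ᵠ length non)
      ≤⟨ *-mono-nonNegˡ (ι-nonNeg _) (*-mono-nonNegˡ (^ᵠ-nonNeg (length (subsets k t)) ρ≥0) (^ᵠ-≤1 (length non) (inv-nonNeg (suc d)) (inv-≤1 d))) ⟩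
    ι (length ownRoles) Q.* (ρ ^ᵠ length (subsets k t) Q.* 1ℚ)
      ≡⟨ cong (ι (length ownRoles) Q.*_) (trans (Q.*-identityʳ _) (cong (ρ ^ᵠ_) eqℓ)) ⟩
    ι (length ownRoles) Q.* (ρ Q.* ρ ^ᵠ ℓ)
      ≤⟨ *-mono-nonNegˡ (ι-nonNeg _) (*-mono-nonNegˡ ρ≥0 (^ᵠ-≤1 ℓ ρ≥0 (inv-≤1′ (nonempty a∈roles)))) ⟩
    ι (length ownRoles) Q.* (ρ Q.* 1ℚ)
      ≡⟨ cong (ι (length ownRoles) Q.*_) (Q.*-identityʳ ρ) ⟩
    ι (length ownRoles) Q.* ρ
      ≤⟨ *-mono-nonNegʳ ρ≥0 (ι-mono (Lp.length-filter ownRole? (roles k t))) ⟩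
    ι (length (roles k t)) Q.* ρ
      ≡⟨ trans (Q.*-comm _ ρ) (trans (cong (λ n → inv n Q.* ι n) eqm) (inv-ι m)) ⟩
    1ℚ ∎
    where
    open Q.≤-Reasoning
    ρ≥0 : 0ℚ Q.≤ ρ
    ρ≥0 = inv-nonNeg (length (roles k t))

  u-decays : ∀ η → 0ℚ Q.< η → ∃ λ R → u R Q.≤ η
  u-decays η h with own-nonempty
  ... | L′ , eq = Decay.decays κ L′ κ>0 κ≤1 u (sub-nonNeg (inv-≤1 d)) (sub-≤ (inv-nonNeg (suc d)))
    (λ r → cong (λ L → u r Q.- κ Q.* u r ^ᵠ L) eq) η h

-- Coverings of [k]

bit : Bool → ℕ
bit true = 1
bit false = 0

∣∣≡∑ : ∀ {n} (p : Subset n) → ∣ p ∣ ≡ ∑ (allFin n) (λ i → bit (lookup p i))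
∣∣≡∑ [] = refl
∣∣≡∑ {suc n} (b ∷ p) = trans (head b) (cong (bit b +_) (trans (∣∣≡∑ p)
  (sym (trans (cong (λ l → ∑ l (λ i → bit (lookup (b ∷ p) i))) (sym (Lp.map-tabulate {n = n} id suc))) (∑-map suc (allFin n) _)))))
  where
  head : ∀ b → ∣ b ∷ p ∣ ≡ bit b + ∣ p ∣
  head true = refl
  head false = refl

shrink : ∀ {c} s (p : Subset c) → s ≤ ∣ p ∣ → ∃ λ q → ∣ q ∣ ≡ s × (∀ {i} → q ∋ i → p ∋ i)
shrink zero [] _ = [] , refl , id
shrink s (false ∷ p) le with shrink s p le
... | q , e , sub = false ∷ q , e , λ { {suc i} → sub }
shrink (suc s) (true ∷ p) (s≤s le) with shrink s p le
... | q , e , sub = true ∷ q , cong suc e , λ { {zero} _ → refl ; {suc i} → sub }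
shrink zero (true ∷ p) _ with shrink zero p z≤n
... | q , e , sub = false ∷ q , e , λ { {suc i} → sub }

∣∣-injection : ∀ {m n} (p : Subset m) (q : Subset n) (f : Fin m → Fin n) → (∀ {i j} → f i ≡ f j → i ≡ j) →
  (∀ {i} → p ∋ i → q ∋ f i) → ∣ p ∣ ≤ ∣ q ∣
∣∣-injection p q f inj h = begin
  ∣ p ∣ ≡⟨ sym (trans (Lp.length-map f (elements p)) (length-elements p)) ⟩
  length (map f (elements p)) ≤⟨ length-mono-⊆ _ _ (Un.map⁺ inj (Unique-elements p)) into ⟩
  length (elements q) ≡⟨ length-elements q ⟩
  ∣ q ∣ ∎
  where
  open ≤-Reasoning
  into : ∀ {v} → v ∈ˡ map f (elements p) → v ∈ˡ elements q
  into m with ∈-map⁻ f m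
  ... | i , mi , refl = ∈-elements⁺ q (h (∈-elements⁻ p mi))

module Covering {k c s t lam q : ℕ} (1≤λ : 1 ≤ lam) (λ≤c : lam ≤ c) (sk≡ : lam + q * c ≡ s * k) (t≡ : t ≡ suc q) (s<c : s < c)
  (𝓑 : List (Subset k)) (disjointFree : DisjointFree lam (s + 1) (c ∸ s + 1) 𝓑) where

  -- Truncate every point to exactly s of its sets; the total size sk = λ + q c then forces λ of the sets to keep size t.
  no-cover : (B : Fin c → Subset k) → (∀ j → ∣ B j ∣ ≤ t) → (∀ j → ∣ B j ∣ ≡ t → B j ∈ˡ 𝓑) → ¬ (∀ b → s ≤ ∣ tabulate (λ j → lookup (B j) b) ∣)
  no-cover B small full covered = disjointFree A A∈𝓑 (part₁ , part₂)
    where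
    column : Fin k → Subset c
    column b = tabulate (λ j → lookup (B j) b)
    Q : Fin k → Subset c
    Q b = proj₁ (shrink s (column b) (covered b))
    ∣Q∣ : ∀ b → ∣ Q b ∣ ≡ s
    ∣Q∣ b = proj₁ (proj₂ (shrink s (column b) (covered b)))
    B′ : Fin c → Subset k
    B′ j = tabulate (λ b → lookup (Q b) j)
    lookup-B′ : ∀ j b → lookup (B′ j) b ≡ lookup (Q b) j
    lookup-B′ j b = V.lookup∘tabulate (λ b → lookup (Q b) j) b
    B′⊆B : ∀ j {b} → B′ j ∋ b → B j ∋ b
    B′⊆B j {b} m = trans (sym (V.lookup∘tabulate (λ j → lookup (B j) b) j))
      (proj₂ (proj₂ (shrink s (column b) (covered b))) (trans (sym (lookup-B′ j b)) m))
    ∣B′∣≤t : ∀ j → ∣ B′ j ∣ ≤ t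
    ∣B′∣≤t j = ≤-trans (⊆⇒∣∣≤ (B′ j) (B j) (B′⊆B j)) (small j)
    full? : ∀ j → Dec (∣ B′ j ∣ ≡ t)
    full? j = ∣ B′ j ∣ ≟ t
    J : List (Fin c)
    J = filter full? (allFin c)
    total : ∑ (allFin c) (λ j → ∣ B′ j ∣) ≡ s * k
    total = begin
      ∑ (allFin c) (λ j → ∣ B′ j ∣) ≡⟨ ∑-cong (allFin c) (λ j → trans (∣∣≡∑ (B′ j)) (∑-cong (allFin k) (λ b → cong bit (lookup-B′ j b)))) ⟩
      ∑ (allFin c) (λ j → ∑ (allFin k) (λ b → bit (lookup (Q b) j))) ≡⟨ ∑-swap (allFin c) (allFin k) _ ⟩
      ∑ (allFin k) (λ b → ∑ (allFin c) (λ j → bit (lookup (Q b) j))) ≡⟨ ∑-cong (allFin k) (λ b → trans (sym (∣∣≡∑ (Q b))) (∣Q∣ b)) ⟩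
      ∑ (allFin k) (λ _ → s) ≡⟨ ∑-const (allFin k) s ⟩
      length (allFin k) * s ≡⟨ cong (_* s) (length-allFin k) ⟩
      k * s ≡⟨ *-comm k s ⟩
      s * k ∎
      where open ≡-Reasoning
    -- A truncated set has size q + 1 if it is full and at most q otherwise; taking q off each of
    -- the c sets leaves λ.
    λ≤J : lam ≤ length J
    λ≤J = +-cancelʳ-≤ (q * c) _ _ (begin
      lam + q * c ≡⟨ trans sk≡ (sym total) ⟩
      ∑ (allFin c) (λ j → ∣ B′ j ∣) ≤⟨ ∑-mono (allFin c) (λ j → bound j (full? j)) ⟩
      ∑ (allFin c) (λ j → ind (full? j) + q) ≡⟨ ∑-⊕ (allFin c) _ _ ⟩
      ∑ (allFin c) (λ j → ind (full? j)) + ∑ (allFin c) (λ _ → q)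
        ≡⟨ cong₂ _+_ (∑-ind-filter full? (allFin c)) (trans (∑-const (allFin c) q) (trans (cong (_* q) (length-allFin c)) (*-comm c q))) ⟩
      length J + q * c ∎)
      where
      open ≤-Reasoning
      bound : ∀ j (d : Dec (∣ B′ j ∣ ≡ t)) → ∣ B′ j ∣ ≤ ind d + q
      bound j (yes e) = ≤-reflexive (trans e t≡)
      bound j (no ne) = ℕ.≤-pred (≤-trans (≤∧≢⇒< (∣B′∣≤t j) ne) (≤-reflexive t≡))
    index : Fin lam → Fin c
    index i = Data.List.lookup J (F.inject≤ i λ≤J)
    index-injective : ∀ {i j} → index i ≡ index j → i ≡ j
    index-injective e = F.inject≤-injective λ≤J λ≤J _ _ (lookup-Unique (Un.filter⁺ full? (Un.allFin⁺ c)) e)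
    index-full : ∀ i → ∣ B′ (index i) ∣ ≡ t
    index-full i = proj₂ (∈-filter⁻ full? {xs = allFin c} (∈-lookup (F.inject≤ i λ≤J)))
    A : Fin lam → Subset k
    A i = B′ (index i)
    A∈𝓑 : ∀ i → A i ∈ˡ 𝓑
    A∈𝓑 i = subst (_∈ˡ 𝓑) (sym A≡B) (full (index i) (trans (cong ∣_∣ (sym A≡B)) (index-full i)))
      where
      A≡B : A i ≡ B (index i)
      A≡B = ⊆-full (A i) (B (index i)) (B′⊆B (index i)) (≤-trans (small (index i)) (≤-reflexive (sym (index-full i))))
    -- If b lay in all s + 1 sets, it would lie in more than the s sets left to it.
    part₁ : (S : Subset lam) → ∣ S ∣ ≡ s + 1 → (b : Fin k) → ∃ λ i → i ∈ S × b ∉ A i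
    part₁ S ∣S∣ b with F.any? (λ i → (lookup S i Bool.≟ true) ×-dec ¬? (lookup (A i) b Bool.≟ true))
    ... | yes (i , m , n) = i , V.lookup⇒[]= i S m , n ∘ V.[]=⇒lookup
    ... | no none = contradiction (≤-trans (≤-reflexive (sym (trans ∣S∣ (+-comm s 1))))
          (≤-trans (∣∣-injection S (Q b) index index-injective into) (≤-reflexive (∣Q∣ b)))) (<-irrefl refl)
      where
      into : ∀ {i} → S ∋ i → Q b ∋ index i
      into {i} m with lookup (A i) b Bool.≟ true
      ... | yes e = trans (sym (lookup-B′ (index i) b)) e
      ... | no ne = contradiction (i , m , ne) none
    -- If b lay in none of these c - s + 1 sets, it would miss more than the c - s sets outside
    -- `Q b`.
    part₂ : (S : Subset lam) → ∣ S ∣ ≡ c ∸ s + 1 → (b : Fin k) → ∃ λ i → i ∈ S × b ∈ A i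
    part₂ S ∣S∣ b with F.any? (λ i → (lookup S i Bool.≟ true) ×-dec (lookup (A i) b Bool.≟ true))
    ... | yes (i , m , n) = i , V.lookup⇒[]= i S m , V.lookup⇒[]= b (A i) n
    ... | no none = contradiction (≤-trans (≤-reflexive (sym (trans ∣S∣ (+-comm (c ∸ s) 1))))
          (≤-trans (∣∣-injection S (∁ (Q b)) index index-injective into) (≤-reflexive (trans (Sub.∣∁p∣≡n∸∣p∣ (Q b)) (cong (c ∸_) (∣Q∣ b)))))) (<-irrefl refl)
      where
      into : ∀ {i} → S ∋ i → ∁ (Q b) ∋ index i
      into {i} m with bool-split (lookup (Q b) (index i))
      ... | inj₁ e = contradiction (i , m , trans (lookup-B′ (index i) b) e) none
      ... | inj₂ e = trans (V.lookup-map (index i) not (Q b)) (cong not e)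

%-gap : ∀ c .{{_ : NonZero c}} x i i′ → (x + i) % c ≡ (x + i′) % c → (x + i) div c < (x + i′) div c → c + i ≤ i′
%-gap c x i i′ e lt = +-cancelˡ-≤ x _ _ (begin
  x + (c + i) ≡⟨ trans (sym (+-assoc x c i)) (trans (cong (_+ i) (+-comm x c)) (+-assoc c x i)) ⟩
  c + (x + i) ≡⟨ cong (c +_) (m≡m%n+[m/n]*n (x + i) c) ⟩
  c + ((x + i) % c + (x + i) div c * c) ≡⟨ trans (sym (+-assoc c ((x + i) % c) _)) (trans (cong (_+ (x + i) div c * c) (+-comm c ((x + i) % c))) (+-assoc ((x + i) % c) c _)) ⟩
  (x + i) % c + suc ((x + i) div c) * c ≤⟨ +-mono-≤ (≤-reflexive e) (*-monoˡ-≤ c lt) ⟩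
  (x + i′) % c + (x + i′) div c * c ≡⟨ sym (m≡m%n+[m/n]*n (x + i′) c) ⟩
  x + i′ ∎)
  where open ≤-Reasoning

%-cancel : ∀ c .{{_ : NonZero c}} x i i′ → i < c → i′ < c → (x + i) % c ≡ (x + i′) % c → i ≡ i′
%-cancel c x i i′ i<c i′<c e with ℕ.<-cmp ((x + i) div c) ((x + i′) div c)
... | tri≈ _ eq _ = +-cancelˡ-≡ x i i′ (trans (m≡m%n+[m/n]*n (x + i) c)
        (trans (cong₂ (λ r m → r + m * c) e eq) (sym (m≡m%n+[m/n]*n (x + i′) c))))
... | tri< lt _ _ = contradiction (%-gap c x i i′ e lt) (<⇒≱ (<-≤-trans i′<c (m≤m+n c i)))
... | tri> _ _ gt = contradiction (%-gap c x i′ i (sym e) gt) (<⇒≱ (<-≤-trans i<c (m≤m+n c i′)))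

-- Dealing the sk pairs (b , i) round-robin to c sets gives sets of size at most ⌈sk/c⌉ in which every point is covered s times.
module Deal {k c′ s t : ℕ} (sk≤ : s * k ≤ t * suc c′) (s≤c : s ≤ suc c′) where
  private
    c = suc c′

    position : Fin k → Fin s → ℕ
    position b i = toℕ (F.combine b i)

    slot? : ∀ (j : Fin c) b → Dec (∃ λ i → position b i % c ≡ toℕ j)
    slot? j b = F.any? λ i → position b i % c ≟ toℕ j

  B : Fin c → Subset k
  B j = tabulate (λ b → ⌊ slot? j b ⌋)

  B⁺ : ∀ {j : Fin c} {b} i → position b i % c ≡ toℕ j → B j ∋ b
  B⁺ {j} {b} i e = trans (V.lookup∘tabulate _ b) (⌊⌋-true (slot? j b) (i , e))

  B⁻ : ∀ {j : Fin c} {b} → B j ∋ b → ∃ λ i → position b i % c ≡ toℕ j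
  B⁻ {j} {b} m = ⌊⌋-true⁻ (slot? j b) (trans (sym (V.lookup∘tabulate _ b)) m)

  ∣B∣≤t : ∀ j → ∣ B j ∣ ≤ t
  ∣B∣≤t j = begin
    ∣ B j ∣ ≡⟨ sym (length-elements (B j)) ⟩
    length (elements (B j)) ≡⟨ sym (Lp.length-map row (elements (B j))) ⟩
    length (map row (elements (B j))) ≤⟨ length-mono-⊆ _ (upTo t) (Unique-map-∈ row _ row-injective (Unique-elements (B j))) into ⟩
    length (upTo t) ≡⟨ Lp.length-upTo t ⟩
    t ∎
    where
    open ≤-Reasoning
    -- Distinct positions dealt to the same set differ in their quotient by c, and the quotients are
    -- below t because s k ≤ t c. The default `t` never occurs for points of `B j`.
    row′ : ∀ {b} → Dec (∃ λ i → position b i % c ≡ toℕ j) → ℕ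
    row′ {b} (yes (i , _)) = position b i div c
    row′ (no _) = t
    row : Fin k → ℕ
    row b = row′ (slot? j b)
    row-at : ∀ {b} (d : Dec (∃ λ i → position b i % c ≡ toℕ j)) → (∃ λ i → position b i % c ≡ toℕ j) → ∃ λ i → position b i % c ≡ toℕ j × row′ d ≡ position b i div c
    row-at (yes (i , e)) _ = i , e , refl
    row-at (no n) p = contradiction p n
    row-injective : ∀ {b b′} → b ∈ˡ elements (B j) → b′ ∈ˡ elements (B j) → row b ≡ row b′ → b ≡ b′
    row-injective {b} {b′} m m′ eq with row-at (slot? j b) (B⁻ {j} {b} (∈-elements⁻ (B j) m)) | row-at (slot? j b′) (B⁻ {j} {b′} (∈-elements⁻ (B j) m′))
    ... | i , e , r | i′ , e′ , r′ = proj₁ (F.combine-injective b i b′ i′ (F.toℕ-injective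
          (trans (m≡m%n+[m/n]*n (position b i) c) (trans (cong₂ (λ x y → x + y * c) (trans e (sym e′)) (trans (sym r) (trans eq r′)))
            (sym (m≡m%n+[m/n]*n (position b′ i′) c))))))
    into : ∀ {x} → x ∈ˡ map row (elements (B j)) → x ∈ˡ upTo t
    into m with ∈-map⁻ row m
    ... | b , mb , refl with row-at (slot? j b) (B⁻ {j} {b} (∈-elements⁻ (B j) mb))
    ...   | i , e , r = ∈-upTo⁺ (subst (_< t) (sym r) (m<n*o⇒m/o<n (<-≤-trans (F.toℕ<n (F.combine b i)) (≤-trans (≤-reflexive (*-comm k s)) sk≤))))

  covers : ∀ b → s ≤ ∣ tabulate (λ j → lookup (B j) b) ∣
  covers b = begin
    s ≡⟨ sym (Sub.∣⊤∣≡n s) ⟩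
    ∣ full ∣ ≤⟨ ∣∣-injection full (tabulate (λ j → lookup (B j) b)) set set-injective (λ {i} _ → hit i) ⟩
    ∣ tabulate (λ j → lookup (B j) b) ∣ ∎
    where
    open ≤-Reasoning
    full : Subset s
    full = everything
    set : Fin s → Fin c
    set i = fromℕ< (m%n<n (position b i) c)
    set-position : ∀ i → toℕ (set i) ≡ position b i % c
    set-position i = F.toℕ-fromℕ< (m%n<n (position b i) c)
    hit : ∀ i → tabulate (λ j → lookup (B j) b) ∋ set i
    hit i = trans (V.lookup∘tabulate (λ j → lookup (B j) b) (set i)) (B⁺ {set i} {b} i (sym (set-position i)))
    -- The s positions of b are consecutive and s ≤ c, so their residues are distinct.
    set-injective : ∀ {i i′} → set i ≡ set i′ → i ≡ i′
    set-injective {i} {i′} e = F.toℕ-injective (%-cancel c (s * toℕ b) (toℕ i) (toℕ i′)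
      (<-≤-trans (F.toℕ<n i) s≤c) (<-≤-trans (F.toℕ<n i′) s≤c)
      (trans (cong (_% c) (sym (F.toℕ-combine b i))) (trans (sym (set-position i)) (trans (cong toℕ e) (trans (set-position i′) (cong (_% c) (F.toℕ-combine b i′)))))))

-- From packings to frameproof families

preimage : ∀ {N k} → Vec (Fin N) k → Subset N → Subset k
preimage y e = tabulate (λ j → lookup e (lookup y j))

∋-preimage : ∀ {N k} (y : Vec (Fin N) k) (e : Subset N) j → lookup (preimage y e) j ≡ lookup e (lookup y j)
∋-preimage y e j = V.lookup∘tabulate _ j

edge-preimage : ∀ {N k} (y : Vec (Fin N) k) (e : Subset N) → (∀ {v} → e ∋ v → ∃ λ j → lookup y j ≡ v) → edge y (preimage y e) ≡ e
edge-preimage y e h = ⊆-full _ _ into (⊆⇒∣∣≤ e (edge y (preimage y e)) from)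
  where
  into : ∀ {v} → edge y (preimage y e) ∋ v → e ∋ v
  into m with ∋-edge⁻ y (preimage y e) m
  ... | j , mj , refl = trans (sym (∋-preimage y e j)) mj
  from : ∀ {v} → e ∋ v → edge y (preimage y e) ∋ v
  from m with h m
  ... | j , refl = ∋-edge⁺ y (preimage y e) (trans (∋-preimage y e j) m)

AllPairs-lookup : ∀ {A : Set} {R : A → A → Set} → (∀ {x y} → R x y → R y x) → ∀ {xs x y} → AllPairs R xs → x ∈ˡ xs → y ∈ˡ xs → x ≡ y ⊎ R x y
AllPairs-lookup s (rs ∷ ps) (here refl) (here refl) = inj₁ refl
AllPairs-lookup s (rs ∷ ps) (here refl) (there m) = inj₂ (All.lookup rs m)
AllPairs-lookup s (rs ∷ ps) (there m) (here refl) = inj₂ (s (All.lookup rs m))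
AllPairs-lookup s (rs ∷ ps) (there m) (there m′) = AllPairs-lookup s ps m m′

Separated-sym : ∀ {N k t 𝓑} {x y : Vec (Fin N) k} → Separated t 𝓑 x y → Separated t 𝓑 y x
Separated-sym sep T T′ s s′ e with sep T′ T s′ s (sym e)
... | o , o′ , far = o′ , o , λ i j p q r → far j i q p (sym r)

module Packing {N n k t : ℕ} (N≤n : N ≤ n) (𝓑 : List (Subset k)) (T₀ : Subset k) (∣T₀∣ : ∣ T₀ ∣ ≡ t) (T₀∉ : ¬ T₀ ∈ˡ 𝓑)
  (blocks : List (Vec (Fin N) k)) (injective : ∀ {x} → x ∈ˡ blocks → InjectiveBlock x) (separated : AllPairs (Separated t 𝓑) blocks) where

  embed : Fin N → Fin n
  embed v = F.inject≤ v N≤n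

  embed-injective : ∀ {v w} → embed v ≡ embed w → v ≡ w
  embed-injective = F.inject≤-injective N≤n N≤n _ _

  vertexSet : Vec (Fin N) k → Subset n
  vertexSet x = edge (V.map embed x) everything

  ∋-vertexSet⁺ : ∀ x i → vertexSet x ∋ embed (lookup x i)
  ∋-vertexSet⁺ x i = subst (vertexSet x ∋_) (V.lookup-map i embed x) (∋-edge⁺ (V.map embed x) everything (V.lookup-replicate i true))

  ∋-vertexSet⁻ : ∀ x {v} → vertexSet x ∋ embed v → ∃ λ i → lookup x i ≡ v
  ∋-vertexSet⁻ x m with ∋-edge⁻ (V.map embed x) everything m
  ... | i , _ , e = i , embed-injective (trans (sym (V.lookup-map i embed x)) e)

  ∣vertexSet∣ : ∀ {x} → x ∈ˡ blocks → ∣ vertexSet x ∣ ≡ k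
  ∣vertexSet∣ {x} m = trans (∣edge∣ {x = V.map embed x} (λ i j e → injective m i j (embed-injective
    (trans (sym (V.lookup-map i embed x)) (trans e (V.lookup-map j embed x))))) everything) (Sub.∣⊤∣≡n k)

  family : List (Subset n)
  family = map vertexSet blocks

  shared : ∀ {x y T} → x ∈ˡ blocks → y ∈ˡ blocks → (∀ {i} → T ∋ i → vertexSet y ∋ embed (lookup x i)) →
    ∃ λ T′ → ∣ T′ ∣ ≡ ∣ T ∣ × edge x T ≡ edge y T′
  shared {x} {y} {T} mx my h = T′ , size , sym e
    where
    T′ = preimage y (edge x T)
    e : edge y T′ ≡ edge x T
    e = edge-preimage y (edge x T) inside-y
      where
      inside-y : ∀ {v} → edge x T ∋ v → ∃ λ j → lookup y j ≡ v
      inside-y m with ∋-edge⁻ x T m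
      ... | i , mi , refl = ∋-vertexSet⁻ y (h mi)
    size : ∣ T′ ∣ ≡ ∣ T ∣
    size = trans (sym (∣edge∣ (injective my) T′)) (trans (cong ∣_∣ e) (∣edge∣ (injective mx) T))

  -- Two blocks on the same vertices would share the edge at `T₀`, which is own.
  vertexSet-injective : ∀ {x y} → x ∈ˡ blocks → y ∈ˡ blocks → vertexSet x ≡ vertexSet y → x ≡ y
  vertexSet-injective {x} {y} mx my e with AllPairs-lookup (λ {x} {y} → Separated-sym {x = x} {y}) separated mx my
  ... | inj₁ eq = eq
  ... | inj₂ sep with shared {T = T₀} mx my (λ {i} _ → subst (_∋ embed (lookup x i)) e (∋-vertexSet⁺ x i))
  ...   | T′ , sz , q = contradiction (proj₁ (sep T₀ T′ ∣T₀∣ (trans sz ∣T₀∣) q)) T₀∉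

  family-uniform : IsUniform n k family
  family-uniform = Unique-map-∈ vertexSet blocks vertexSet-injective unique , All.tabulate sizes
    where
    unique : Unique blocks
    unique = AllPairs.map (λ {x} sep e → T₀∉ (proj₁ (sep T₀ T₀ ∣T₀∣ ∣T₀∣ (cong (λ z → edge z T₀) e)))) separated
    sizes : ∀ {A} → A ∈ˡ family → ∣ A ∣ ≡ k
    sizes m with ∈-map⁻ vertexSet m
    ... | x , mx , refl = ∣vertexSet∣ mx

  family-frameproof : ∀ {c s lam q} → 1 ≤ lam → lam ≤ c → lam + q * c ≡ s * k → t ≡ suc q → s < c →
    DisjointFree lam (s + 1) (c ∸ s + 1) 𝓑 → Frameproof c s family
  family-frameproof {c} {s} 1≤λ λ≤c sk≡ t≡ s<c free A₀ A₀∈ As As∈ A₀≢ with ∈-map⁻ vertexSet A₀∈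
  ... | x , mx , refl with F.any? (λ b → count As (embed (lookup x b)) <? s)
  ...   | yes (b , lt) = embed (lookup x b) , V.lookup⇒[]= _ (vertexSet x) (∋-vertexSet⁺ x b) , lt
  ...   | no none = contradiction columns (Covering.no-cover 1≤λ λ≤c sk≡ t≡ s<c 𝓑 free B small full)
    where
    B : Fin c → Subset k
    B j = tabulate (λ b → lookup (As j) (embed (lookup x b)))
    lookup-B : ∀ j b → lookup (B j) b ≡ lookup (As j) (embed (lookup x b))
    lookup-B j b = V.lookup∘tabulate _ b
    columns : ∀ b → s ≤ ∣ tabulate (λ j → lookup (B j) b) ∣
    columns b = ≤-trans (≮⇒≥ (λ lt → none (b , lt))) (≤-reflexive (cong ∣_∣ (V.tabulate-cong (λ j → sym (lookup-B j b)))))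
    y : Fin c → Vec (Fin N) k
    y j = proj₁ (∈-map⁻ vertexSet (As∈ j))
    my : ∀ j → y j ∈ˡ blocks
    my j = proj₁ (proj₂ (∈-map⁻ vertexSet (As∈ j)))
    As≡ : ∀ j → As j ≡ vertexSet (y j)
    As≡ j = proj₂ (proj₂ (∈-map⁻ vertexSet (As∈ j)))
    sep : ∀ j → Separated t 𝓑 x (y j)
    sep j with AllPairs-lookup (λ {x} {y} → Separated-sym {x = x} {y}) separated mx (my j)
    ... | inj₁ e = contradiction (trans (cong vertexSet e) (sym (As≡ j))) (A₀≢ j)
    ... | inj₂ p = p
    inside-y : ∀ {j b} → B j ∋ b → vertexSet (y j) ∋ embed (lookup x b)
    inside-y {j} {b} m = subst (_∋ embed (lookup x b)) (As≡ j) (trans (sym (lookup-B j b)) m)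
    full : ∀ j → ∣ B j ∣ ≡ t → B j ∈ˡ 𝓑
    full j sz with shared {T = B j} mx (my j) (inside-y {j})
    ... | T′ , sz′ , e = proj₁ (sep j (B j) T′ sz (trans sz′ sz) e)
    -- A trace with more than t points contains a t-set T, which is then a common edge, and a point
    -- outside T, which is a further common vertex; `Separated` excludes it.
    small : ∀ j → ∣ B j ∣ ≤ t
    small j with ∣ B j ∣ ≤? t
    ... | yes le = le
    ... | no nle with shrink t (B j) (<⇒≤ (≰⇒> nle))
    ...   | T , ∣T∣ , T⊆B with F.any? (λ i → (lookup (B j) i Bool.≟ true) ×-dec (lookup T i Bool.≟ false))
    ...     | no np = contradiction (≤-trans (⊆⇒∣∣≤ (B j) T (λ {i} m → covered-by i m)) (≤-reflexive ∣T∣)) nle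
      where
      covered-by : ∀ i → B j ∋ i → T ∋ i
      covered-by i m with bool-split (lookup T i)
      ... | inj₁ p = p
      ... | inj₂ p = contradiction (i , m , p) np
    ...     | yes (i , m , out) with shared {T = T} mx (my j) (λ {i} p → inside-y {j} {i} (T⊆B p)) | ∋-vertexSet⁻ (y j) (inside-y {j} m)
    ...       | T′ , sz′ , e | l , yl = contradiction (sym yl) (proj₂ (proj₂ (sep j T T′ ∣T∣ (trans sz′ ∣T∣) e)) i l out outside-T′)
      where
      outside-T′ : lookup T′ l ≡ false
      outside-T′ with bool-split (lookup T′ l)
      ... | inj₂ p = p
      ... | inj₁ p with ∋-edge⁻ x T (subst (_∋ lookup (y j) l) (sym e) (∋-edge⁺ (y j) T′ p))
      ...   | i′ , mi′ , q = contradiction (subst (T ∋_) (injective mx i′ i (trans q yl)) mi′) (λ r → true≢false r out)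

-- The random process

⟦⟧≡ι : ∀ b → ⟦ b ⟧ ≡ ι (bit b)
⟦⟧≡ι true = sym ι1
⟦⟧≡ι false = sym ι0

module Process {k G N : ℕ} (codeField : CodeField k G N) (t : ℕ) (G≤N : G ≤ N) (v₀ : Fin N) (𝓑 : List (Subset k)) (d : ℕ) where
  open Collisions codeField t G≤N
  open Roles {N} {k} t v₀
  open Own t 𝓑
  open Rates t 𝓑 d

  Block : Set
  Block = Vec V k

  ∈-ownRoles⁻ : ∀ {a} → a ∈ˡ ownRoles → IsRole a × ¬ supp a ∈ˡ 𝓑
  ∈-ownRoles⁻ {a} m with ∈-filter⁻ ownRole? {xs = roles k t} m
  ... | m′ , sz , inj , o = record { bounded = ∈roles⇒bounded m′ ; size = sz ; injective = inj } , o

  ∈-ownRoles⁺ : ∀ {a} → IsRole a → ¬ supp a ∈ˡ 𝓑 → a ∈ˡ ownRoles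
  ∈-ownRoles⁺ isRole o = ∈-filter⁺ ownRole? (IsRole⇒∈roles isRole) (IsRole.size isRole , IsRole.injective isRole , o)

  role : Block → Subset k → Role k
  role x T = roleOf (restrict x T) (edge x T)

  role-∈ownRoles : ∀ {x T} → InjectiveBlock x → ∣ T ∣ ≡ t → ¬ T ∈ˡ 𝓑 → role x T ∈ˡ ownRoles
  role-∈ownRoles {x} {T} inj sz o = ∈-ownRoles⁺
    (isRole-roleOf (restrict x T) (restrict-injective x inj T) (trans (cong ∣_∣ (supp-restrict x T)) sz))
    (o ∘ subst (_∈ˡ 𝓑) (trans (supp-roleOf (restrict x T) (edge x T)) (supp-restrict x T)))

  restrict-complete : ∀ θ P → restrict (complete θ P) (supp P) ≡ P
  restrict-complete θ P = vec-ext λ i → at i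
    where
    at : ∀ i → lookup (restrict (complete θ P) (supp P)) i ≡ lookup P i
    at i with lookup P i in eq
    ... | just v = trans (lookup-restrict⁺ (complete θ P) (supp P) (supp-true {P} eq)) (cong just (complete-extends θ P eq))
    ... | nothing = lookup-restrict⁻ (complete θ P) (supp P) (trans (V.lookup-map i Maybe.is-just P) (cong Maybe.is-just eq))

  module _ {a : Role k} (isRole : IsRole a) {e : Edge} (∣e∣ : ∣ e ∣ ≡ t) (θ : Twists) where
    private x = complete θ (place a e)

    restrict-joined : restrict x (supp a) ≡ place a e
    restrict-joined = trans (cong (restrict x) (sym (supp-place a e))) (restrict-complete θ (place a e))

    edge-joined : edge x (supp a) ≡ e
    edge-joined = trans (cong vertices restrict-joined) (vertices-place isRole ∣e∣)

    role-joined : role x (supp a) ≡ a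
    role-joined = trans (cong₂ (λ P e → roleOf P e) restrict-joined edge-joined) (roleOf-place isRole {e} ∣e∣)

  -- The reserved edges are set aside for the t-subsets in 𝓑 and are never covered.
  record State : Set where
    field
      available : Edge → Bool
      reserved : Edge → Bool
      blocks : List Block
  open State public

  -- Ensures that x meets the blocks of the earlier rounds θs in at most t vertices.
  Compatible : ∀ {r} → Vec Twists r → Block → Set
  Compatible θs x = VAll.All (λ θ → All (λ I → ¬ value θ I ∈ˡ toList x) (items (toList x))) θs

  Chosen : Twists → (Edge → Role k) → Block → Subset k → Set
  Chosen θ c x T = complete θ (restrict x T) ≡ x × c (edge x T) ≡ role x T

  -- Agreement is required of the edges in 𝓑 as well: otherwise two blocks of one round could share
  -- a reserved edge and further vertices.
  Selected : ∀ {r} → Twists → Vec Twists r → State → (Edge → Role k) → Block → Set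
  Selected θ θs st c x = InjectiveBlock x × Compatible θs x × All (Chosen θ c x) (subsets k t)
    × All (λ T → available st (edge x T) ≡ true) own × All (λ T → reserved st (edge x T) ≡ true) non

  opaque
    selected? : ∀ {r} θ (θs : Vec Twists r) st c x → Dec (Selected θ θs st c x)
    selected? θ θs st c x =
      (F.all? λ i → F.all? λ j → (lookup x i F.≟ lookup x j) →-dec (i F.≟ j))
      ×-dec VAll.all? (λ θ′ → All.all? (λ I → ¬? (value θ′ I ∈ˡ? toList x)) (items (toList x))) θs
      ×-dec All.all? (λ T → V.≡-dec F._≟_ (complete θ (restrict x T)) x ×-dec (c (edge x T) ≟R role x T)) (subsets k t)
      ×-dec All.all? (λ T → available st (edge x T) Bool.≟ true) own
      ×-dec All.all? (λ T → reserved st (edge x T) Bool.≟ true) non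

  Covered : ∀ {r} → Twists → Vec Twists r → State → (Edge → Role k) → Edge → Set
  Covered θ θs st c e = Any (λ a → Selected θ θs st c (complete θ (place a e))) ownRoles

  opaque
    covered? : ∀ {r} θ (θs : Vec Twists r) st c e → Dec (Covered θ θs st c e)
    covered? θ θs st c e = Any.any? (λ a → selected? θ θs st c (complete θ (place a e))) ownRoles

  allBlocks : List Block
  allBlocks = vectors (allFin N) k

  step : ∀ {r} → Twists → Vec Twists r → State → (Edge → Role k) → State
  step θ θs st c = record
    { available = λ e → available st e ∧ not ⌊ covered? θ θs st c e ⌋
    ; reserved = reserved st
    ; blocks = filter (selected? θ θs st c) allBlocks ++ blocks st }

  initial : (Edge → Bool) → State
  initial R = record { available = not ∘ R ; reserved = R ; blocks = [] }

  Coded : Twists → Block → Set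
  Coded θ x = ∀ T → ∣ T ∣ ≡ t → complete θ (restrict x T) ≡ x

  -- `coded` remembers that an old block belongs to the code of some earlier round; through it the
  -- condition `Compatible` on a new block says something about the old one.
  record Invariant {r} (θs : Vec Twists r) (st : State) : Set where
    field
      exclusive : ∀ {e} → available st e ≡ true → reserved st e ≡ false
      injective : ∀ {x} → x ∈ˡ blocks st → InjectiveBlock x
      coded : ∀ {x} → x ∈ˡ blocks st → VAny.Any (λ θ → Coded θ x) θs
      own-used : ∀ {x T} → x ∈ˡ blocks st → ∣ T ∣ ≡ t → ¬ T ∈ˡ 𝓑 → available st (edge x T) ≡ false × reserved st (edge x T) ≡ false
      non-reserved : ∀ {x T} → x ∈ˡ blocks st → ∣ T ∣ ≡ t → T ∈ˡ 𝓑 → reserved st (edge x T) ≡ true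
      separated : AllPairs (Separated t 𝓑) (blocks st)
      covers : ∀ {e} → ∣ e ∣ ≡ t → available st e ≡ false → reserved st e ≡ false → ∃ λ x → x ∈ˡ blocks st × ∃ λ T → T ∈ˡ own × e ≡ edge x T

  initial-invariant : ∀ R → Invariant [] (initial R)
  initial-invariant R = record
    { exclusive = λ {e} eq → trans (sym (Bool.not-involutive (R e))) (cong not eq)
    ; injective = λ () ; coded = λ () ; own-used = λ () ; non-reserved = λ () ; separated = []
    ; covers = λ {e} _ f r → contradiction (trans (sym f) (cong not r)) λ () }

  module _ {r} {θ : Twists} {θs : Vec Twists r} {st : State} {c : Edge → Role k} where
    module _ {x} (sel : Selected θ θs st c x) where
      selected-chosen : ∀ T → ∣ T ∣ ≡ t → Chosen θ c x T
      selected-chosen _ sz = All.lookup (proj₁ (proj₂ (proj₂ sel))) (∈-subsets⁺ _ sz)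

      selected-own : ∀ T → ∣ T ∣ ≡ t → ¬ T ∈ˡ 𝓑 → available st (edge x T) ≡ true
      selected-own _ sz o = All.lookup (proj₁ (proj₂ (proj₂ (proj₂ sel)))) (∈-filter⁺ own? (∈-subsets⁺ _ sz) o)

      selected-non : ∀ T → ∣ T ∣ ≡ t → T ∈ˡ 𝓑 → reserved st (edge x T) ≡ true
      selected-non _ sz o = All.lookup (proj₂ (proj₂ (proj₂ (proj₂ sel)))) (∈-filter⁺ (_∈𝓑? 𝓑) (∈-subsets⁺ _ sz) o)

      selected-covers : ∀ T → ∣ T ∣ ≡ t → ¬ T ∈ˡ 𝓑 → Covered θ θs st c (edge x T)
      selected-covers T sz o = Any.map (λ { refl → subst (Selected θ θs st c) (sym eq) sel }) (role-∈ownRoles {x} (proj₁ sel) sz o)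
        where
        eq : complete θ (place (role x T) (edge x T)) ≡ x
        eq = trans (cong (complete θ) (place-roleOf (restrict x T) refl)) (proj₁ (selected-chosen T sz))

    -- The colour of the shared t-set determines its block.
    selected-agree : ∀ {x y} T T′ → Selected θ θs st c x → Selected θ θs st c y → ∣ T ∣ ≡ t → ∣ T′ ∣ ≡ t → edge x T ≡ edge y T′ → x ≡ y
    selected-agree {x} {y} T T′ sx sy sz sz′ e = begin
      x ≡⟨ sym (proj₁ (selected-chosen sx T sz)) ⟩
      complete θ (restrict x T) ≡⟨ cong (complete θ) (sym (place-roleOf (restrict x T) refl)) ⟩
      complete θ (place (role x T) (edge x T)) ≡⟨ cong (complete θ) (cong₂ place (trans (sym (proj₂ (selected-chosen sx T sz))) (trans (cong c e) (proj₂ (selected-chosen sy T′ sz′)))) e) ⟩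
      complete θ (place (role y T′) (edge y T′)) ≡⟨ cong (complete θ) (place-roleOf (restrict y T′) refl) ⟩
      complete θ (restrict y T′) ≡⟨ proj₁ (selected-chosen sy T′ sz′) ⟩
      y ∎
      where open ≡-Reasoning

    module _ (inv : Invariant θs st) where
      open Invariant inv
      private
        st′ = step θ θs st c
        new = filter (selected? θ θs st c) allBlocks

        new⁻ : ∀ {x} → x ∈ˡ new → Selected θ θs st c x
        new⁻ m = proj₂ (∈-filter⁻ (selected? θ θs st c) {xs = allBlocks} m)

        by-age : ∀ {x} {Q : Set} → x ∈ˡ blocks st′ → (Selected θ θs st c x → Q) → (x ∈ˡ blocks st → Q) → Q
        by-age m f g with ∈-++⁻ new m
        ... | inj₁ p = f (new⁻ p)
        ... | inj₂ q = g q

        still-used : ∀ {e} → available st e ≡ false → available st′ e ≡ false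
        still-used {e} eq = cong (_∧ not ⌊ covered? θ θs st c e ⌋) eq

        compatible : ∀ {x y} → Selected θ θs st c x → y ∈ˡ blocks st → Separated t 𝓑 x y
        compatible {x} {y} sel m T T′ sz sz′ e with T ∈𝓑? 𝓑 | T′ ∈𝓑? 𝓑
        ... | no o | yes o′ = contradiction (trans (cong (reserved st) e) (non-reserved m sz′ o′)) (λ q → true≢false q (exclusive (selected-own sel T sz o)))
        ... | no o | no o′ = contradiction (trans (sym (cong (available st) e)) (selected-own sel T sz o)) (λ q → true≢false q (proj₁ (own-used m sz′ o′)))
        ... | yes o | no o′ = contradiction (trans (sym (cong (reserved st) e)) (selected-non sel T sz o)) (λ q → true≢false q (proj₂ (own-used m sz′ o′)))
        ... | yes o | yes o′ = o , o′ , λ i j _ out eq → disagree (coded m) (proj₁ (proj₂ sel)) i j out eq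
          where
          -- A vertex of y outside the shared t-set is, in the code of y, the value of an item whose
          -- vertices lie in x. `Compatible` keeps such values out of x.
          disagree : ∀ {r} {θs : Vec Twists r} → VAny.Any (λ θ → Coded θ y) θs → Compatible θs x →
            ∀ i j → lookup T′ j ≡ false → lookup x i ≢ lookup y j
          disagree (VAny.there p) (_ VAll.∷ q) i j out eq = disagree p q i j out eq
          disagree (VAny.here {x = θ′} cy) (q VAll.∷ _) i j out eq = All.lookup q (∈-items⁺ item)
            (subst (_∈ˡ toList x) (trans eq (cong (λ z → lookup z j) (sym (cy T′ sz′)))) (∈-toList⁺ x i))
            where
            item : IsItem (toList x) (restrict y T′) j
            item = record
              { size = trans (cong ∣_∣ (supp-restrict y T′)) sz′
              ; within = λ {l} {v} el → inside-x (subst (_∋ v) (sym e) (∋-vertices⁺ (restrict y T′) el))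
              ; free = lookup-restrict⁻ y T′ out }
              where
              inside-x : ∀ {v} → edge x T ∋ v → v ∈ˡ toList x
              inside-x mv with ∋-edge⁻ x T mv
              ... | l , _ , refl = ∈-toList⁺ x l

      step-invariant : Invariant (θ ∷ θs) st′
      step-invariant = record
        { exclusive = λ {e} eq → exclusive (Bool.∧-conicalˡ (available st e) _ eq)
        ; injective = λ m → by-age m (λ s → proj₁ s) injective
        ; coded = λ m → by-age m (λ s → VAny.here (λ T sz → proj₁ (selected-chosen s T sz))) (λ m′ → VAny.there (coded m′))
        ; own-used = λ {x} {T} m sz o → by-age m
            (λ s → trans (cong (λ b → available st (edge x T) ∧ not b) (⌊⌋-true (covered? θ θs st c (edge x T)) (selected-covers s T sz o))) (Bool.∧-zeroʳ _)
                 , exclusive (selected-own s T sz o))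
            (λ m′ → still-used (proj₁ (own-used m′ sz o)) , proj₂ (own-used m′ sz o))
        ; non-reserved = λ {x} {T} m sz o → by-age m (λ s → selected-non s T sz o) (λ m′ → non-reserved m′ sz o)
        ; separated = AllPairs-++
            (AllPairs-∈ (Un.filter⁺ (selected? θ θs st c) (Unique-vectors k (Un.allFin⁺ N)))
              (λ m m′ ne T T′ sz sz′ e → contradiction (selected-agree T T′ (new⁻ m) (new⁻ m′) sz sz′ e) ne))
            separated (λ m m′ → compatible (new⁻ m) m′)
        ; covers = cover }
        where
        cover : ∀ {e} → ∣ e ∣ ≡ t → available st′ e ≡ false → reserved st e ≡ false → ∃ λ x → x ∈ˡ blocks st′ × ∃ λ T → T ∈ˡ own × e ≡ edge x T
        cover {e} sz f r with bool-split (available st e)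
        ... | inj₂ f′ with covers sz f′ r
        ...   | x , m , T , mT , eq = x , ∈-++⁺ʳ new m , T , mT , eq
        cover {e} sz f r | inj₁ f′ with covered? θ θs st c e
        ... | no _ = contradiction (trans (sym f) (cong (_∧ true) f′)) λ ()
        ... | yes p with find p
        ...   | a , ma , sel = x , ∈-++⁺ˡ (∈-filter⁺ (selected? θ θs st c) (∈-vectors⁺ x (λ i → ∈-allFin _)) sel)
            , supp a , ∈-filter⁺ own? (∈-subsets⁺ _ (IsRole.size isRole)) (proj₂ (∈-ownRoles⁻ ma)) , sym (edge-joined isRole sz θ)
          where
          x = complete θ (place a e)
          isRole = proj₁ (∈-ownRoles⁻ ma)

  -- Exploring the history of an edge

  edges : List Edge
  edges = subsets N t

  module Reserve = Colourings {Edge} {ℕ} (V.≡-dec Bool._≟_) _≟_ (upTo (suc d)) (Un.upTo⁺ (suc d)) 0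
  module Colour = Colourings {Edge} {Role k} (V.≡-dec Bool._≟_) _≟R_ (roles k t) (Unique-roles k t) (V.replicate k nothing)

  0∈ : 0 ∈ˡ upTo (suc d)
  0∈ = ∈-upTo⁺ (s≤s z≤n)

  blank∈ : V.replicate k nothing ∈ˡ roles k t
  blank∈ = ∈-vectors⁺ (V.replicate k nothing) (λ i → subst (_∈ˡ nothing ∷ map just (upTo t)) (sym (V.lookup-replicate i nothing)) (here refl))

  -- An edge is reserved if its initial colour, one of d + 1, is 0. Every round draws fresh colours,
  -- independent of the state before it, while the codes are fixed throughout.
  𝔼 : ∀ {r} → Vec Twists r → (State → ℚ) → ℚ
  𝔼 [] f = mean (Reserve.colourings edges) (λ c → f (initial (λ e → ⌊ c e ≟ 0 ⌋)))
  𝔼 (θ ∷ θs) f = 𝔼 θs (λ st → mean (Colour.colourings edges) (λ c → f (step θ θs st c)))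

  linear-𝔼 : ∀ {r} (θs : Vec Twists r) → Linear (𝔼 θs)
  linear-𝔼 [] = record
    { ext = λ h → Linear.ext l (λ c → h _)
    ; add = λ f g → Linear.add l _ _
    ; scale = λ r f → Linear.scale l r _ }
    where l = mean-linear (Reserve.colourings edges)
  linear-𝔼 (θ ∷ θs) = record
    { ext = λ h → Linear.ext (linear-𝔼 θs) (λ st → Linear.ext l (λ c → h _))
    ; add = λ f g → trans (Linear.ext (linear-𝔼 θs) (λ st → Linear.add l _ _)) (Linear.add (linear-𝔼 θs) _ _)
    ; scale = λ r f → trans (Linear.ext (linear-𝔼 θs) (λ st → Linear.scale l r _)) (Linear.scale (linear-𝔼 θs) r _) }
    where l = mean-linear (Colour.colourings edges)

  mean-≤-colouring : ∀ {C : Set} (xs : List C) → (∃ λ c → ∃ λ cs → xs ≡ c ∷ cs) → (f : C → ℚ) → ∀ y → mean xs f Q.≤ y → ∃ λ c → f c Q.≤ y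
  mean-≤-colouring .(c ∷ cs) (c , cs , refl) f y h with mean-≤-witness c cs f y h
  ... | c′ , _ , le = c′ , le

  𝔼-≤-witness : ∀ {r} (θs : Vec Twists r) f y → 𝔼 θs f Q.≤ y → ∃ λ st → Invariant θs st × f st Q.≤ y
  𝔼-≤-witness [] f y h with mean-≤-colouring _ (Reserve.nonempty-colourings edges 0 0∈ edges) _ y h
  ... | c , le = initial (λ e → ⌊ c e ≟ 0 ⌋) , initial-invariant (λ e → ⌊ c e ≟ 0 ⌋) , le
  𝔼-≤-witness (θ ∷ θs) f y h with 𝔼-≤-witness θs _ y h
  ... | st , inv , le with mean-≤-colouring _ (Colour.nonempty-colourings edges _ blank∈ edges) _ y le
  ...   | c , le′ = step θ θs st c , step-invariant inv , le′

  join : Twists → Role k → Edge → Block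
  join θ a e = complete θ (place a e)

  -- Three of the conditions depend on the codes alone and are assumed. What remains is a
  -- conjunction over edges, whose indicator is a product.
  selected-⟦⟧ : ∀ {r} θ (θs : Vec Twists r) st c x → InjectiveBlock x → Compatible θs x → Coded θ x →
    ⟦ ⌊ selected? θ θs st c x ⌋ ⟧ ≡
      ∏ (subsets k t) (λ T → Colour.hit (edge x T) (role x T) c)
      Q.* (∏ own (λ T → ⟦ available st (edge x T) ⟧) Q.* ∏ non (λ T → ⟦ reserved st (edge x T) ⟧))
  selected-⟦⟧ θ θs st c x inj comp code
    with ∏-one-or-zero (subsets k t) (λ T → ⌊ c (edge x T) ≟R role x T ⌋)
       | ∏-one-or-zero own (λ T → available st (edge x T))
       | ∏-one-or-zero non (λ T → reserved st (edge x T))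
  ... | inj₂ z | _ | _ = trans (⟦⟧-no (selected? θ θs st c x) (λ s → impossible s)) (sym (trans (cong (Q._* on) z) (Q.*-zeroˡ on)))
    where
    on = ∏ own (λ T → ⟦ available st (edge x T) ⟧) Q.* ∏ non (λ T → ⟦ reserved st (edge x T) ⟧)
    impossible : Selected θ θs st c x → _
    impossible (_ , _ , ch , _) = contradiction (trans (sym (∏-one (All.map (λ {T} (_ , e) → ⌊⌋-true (c (edge x T) ≟R role x T) e) ch))) z) λ ()
  ... | inj₁ _ | inj₂ z | _ = trans (⟦⟧-no (selected? θ θs st c x) (λ (_ , _ , _ , fr , _) → contradiction (trans (sym (∏-one fr)) z) λ ()))
        (sym (trans (cong (∏ (subsets k t) (λ T → Colour.hit (edge x T) (role x T) c) Q.*_) (trans (cong (Q._* ∏ non (λ T → ⟦ reserved st (edge x T) ⟧)) z) (Q.*-zeroˡ (∏ non (λ T → ⟦ reserved st (edge x T) ⟧)))))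
          (Q.*-zeroʳ (∏ (subsets k t) (λ T → Colour.hit (edge x T) (role x T) c)))))
  ... | inj₁ _ | inj₁ _ | inj₂ z = trans (⟦⟧-no (selected? θ θs st c x) (λ (_ , _ , _ , _ , re) → contradiction (trans (sym (∏-one re)) z) λ ()))
        (sym (trans (cong (∏ (subsets k t) (λ T → Colour.hit (edge x T) (role x T) c) Q.*_) (trans (cong (∏ own (λ T → ⟦ available st (edge x T) ⟧) Q.*_) z) (Q.*-zeroʳ (∏ own (λ T → ⟦ available st (edge x T) ⟧)))))
          (Q.*-zeroʳ (∏ (subsets k t) (λ T → Colour.hit (edge x T) (role x T) c)))))
  ... | inj₁ h | inj₁ fr | inj₁ re = trans
        (⟦⟧-yes (selected? θ θs st c x) (inj , comp
          , All.tabulate (λ {T} m → code T (∈-subsets⁻ k t m) , ⌊⌋-true⁻ (c (edge x T) ≟R role x T) (All.lookup h m)) , fr , re))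
        (sym (trans (cong₂ Q._*_ (∏-one h) (cong₂ Q._*_ (∏-one fr) (∏-one re))) refl))

  -- If the block of a role is selected, the colour of e is that role, so at most one term of the
  -- sum is 1. In that case e was available, being an own edge of the block. Hence the formula is
  -- exact and linear in the indicators.
  free-step : ∀ {r} θ (θs : Vec Twists r) st c {e} → ∣ e ∣ ≡ t →
    ⟦ available (step θ θs st c) e ⟧ ≡ ⟦ available st e ⟧ Q.- ∑ᵠ ownRoles (λ a → ⟦ ⌊ selected? θ θs st c (join θ a e) ⌋ ⟧)
  free-step θ θs st c {e} sz with covered? θ θs st c e
  ... | no nc = trans (cong ⟦_⟧ (Bool.∧-identityʳ (available st e))) (sym (trans (cong (λ s → ⟦ available st e ⟧ Q.- s)
          (trans (∑ℚ.∑-cong-∈ ownRoles (λ {a} m → ⟦⟧-no (selected? θ θs st c (join θ a e)) (λ s → nc (Any.map (λ { refl → s }) m)))) (∑ℚ.∑-zero ownRoles)))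
          (Q.+-identityʳ ⟦ available st e ⟧)))
  ... | yes cov with find cov
  ...   | a , m , sel = trans (cong ⟦_⟧ (Bool.∧-zeroʳ (available st e))) (sym (trans (cong₂ (λ p s → p Q.- s) (cong ⟦_⟧ free-e) sum-one) refl))
    where
    isRole = λ {a} (m : a ∈ˡ ownRoles) → proj₁ (∈-ownRoles⁻ m)
    colour : ∀ {a} → a ∈ˡ ownRoles → Selected θ θs st c (join θ a e) → c e ≡ a
    colour {a} m s = trans (cong c (sym (edge-joined (isRole m) sz θ)))
      (trans (proj₂ (selected-chosen {θ = θ} {θs} {st} {c} s (supp a) (IsRole.size (isRole m)))) (role-joined (isRole m) sz θ))
    free-e : available st e ≡ true
    free-e = trans (cong (available st) (sym (edge-joined (isRole m) sz θ)))
      (selected-own {θ = θ} {θs} {st} {c} sel (supp a) (IsRole.size (isRole m)) (proj₂ (∈-ownRoles⁻ m)))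
    sum-one : ∑ᵠ ownRoles (λ a → ⟦ ⌊ selected? θ θs st c (join θ a e) ⌋ ⟧) ≡ 1ℚ
    sum-one = ∑ᵠ-one (Un.filter⁺ ownRole? (Unique-roles k t)) m _ (⟦⟧-yes (selected? θ θs st c (join θ a e)) sel)
      (λ {a′} m′ ne → ⟦⟧-no (selected? θ θs st c (join θ a′ e)) (λ s → ne (trans (sym (colour m′ s)) (colour m sel))))

  -- The edges on whose colour or state the survival of e in this round can depend: e and the
  -- t-subsets of the blocks proposed by its own roles.
  data Potential (θ : Twists) (e : Edge) : Edge → Set where
    itself : Potential θ e e
    joined : ∀ {a T} → a ∈ˡ ownRoles → ∣ T ∣ ≡ t → Potential θ e (edge (join θ a e) T)

  module Round {r} (θ : Twists) (θs : Vec Twists r) where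
    monomial : List Edge → List Edge → List Edge → List (Edge × Role k) → State → (Edge → Role k) → ℚ
    monomial E₁ E₂ F D st c =
      ∏ E₁ (λ e → ⟦ available (step θ θs st c) e ⟧) Q.* (∏ E₂ (λ e → ⟦ available st e ⟧) Q.*
        (∏ F (λ e → ⟦ reserved st e ⟧) Q.* ∏ D (λ (e , a) → Colour.hit e a c)))

    Explored : Edge → Set
    Explored e = ∣ e ∣ ≡ t × (∀ {a} → a ∈ˡ ownRoles → InjectiveBlock (join θ a e) × Compatible θs (join θ a e))

    hits : Block → List (Edge × Role k)
    hits x = map (λ T → edge x T , role x T) (subsets k t)

    joined-monomial : List Edge → List Edge → List Edge → List (Edge × Role k) → Block → State → (Edge → Role k) → ℚ
    joined-monomial E₁ E₂ F D x = monomial E₁ (map (edge x) own ++ E₂) (map (edge x) non ++ F) (hits x ++ D)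

    -- The subtracted terms carry no separate factor for e, since e is itself an own edge of the
    -- joined block, at the positions `supp a`.
    monomial-expand : ∀ {e} → Explored e → ∀ E₁ E₂ F D st c →
      monomial (e ∷ E₁) E₂ F D st c ≡ monomial E₁ (e ∷ E₂) F D st c Q.- ∑ᵠ ownRoles (λ a → joined-monomial E₁ E₂ F D (join θ a e) st c)
    monomial-expand {e} (sz , ex) E₁ E₂ F D st c = begin
      (⟦ available (step θ θs st c) e ⟧ Q.* A) Q.* Y
        ≡⟨ cong (λ p → (p Q.* A) Q.* Y) (free-step θ θs st c sz) ⟩
      ((p Q.- S) Q.* A) Q.* (B Q.* (Z Q.* H))
        ≡⟨ QSolver.solve 6 (λ p s a b c h → ((p :+ s) :* a) :* (b :* (c :* h)) := a :* ((p :* b) :* (c :* h)) :+ s :* (a :* (b :* (c :* h)))) refl p (Q.- S) A B Z H ⟩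
      A Q.* ((p Q.* B) Q.* (Z Q.* H)) Q.+ (Q.- S) Q.* (A Q.* Y)
        ≡⟨ cong (λ z → A Q.* ((p Q.* B) Q.* (Z Q.* H)) Q.+ z) (trans (sym (Q.neg-distribˡ-* S (A Q.* Y))) (cong Q.-_ sum)) ⟩
      monomial E₁ (e ∷ E₂) F D st c Q.- ∑ᵠ ownRoles (λ a → joined-monomial E₁ E₂ F D (join θ a e) st c) ∎
      where
      open ≡-Reasoning
      open QSolver using (_:+_; _:*_; _:=_)
      A = ∏ E₁ (λ e → ⟦ available (step θ θs st c) e ⟧)
      B = ∏ E₂ (λ e → ⟦ available st e ⟧)
      Z = ∏ F (λ e → ⟦ reserved st e ⟧)
      H = ∏ D (λ (e , a) → Colour.hit e a c)
      Y = B Q.* (Z Q.* H)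
      p = ⟦ available st e ⟧
      s = λ a → ⟦ ⌊ selected? θ θs st c (join θ a e) ⌋ ⟧
      S = ∑ᵠ ownRoles s
      product : ∀ {X X′ : Set} (g : X → X′) (f : X′ → ℚ) (xs : List X) (ys : List X′) → ∏ (map g xs ++ ys) f ≡ ∏ xs (f ∘ g) Q.* ∏ ys f
      product g f xs ys = trans (∏ℚ.∑-++ (map g xs) ys f) (cong (Q._* ∏ ys f) (∏ℚ.∑-map g xs f))
      sum : S Q.* (A Q.* Y) ≡ ∑ᵠ ownRoles (λ a → joined-monomial E₁ E₂ F D (join θ a e) st c)
      sum = trans (Q.*-comm S (A Q.* Y)) (trans (*-∑ᵠ (A Q.* Y) ownRoles s) (∑ℚ.∑-cong-∈ ownRoles term))
        where
        term : ∀ {a} → a ∈ˡ ownRoles → (A Q.* Y) Q.* s a ≡ joined-monomial E₁ E₂ F D (join θ a e) st c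
        term {a} m = begin
          (A Q.* Y) Q.* s a
            ≡⟨ cong ((A Q.* Y) Q.*_) (selected-⟦⟧ θ θs st c x (proj₁ (ex m)) (proj₂ (ex m))
                 (λ T szT → complete-restrict θ (place a e) T (trans (cong ∣_∣ (supp-place a e)) (trans (IsRole.size (proj₁ (∈-ownRoles⁻ m))) (sym szT))))) ⟩
          (A Q.* (B Q.* (Z Q.* H))) Q.* (h Q.* (o Q.* n))
            ≡⟨ QSolver.solve 7 (λ a b c d h o n → (a :* (b :* (c :* d))) :* (h :* (o :* n)) := a :* ((o :* b) :* ((n :* c) :* (h :* d)))) refl A B Z H h o n ⟩
          A Q.* ((o Q.* B) Q.* ((n Q.* Z) Q.* (h Q.* H)))
            ≡⟨ sym (cong (A Q.*_) (cong₂ Q._*_ (product (edge x) _ own E₂) (cong₂ Q._*_ (product (edge x) _ non F) (product (λ T → edge x T , role x T) _ (subsets k t) D)))) ⟩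
          joined-monomial E₁ E₂ F D x st c ∎
          where
          x = join θ a e
          h = ∏ (subsets k t) (λ T → Colour.hit (edge x T) (role x T) c)
          o = ∏ own (λ T → ⟦ available st (edge x T) ⟧)
          n = ∏ non (λ T → ⟦ reserved st (edge x T) ⟧)

    𝔼′ : (State → (Edge → Role k) → ℚ) → ℚ
    𝔼′ f = 𝔼 θs (λ st → mean (Colour.colourings edges) (f st))

    linear-𝔼′ : Linear {State × (Edge → Role k)} (λ f → 𝔼′ (λ st c → f (st , c)))
    linear-𝔼′ = record
      { ext = λ h → Linear.ext (linear-𝔼 θs) (λ st → Linear.ext l (λ c → h (st , c)))
      ; add = λ f g → trans (Linear.ext (linear-𝔼 θs) (λ st → Linear.add l _ _)) (Linear.add (linear-𝔼 θs) _ _)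
      ; scale = λ r f → trans (Linear.ext (linear-𝔼 θs) (λ st → Linear.scale l r _)) (Linear.scale (linear-𝔼 θs) r _) }
      where l = mean-linear (Colour.colourings edges)

    -- The edges E₁ are still to be explored in this round; E₂, F and D collect the conditions found so far.
    module Exploration (P : Edge → Set) (P-size : ∀ {e} → P e → ∣ e ∣ ≡ t)
      -- The induction hypothesis for the earlier rounds, available for edges with property P.
      (before : ∀ E F → Unique E → Unique F → (∀ {e} → e ∈ˡ E → ¬ e ∈ˡ F) → All P E → All P F →
        𝔼 θs (λ st → ∏ E (λ e → ⟦ available st e ⟧) Q.* ∏ F (λ e → ⟦ reserved st e ⟧)) ≡ u r ^ᵠ length E Q.* δ ^ᵠ length F) where

      Avoids : List Edge → List Edge → Set
      Avoids E₁ X = ∀ {e f} → e ∈ˡ E₁ → f ∈ˡ X → ¬ Potential θ e f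

      -- Potentials of different unexplored edges are disjoint and avoid all that has been
      -- collected. Hence every edge met later is new, and no condition is ever imposed twice on the
      -- same edge.
      record Frontier (E₁ E₂ F : List Edge) (D : List (Edge × Role k)) : Set where
        field
          explored : All Explored E₁
          potentials : ∀ {e f} → e ∈ˡ E₁ → Potential θ e f → P f
          apart : AllPairs (λ e e′ → ∀ {f} → Potential θ e f → ¬ Potential θ e′ f) E₁
          avoids₂ : Avoids E₁ E₂
          avoidsF : Avoids E₁ F
          avoidsD : Avoids E₁ (map proj₁ D)
          unique₂ : Unique E₂
          uniqueF : Unique F
          uniqueD : Unique (map proj₁ D)
          disjoint : ∀ {e} → e ∈ˡ E₂ → ¬ e ∈ˡ F
          P₂ : All P E₂
          PF : All P F
          PD : All (λ (e , a) → P e × a ∈ˡ roles k t) D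
      open Frontier

      value₁ : ℕ → ℕ → ℕ → ℕ → ℚ
      value₁ n₁ n₂ f h = u (suc r) ^ᵠ n₁ Q.* (u r ^ᵠ n₂ Q.* (δ ^ᵠ f Q.* ρ ^ᵠ h))

      keys-hits : ∀ x D → map proj₁ (hits x ++ D) ≡ map (edge x) (subsets k t) ++ map proj₁ D
      keys-hits x D = trans (Lp.map-++ proj₁ (hits x) D) (cong (_++ map proj₁ D) (sym (Lp.map-∘ (subsets k t))))

      frontier-skip : ∀ {e E₁ E₂ F D} → Frontier (e ∷ E₁) E₂ F D → Frontier E₁ (e ∷ E₂) F D
      frontier-skip fr with fr .apart | fr .explored
      ... | ap ∷ aps | ex ∷ exs = record
        { explored = exs ; potentials = fr .potentials ∘ there ; apart = aps
        ; avoids₂ = λ { m (here refl) q → All.lookup ap m itself q ; m (there m′) q → fr .avoids₂ (there m) m′ q }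
        ; avoidsF = fr .avoidsF ∘ there ; avoidsD = fr .avoidsD ∘ there
        ; unique₂ = All.tabulate (λ { m refl → fr .avoids₂ (here refl) m itself }) ∷ fr .unique₂
        ; uniqueF = fr .uniqueF ; uniqueD = fr .uniqueD
        ; disjoint = λ { (here refl) m → fr .avoidsF (here refl) m itself ; (there m) → fr .disjoint m }
        ; P₂ = fr .potentials (here refl) itself ∷ fr .P₂ ; PF = fr .PF ; PD = fr .PD }

      frontier-join : ∀ {e E₁ E₂ F D a} → a ∈ˡ ownRoles → Frontier (e ∷ E₁) E₂ F D → let x = join θ a e in
        Frontier E₁ (map (edge x) own ++ E₂) (map (edge x) non ++ F) (hits x ++ D)
      frontier-join {e} {E₁} {E₂} {F} {D} {a} ma fr with fr .apart | fr .explored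
      ... | ap ∷ aps | ex ∷ exs = record
        { explored = exs ; potentials = fr .potentials ∘ there ; apart = aps
        ; avoids₂ = avoid-++ own⊆ (fr .avoids₂ ∘ there)
        ; avoidsF = avoid-++ non⊆ (fr .avoidsF ∘ there)
        ; avoidsD = λ m m′ → avoid-++ {X = subsets k t} id (fr .avoidsD ∘ there) m (subst (_ ∈ˡ_) (keys-hits x D) m′)
        ; unique₂ = Un.++⁺ (unique-map (Un.filter⁺ own? unique-subsets)) (fr .unique₂) (λ (m , m′) → fr .avoids₂ (here refl) m′ (pot own⊆ m))
        ; uniqueF = Un.++⁺ (unique-map (Un.filter⁺ (_∈𝓑? 𝓑) unique-subsets)) (fr .uniqueF) (λ (m , m′) → fr .avoidsF (here refl) m′ (pot non⊆ m))
        ; uniqueD = subst Unique (sym (keys-hits x D))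
            (Un.++⁺ (unique-map unique-subsets) (fr .uniqueD) (λ (m , m′) → fr .avoidsD (here refl) m′ (pot {X = subsets k t} id m)))
        ; disjoint = disj
        ; P₂ = ++⁺ (All.tabulate (λ m → fr .potentials (here refl) (pot own⊆ m))) (fr .P₂)
        ; PF = ++⁺ (All.tabulate (λ m → fr .potentials (here refl) (pot non⊆ m))) (fr .PF)
        ; PD = ++⁺ (All.tabulate hit-ok) (fr .PD) }
        where
        x = join θ a e
        inj : InjectiveBlock x
        inj = proj₁ (proj₂ (All.lookup (fr .explored) (here refl)) ma)
        unique-subsets = Unique-subsets k t
        own⊆ : ∀ {T} → T ∈ˡ own → T ∈ˡ subsets k t
        own⊆ m = proj₁ (∈-filter⁻ own? {xs = subsets k t} m)
        non⊆ : ∀ {T} → T ∈ˡ non → T ∈ˡ subsets k t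
        non⊆ m = proj₁ (∈-filter⁻ (_∈𝓑? 𝓑) {xs = subsets k t} m)
        unique-map : ∀ {X} → Unique X → Unique (map (edge x) X)
        unique-map u = Un.map⁺ (edge-injective {x = x} inj) u
        pot : ∀ {X f} → (∀ {T} → T ∈ˡ X → T ∈ˡ subsets k t) → f ∈ˡ map (edge x) X → Potential θ e f
        pot sub m with ∈-map⁻ (edge x) m
        ... | T , mT , refl = joined ma (∈-subsets⁻ k t (sub mT))
        avoid-++ : ∀ {X Y} → (∀ {T} → T ∈ˡ X → T ∈ˡ subsets k t) → Avoids E₁ Y → Avoids E₁ (map (edge x) X ++ Y)
        avoid-++ {X} sub av m m′ q with ∈-++⁻ (map (edge x) X) m′
        ... | inj₁ p = All.lookup (AllPairs.head (fr .apart)) m (pot sub p) q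
        ... | inj₂ p = av m p q
        disj : ∀ {f} → f ∈ˡ map (edge x) own ++ E₂ → ¬ f ∈ˡ map (edge x) non ++ F
        disj {f} m m′ with ∈-++⁻ (map (edge x) own) m | ∈-++⁻ (map (edge x) non) m′
        ... | inj₂ p | inj₂ q = fr .disjoint p q
        ... | inj₂ p | inj₁ q = fr .avoids₂ (here refl) p (pot non⊆ q)
        ... | inj₁ p | inj₂ q = fr .avoidsF (here refl) q (pot own⊆ p)
        ... | inj₁ p | inj₁ q with ∈-map⁻ (edge x) p | ∈-map⁻ (edge x) q
        ...   | T , mT , refl | T′ , mT′ , eq with edge-injective {x = x} inj {T} {T′} eq
        ...     | refl = proj₂ (∈-filter⁻ own? {xs = subsets k t} mT) (proj₂ (∈-filter⁻ (_∈𝓑? 𝓑) {xs = subsets k t} mT′))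
        hit-ok : ∀ {p} → p ∈ˡ hits x → P (proj₁ p) × proj₂ p ∈ˡ roles k t
        hit-ok m with ∈-map⁻ _ m
        ... | T , mT , refl = fr .potentials (here refl) (joined ma sz)
          , IsRole⇒∈roles (isRole-roleOf (restrict x T) (restrict-injective x inj T) (trans (cong ∣_∣ (supp-restrict x T)) sz))
          where sz = ∈-subsets⁻ k t mT

      -- Induction on E₁. Expanding its first edge e either adds e to E₂ or adds the conditions of a
      -- whole block, with L own edges, m reserved ones and ℓ colours; the difference reproduces u r
      -- - κ u r ^ L. With E₁ exhausted, the colours of the round are independent of the state
      -- before it, to which `before` applies.
      explore : ∀ E₁ E₂ F D → Frontier E₁ E₂ F D →
        𝔼′ (monomial E₁ E₂ F D) ≡ value₁ (length E₁) (length E₂) (length F) (length D)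
      explore [] E₂ F D fr = begin
        𝔼 θs (λ st → mean cols (monomial [] E₂ F D st))
          ≡⟨ ext (λ st → trans (Linear.ext (mean-linear cols) (λ c → trans (Q.*-identityˡ _) (sym (Q.*-assoc (b st) (f st) (h c)))))
               (trans (Linear.scale (mean-linear cols) (b st Q.* f st) h) (trans (cong ((b st Q.* f st) Q.*_) hits-mean) (Q.*-comm _ (ρ ^ᵠ length D))))) ⟩
        𝔼 θs (λ st → ρ ^ᵠ length D Q.* (b st Q.* f st))
          ≡⟨ trans (scale (ρ ^ᵠ length D) (λ st → b st Q.* f st)) (cong (ρ ^ᵠ length D Q.*_) (before E₂ F (fr .unique₂) (fr .uniqueF) (fr .disjoint) (fr .P₂) (fr .PF))) ⟩
        ρ ^ᵠ length D Q.* (u r ^ᵠ length E₂ Q.* δ ^ᵠ length F)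
          ≡⟨ QSolver.solve 3 (λ a b c → a :* (b :* c) := QSolver.con 1 :* (b :* (c :* a))) refl (ρ ^ᵠ length D) (u r ^ᵠ length E₂) (δ ^ᵠ length F) ⟩
        value₁ 0 (length E₂) (length F) (length D) ∎
        where
        open ≡-Reasoning
        open QSolver using (_:*_; _:=_)
        open Linear (linear-𝔼 θs)
        cols = Colour.colourings edges
        b = λ st → ∏ E₂ (λ e → ⟦ available st e ⟧)
        f = λ st → ∏ F (λ e → ⟦ reserved st e ⟧)
        h = λ c → ∏ D (λ (e , a) → Colour.hit e a c)
        hits-mean : mean cols h ≡ ρ ^ᵠ length D
        hits-mean = Colour.mean-hits edges _ blank∈ D (fr .uniqueD) (All.map (λ (p , m) → ∈-subsets⁺ _ (P-size p) , m) (fr .PD))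
      explore (e ∷ E₁) E₂ F D fr = begin
        𝔼′ (monomial (e ∷ E₁) E₂ F D)
          ≡⟨ 𝔼″.ext (λ (st , c) → monomial-expand (All.lookup (fr .explored) (here refl)) E₁ E₂ F D st c) ⟩
        𝔼′ (λ st c → monomial E₁ (e ∷ E₂) F D st c Q.- ∑ᵠ ownRoles (λ a → after a st c))
          ≡⟨ trans (𝔼″.add _ _) (cong (𝔼′ (monomial E₁ (e ∷ E₂) F D) Q.+_) (trans (𝔼″.neg _) (cong Q.-_ (𝔼″.sum ownRoles (λ a (st , c) → after a st c))))) ⟩
        𝔼′ (monomial E₁ (e ∷ E₂) F D) Q.- ∑ᵠ ownRoles (λ a → 𝔼′ (after a))
          ≡⟨ cong₂ (λ p q → p Q.- q) (explore E₁ (e ∷ E₂) F D (frontier-skip fr))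
               (trans (∑ℚ.∑-cong-∈ ownRoles (λ {a} m → trans (explore E₁ _ _ _ (frontier-join m fr)) (lengths a))) (∑ᵠ-const ownRoles _)) ⟩
        value₁ n₁ (suc n₂) f h Q.- ι (length ownRoles) Q.* value₁ n₁ (L + n₂) (m + f) (ℓ + h)
          ≡⟨ recursion ⟩
        value₁ (suc n₁) n₂ f h ∎
        where
        open ≡-Reasoning
        open QSolver using (_:*_; _:=_; _:+_)
        cols = Colour.colourings edges
        module 𝔼″ = Linear linear-𝔼′
        n₁ = length E₁
        n₂ = length E₂
        f = length F
        h = length D
        L = length own
        m = length non
        ℓ = length (subsets k t)
        after : Role k → State → (Edge → Role k) → ℚ
        after a = joined-monomial E₁ E₂ F D (join θ a e)
        length-map++ : ∀ {X Z : Set} (g : X → Z) xs (ys : List Z) → length (map g xs ++ ys) ≡ length xs + length ys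
        length-map++ g xs ys = trans (Lp.length-++ (map g xs)) (cong (_+ length ys) (Lp.length-map g xs))
        lengths : ∀ a → value₁ n₁ (length (map (edge (join θ a e)) own ++ E₂)) (length (map (edge (join θ a e)) non ++ F)) (length (hits (join θ a e) ++ D))
          ≡ value₁ n₁ (L + n₂) (m + f) (ℓ + h)
        lengths a = cong₂ (λ p q → u (suc r) ^ᵠ n₁ Q.* (u r ^ᵠ p Q.* q)) (length-map++ (edge (join θ a e)) own E₂)
          (cong₂ (λ p q → δ ^ᵠ p Q.* ρ ^ᵠ q) (length-map++ (edge (join θ a e)) non F) (length-map++ _ (subsets k t) D))
        recursion : value₁ n₁ (suc n₂) f h Q.- ι (length ownRoles) Q.* value₁ n₁ (L + n₂) (m + f) (ℓ + h) ≡ value₁ (suc n₁) n₂ f h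
        recursion = begin
          v Q.* ((u r Q.* U) Q.* (Δ Q.* R)) Q.- Λ Q.* (v Q.* (u r ^ᵠ (L + n₂) Q.* (δ ^ᵠ (m + f) Q.* ρ ^ᵠ (ℓ + h))))
            ≡⟨ cong (λ z → v Q.* ((u r Q.* U) Q.* (Δ Q.* R)) Q.- Λ Q.* (v Q.* z)) (cong₂ Q._*_ (^ᵠ-+ (u r) L n₂) (cong₂ Q._*_ (^ᵠ-+ δ m f) (^ᵠ-+ ρ ℓ h))) ⟩
          v Q.* ((u r Q.* U) Q.* (Δ Q.* R)) Q.- Λ Q.* (v Q.* ((uL Q.* U) Q.* ((δm Q.* Δ) Q.* (ρℓ Q.* R))))
            ≡⟨ cong (λ z → v Q.* ((u r Q.* U) Q.* (Δ Q.* R)) Q.- z)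
                 (QSolver.solve 8 (λ l v a U d D p R → l :* (v :* ((a :* U) :* ((d :* D) :* (p :* R)))) := ((l :* (p :* d)) :* a) :* (v :* (U :* (D :* R)))) refl Λ v uL U δm Δ ρℓ R) ⟩
          v Q.* ((u r Q.* U) Q.* (Δ Q.* R)) Q.- (κ Q.* uL) Q.* (v Q.* (U Q.* (Δ Q.* R)))
            ≡⟨ cong (v Q.* ((u r Q.* U) Q.* (Δ Q.* R)) Q.+_) (Q.neg-distribˡ-* (κ Q.* uL) _) ⟩
          v Q.* ((u r Q.* U) Q.* (Δ Q.* R)) Q.+ (Q.- (κ Q.* uL)) Q.* (v Q.* (U Q.* (Δ Q.* R)))
            ≡⟨ QSolver.solve 6 (λ v a U D R b → v :* ((a :* U) :* (D :* R)) :+ b :* (v :* (U :* (D :* R))) := ((a :+ b) :* v) :* (U :* (D :* R))) refl v (u r) U Δ R (Q.- (κ Q.* uL)) ⟩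
          (u (suc r) Q.* v) Q.* (U Q.* (Δ Q.* R)) ∎
          where
          v = u (suc r) ^ᵠ n₁
          U = u r ^ᵠ n₂
          Δ = δ ^ᵠ f
          R = ρ ^ᵠ h
          Λ = ι (length ownRoles)
          uL = u r ^ᵠ L
          δm = δ ^ᵠ m
          ρℓ = ρ ^ᵠ ℓ


  Within : List V → Edge → Set
  Within W e = ∣ e ∣ ≡ t × (∀ {v} → e ∋ v → v ∈ˡ W)

  -- Before the first round an edge is free unless reserved, so a factor for a free edge is 1 minus
  -- a hit, and hits at distinct edges are independent.
  reserve-mean : ∀ E F → Unique E → Unique F → (∀ {e} → e ∈ˡ E → ¬ e ∈ˡ F) → All (λ e → ∣ e ∣ ≡ t) E → All (λ e → ∣ e ∣ ≡ t) F →
    𝔼 [] (λ st → ∏ E (λ e → ⟦ available st e ⟧) Q.* ∏ F (λ e → ⟦ reserved st e ⟧)) ≡ u 0 ^ᵠ length E Q.* δ ^ᵠ length F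
  reserve-mean [] F _ uF _ _ sF = trans (Linear.scale l 1ℚ _) (cong (1ℚ Q.*_) (begin
    mean cols (λ c → ∏ F (λ e → ⟦ ⌊ c e ≟ 0 ⌋ ⟧)) ≡⟨ Linear.ext l (λ c → sym (∏ℚ.∑-map (λ e → e , 0) F _)) ⟩
    mean cols (λ c → ∏ (map (λ e → e , 0) F) (λ (e , a) → Reserve.hit e a c)) ≡⟨ Reserve.mean-hits edges 0 0∈ (map (λ e → e , 0) F) (subst Unique (trans (sym (Lp.map-id F)) (Lp.map-∘ F)) uF) (All.tabulate ok) ⟩
    inv (length (upTo (suc d))) ^ᵠ length (map (λ e → e , 0) F) ≡⟨ cong₂ (λ n m → inv n ^ᵠ m) (Lp.length-upTo (suc d)) (Lp.length-map _ F) ⟩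
    δ ^ᵠ length F ∎))
    where
    open ≡-Reasoning
    cols = Reserve.colourings edges
    l = mean-linear cols
    ok : ∀ {p} → p ∈ˡ map (λ e → e , 0) F → proj₁ p ∈ˡ edges × proj₂ p ∈ˡ upTo (suc d)
    ok m with ∈-map⁻ _ m
    ... | e , me , refl = ∈-subsets⁺ e (All.lookup sF me) , 0∈
  reserve-mean (e ∷ E) F (e∉ ∷ uE) uF disj (s ∷ sE) sF = begin
    mean cols (λ c → (⟦ not ⌊ c e ≟ 0 ⌋ ⟧ Q.* A c) Q.* B c)
      ≡⟨ Linear.ext l (λ c → trans (cong (λ p → (p Q.* A c) Q.* B c) (⟦not⟧ ⌊ c e ≟ 0 ⌋)) (split (A c) (B c) (Reserve.hit e 0 c))) ⟩
    mean cols (λ c → A c Q.* B c Q.- Reserve.hit e 0 c Q.* (A c Q.* B c))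
      ≡⟨ trans (Linear.add l _ _) (cong (mean cols (λ c → A c Q.* B c) Q.+_) (Linear.neg l _)) ⟩
    mean cols (λ c → A c Q.* B c) Q.- mean cols (λ c → Reserve.hit e 0 c Q.* (A c Q.* B c))
      ≡⟨ cong (λ z → mean cols (λ c → A c Q.* B c) Q.- z) (Reserve.mean-hit edges 0 0∈ (∈-subsets⁺ e s) 0∈ (λ c → A c Q.* B c) ignores) ⟩
    mean cols (λ c → A c Q.* B c) Q.- inv (length (upTo (suc d))) Q.* mean cols (λ c → A c Q.* B c)
      ≡⟨ cong₂ (λ p n → p Q.- inv n Q.* p) (reserve-mean E F uE uF (disj ∘ there) sE sF) (Lp.length-upTo (suc d)) ⟩
    X Q.* Y Q.- δ Q.* (X Q.* Y)
      ≡⟨ collect X Y δ ⟩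
    ((1ℚ Q.- δ) Q.* X) Q.* Y ∎
    where
    open ≡-Reasoning
    open QSolver using (_:*_; _:=_; _:+_)
    cols = Reserve.colourings edges
    l = mean-linear cols
    A = λ (c : Edge → ℕ) → ∏ E (λ e → ⟦ not ⌊ c e ≟ 0 ⌋ ⟧)
    B = λ (c : Edge → ℕ) → ∏ F (λ e → ⟦ ⌊ c e ≟ 0 ⌋ ⟧)
    X = u 0 ^ᵠ length E
    Y = δ ^ᵠ length F
    split : ∀ a b h → ((1ℚ Q.- h) Q.* a) Q.* b ≡ a Q.* b Q.- h Q.* (a Q.* b)
    split a b h = trans (QSolver.solve 3 (λ a b h → ((QSolver.con 1 :+ h) :* a) :* b := a :* b :+ h :* (a :* b)) refl a b (Q.- h))
      (cong (a Q.* b Q.+_) (sym (Q.neg-distribˡ-* h (a Q.* b))))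
    collect : ∀ x y h → x Q.* y Q.- h Q.* (x Q.* y) ≡ ((1ℚ Q.- h) Q.* x) Q.* y
    collect x y h = sym (split x y h)
    ignores : Reserve.IgnoresColourOf e (λ c → A c Q.* B c)
    ignores c c′ h = cong₂ Q._*_
      (∏ℚ.∑-cong-∈ E (λ {f} m → cong (λ z → ⟦ not ⌊ z ≟ 0 ⌋ ⟧) (h f (λ q → All.lookup e∉ m (sym q)))))
      (∏ℚ.∑-cong-∈ F (λ {f} m → cong (λ z → ⟦ ⌊ z ≟ 0 ⌋ ⟧) (h f (λ q → disj (here refl) (subst (_∈ˡ F) q m)))))

  missing : ∀ (T T′ : Subset k) → ∣ T ∣ ≡ t → ∣ T′ ∣ ≡ t → T ≢ T′ → ∃ λ i → T ∋ i × lookup T′ i ≡ false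
  missing T T′ s s′ ne with F.any? (λ i → (lookup T i Bool.≟ true) ×-dec (lookup T′ i Bool.≟ false))
  ... | yes p = p
  ... | no np = contradiction (⊆-full T T′ sub (≤-reflexive (trans s′ (sym s)))) ne
    where
    sub : ∀ {i} → T ∋ i → T′ ∋ i
    sub {i} m with bool-split (lookup T′ i)
    ... | inj₁ q = q
    ... | inj₂ q = contradiction (i , m , q) np

  module Joined {θ : Twists} {W : List V} (fresh : Fresh θ W) where
    open Fresh fresh

    module _ {e : Edge} (we : Within W e) {a : Role k} (ma : a ∈ˡ ownRoles) where
      private
        isRole = proj₁ (∈-ownRoles⁻ ma)
        x = join θ a e

      unplaced : ∀ {i} → lookup (supp a) i ≡ false → lookup (place a e) i ≡ nothing
      unplaced {i} q with lookup (place a e) i in eq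
      ... | nothing = refl
      ... | just v = contradiction (trans (sym (supp-true {place a e} eq)) (trans (cong (λ s → lookup s i) (supp-place a e)) q)) λ ()

      item : ∀ {i} → lookup (supp a) i ≡ false → (place a e , i) ∈ˡ items W
      item q = ∈-items⁺ (record
        { size = trans (cong ∣_∣ (supp-place a e)) (IsRole.size isRole)
        ; within = λ eq → proj₂ we (place-within isRole {e} (proj₁ we) eq)
        ; free = unplaced q })

      new-vertex : ∀ {i} → lookup (supp a) i ≡ false → ¬ lookup x i ∈ˡ W
      new-vertex q = new (item q)

      old-vertex : ∀ {i} → supp a ∋ i → e ∋ lookup x i
      old-vertex {i} m = subst (_∋ lookup x i) (edge-joined isRole (proj₁ we) θ) (∋-edge⁺ x (supp a) m)

      joined-injective : InjectiveBlock x
      joined-injective i j eq with bool-split (lookup (supp a) i) | bool-split (lookup (supp a) j)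
      ... | inj₁ p | inj₂ q = contradiction (proj₂ we (old-vertex p)) (new-vertex q ∘ subst (_∈ˡ W) eq)
      ... | inj₂ p | inj₁ q = contradiction (proj₂ we (old-vertex q)) (new-vertex p ∘ subst (_∈ˡ W) (sym eq))
      ... | inj₂ p | inj₂ q = cong proj₂ (distinct (item p) (item q) eq)
      ... | inj₁ p | inj₁ q = restrict-inj
        where
        at : ∀ {i} → supp a ∋ i → lookup (place a e) i ≡ just (lookup x i)
        at {i} m = trans (cong (λ P → lookup P i) (sym (restrict-joined isRole {e} (proj₁ we) θ))) (lookup-restrict⁺ x (supp a) m)
        restrict-inj : i ≡ j
        restrict-inj = place-injective isRole {e} (proj₁ we) i j (trans (at p) (trans (cong just eq) (sym (at q)))) (λ n → contradiction (trans (sym n) (at p)) λ ())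

      joined-closure : ∀ i → lookup x i ∈ˡ closure θ W
      joined-closure i with bool-split (lookup (supp a) i)
      ... | inj₁ p = ∈-++⁺ˡ (proj₂ we (old-vertex p))
      ... | inj₂ q = ∈-++⁺ʳ W (∈-map⁺ (value θ) (item q))

    potential-within : ∀ {e f} → Within W e → Potential θ e f → Within (closure θ W) f
    potential-within (sz , w) itself = sz , λ m → ∈-++⁺ˡ (w m)
    potential-within {e} we (joined {a} {T} ma sz) = trans (∣edge∣ (joined-injective we ma) T) sz , contained
      where
      contained : ∀ {v} → edge (join θ a e) T ∋ v → v ∈ˡ closure θ W
      contained m with ∋-edge⁻ (join θ a e) T m
      ... | i , _ , refl = joined-closure we ma i

    -- A t-set of positions other than `supp a` has a position outside it, and there the vertex is
    -- new.
    potential-old : ∀ {e f} → Within W e → Potential θ e f → f ≡ e ⊎ ∃ λ a → a ∈ˡ ownRoles × ∃ λ i → lookup (supp a) i ≡ false × f ∋ lookup (join θ a e) i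
    potential-old we itself = inj₁ refl
    potential-old {e} we (joined {a} {T} ma sz) with V.≡-dec Bool._≟_ T (supp a)
    ... | yes refl = inj₁ (edge-joined (proj₁ (∈-ownRoles⁻ ma)) (proj₁ we) θ)
    ... | no ne with missing T (supp a) sz (IsRole.size (proj₁ (∈-ownRoles⁻ ma))) ne
    ...   | i , m , q = inj₂ (a , ma , i , q , ∋-edge⁺ (join θ a e) T m)

    potential-in-W : ∀ {e f} → Within W e → Within W f → Potential θ e f → f ≡ e
    potential-in-W we wf p with potential-old we p
    ... | inj₁ eq = eq
    ... | inj₂ (a , ma , i , q , m) = contradiction (proj₂ wf m) (new-vertex we ma q)

    -- By freshness a new vertex determines the item that produced it, hence the placement and the
    -- edge placed.
    potentials-apart : ∀ {e e′ f} → Within W e → Within W e′ → e ≢ e′ → Potential θ e f → ¬ Potential θ e′ f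
    potentials-apart we we′ ne p p′ with potential-old we p
    ... | inj₁ refl = ne (potential-in-W we′ we p′)
    potentials-apart we we′ ne p itself | inj₂ (a , ma , i , q , m) = new-vertex we ma q (proj₂ we′ m)
    potentials-apart {e} {e′} we we′ ne p (joined {a′} {T′} ma′ sz′) | inj₂ (a , ma , i , q , m) with ∋-edge⁻ (join θ a′ e′) T′ m
    ... | j , mj , eq with bool-split (lookup (supp a′) j)
    ...   | inj₁ pj = new-vertex we ma q (subst (_∈ˡ W) eq (proj₂ we′ (old-vertex {e′} we′ ma′ pj)))
    ...   | inj₂ qj = ne (begin
      e ≡⟨ sym (vertices-place (proj₁ (∈-ownRoles⁻ ma)) (proj₁ we)) ⟩
      vertices (place a e) ≡⟨ cong (vertices ∘ proj₁) (distinct (item we ma q) (item we′ ma′ qj) (sym eq)) ⟩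
      vertices (place a′ e′) ≡⟨ vertices-place (proj₁ (∈-ownRoles⁻ ma′)) (proj₁ we′) ⟩
      e′ ∎)
      where open ≡-Reasoning

  good-compatible : ∀ {r} (θs : Vec Twists r) {W} → Good W θs → ∀ x → (∀ {v} → v ∈ˡ toList x → v ∈ˡ W) → Compatible θs x
  good-compatible [] _ x _ = VAll.[]
  good-compatible (θ ∷ θs) {W} (fresh , good) x sub = All.tabulate (λ m v∈ → Fresh.new fresh (items-mono sub m) (sub v∈))
    VAll.∷ good-compatible θs good x (∈-++⁺ˡ ∘ sub)

  -- Induction on the rounds, the latest first: exploring it leads from edges inside W to edges
  -- inside the closure of W, for which the earlier rounds are still good.
  monomial-mean : ∀ {r} (θs : Vec Twists r) {W} → Good W θs → ∀ E F → Unique E → Unique F → (∀ {e} → e ∈ˡ E → ¬ e ∈ˡ F) →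
    All (Within W) E → All (Within W) F →
    𝔼 θs (λ st → ∏ E (λ e → ⟦ available st e ⟧) Q.* ∏ F (λ e → ⟦ reserved st e ⟧)) ≡ u r ^ᵠ length E Q.* δ ^ᵠ length F
  monomial-mean [] _ E F uE uF disj wE wF = reserve-mean E F uE uF disj (All.map proj₁ wE) (All.map proj₁ wF)
  monomial-mean {suc r} (θ ∷ θs) {W} (fresh , good) E F uE uF disj wE wF = begin
    𝔼 (θ ∷ θs) (λ st → ∏ E (λ e → ⟦ available st e ⟧) Q.* ∏ F (λ e → ⟦ reserved st e ⟧))
      ≡⟨ Linear.ext linear-𝔼′ (λ (st , c) → cong (∏ E (λ e → ⟦ available (step θ θs st c) e ⟧) Q.*_)
           (sym (trans (Q.*-identityˡ _) (Q.*-identityʳ (∏ F (λ e → ⟦ reserved st e ⟧)))))) ⟩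
    𝔼′ (monomial E [] F [])
      ≡⟨ explore E [] F [] frontier ⟩
    u (suc r) ^ᵠ length E Q.* (1ℚ Q.* (δ ^ᵠ length F Q.* 1ℚ))
      ≡⟨ cong (u (suc r) ^ᵠ length E Q.*_) (trans (Q.*-identityˡ _) (Q.*-identityʳ (δ ^ᵠ length F))) ⟩
    u (suc r) ^ᵠ length E Q.* δ ^ᵠ length F ∎
    where
    open ≡-Reasoning
    open Round θ θs
    open Joined fresh
    open Exploration (Within (closure θ W)) proj₁ (monomial-mean θs good)
    sub-closure : ∀ {e} → Within W e → Within (closure θ W) e
    sub-closure (sz , w) = sz , λ m → ∈-++⁺ˡ (w m)
    explored-at : ∀ {e} → e ∈ˡ E → Explored e
    explored-at {e} m = proj₁ we , λ {a} ma → joined-injective we ma , good-compatible θs good (join θ a e) (contained ma)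
      where
      we = All.lookup wE m
      contained : ∀ {a} → a ∈ˡ ownRoles → ∀ {v} → v ∈ˡ toList (join θ a e) → v ∈ˡ closure θ W
      contained {a} ma mv with ∈-toList⁻ (join θ a e) mv
      ... | i , refl = joined-closure we ma i
    frontier : Frontier E [] F []
    frontier = record
      { explored = All.tabulate explored-at
      ; potentials = λ m p → potential-within (All.lookup wE m) p
      ; apart = AllPairs-∈ uE (λ m m′ ne p p′ → potentials-apart (All.lookup wE m) (All.lookup wE m′) ne p p′)
      ; avoids₂ = λ _ ()
      ; avoidsF = λ m mF p → disj m (subst (_∈ˡ F) (potential-in-W (All.lookup wE m) (All.lookup wF mF) p) mF)
      ; avoidsD = λ _ ()
      ; unique₂ = [] ; uniqueF = uF ; uniqueD = []
      ; disjoint = λ ()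
      ; P₂ = [] ; PF = All.map (λ {e} → sub-closure {e}) wF ; PD = [] }

  -- Existence of large packings

  module _ (g₀ : Fin G) (R : ℕ) (u-small : u R Q.≤ inv (suc d)) (G-large : 2 * suc d * suc (badnessBound R t) ≤ G) where

    β : ℕ
    β = badnessBound R t

    -- Averaging over the codes comes before any colour is drawn, so the codes are fixed during the
    -- random process.
    few-bad : ∃ λ (θs : Vec Twists R) → G * ∑ edges (λ e → badness (elements e) θs) ≤ β * length edges
    -- Any sequence of codes shows that the list is nonempty, as averaging requires.
    few-bad = choose (vectors allTwists R) (∈-vectors⁺ (V.replicate R (V.replicate k (g₀ , v₀)))
        (λ i → subst (_∈ˡ allTwists) (sym (V.lookup-replicate i _)) (∈-vectors⁺ _
          (λ j → subst (_∈ˡ twists) (sym (V.lookup-replicate j _)) (∈-cartesianProduct⁺ (∈-allFin g₀) (∈-allFin v₀)))))) (begin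
      G * ∑ Θ (λ θs → ∑ edges (λ e → badness (elements e) θs)) ≡⟨ trans (cong (G *_) (∑-swap Θ edges _)) (*-∑ G edges _) ⟩
      ∑ edges (λ e → G * ∑ Θ (badness (elements e))) ≤⟨ ∑-mono-∈ edges (λ {e} m → badness-rare R (elements e) (≤-reflexive (trans (length-elements e) (∈-subsets⁻ N t m)))) ⟩
      ∑ edges (λ _ → β * length Θ) ≡⟨ ∑-const edges _ ⟩
      length edges * (β * length Θ) ≡⟨ rotate (length edges) β (length Θ) ⟩
      length Θ * (β * length edges) ∎)
      where
      open ≤-Reasoning
      Θ = vectors allTwists R
      rotate : ∀ a b c → a * (b * c) ≡ c * (b * a)
      rotate = solve-∀
      choose : ∀ Θ {θ₀} → θ₀ ∈ˡ Θ → G * ∑ Θ (λ θs → ∑ edges (λ e → badness (elements e) θs)) ≤ length Θ * (β * length edges) →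
        ∃ λ (θs : Vec Twists R) → G * ∑ edges (λ e → badness (elements e) θs) ≤ β * length edges
      choose (θ ∷ Θ) _ le with ∑-pigeonhole θ Θ (λ θs → ∑ edges (λ e → badness (elements e) θs)) G (β * length edges) le
      ... | θs , _ , le′ = θs , le′

    opaque
      θs : Vec Twists R
      θs = proj₁ few-bad

      θs-few-bad : G * ∑ edges (λ e → badness (elements e) θs) ≤ β * length edges
      θs-few-bad = proj₂ few-bad

    bad : Edge → ℕ
    bad e = badness (elements e) θs

    S : ℕ
    S = ∑ edges bad

    S-small : 2 * suc d * S ≤ length edges
    S-small = ℕ.*-cancelˡ-≤ (suc β) (begin
      suc β * (2 * suc d * S) ≡⟨ rotate (suc β) (2 * suc d) S ⟩
      2 * suc d * suc β * S ≤⟨ *-monoˡ-≤ S G-large ⟩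
      G * S ≤⟨ θs-few-bad ⟩
      β * length edges ≤⟨ *-monoˡ-≤ (length edges) (n≤1+n β) ⟩
      suc β * length edges ∎)
      where
      open ≤-Reasoning
      rotate : ∀ a b c → a * (b * c) ≡ b * a * c
      rotate = solve-∀

    lost : State → Edge → ℕ
    lost st e = bit (available st e) + bit (reserved st e)

    mean-mono : ∀ {A : Set} (xs : List A) {f g : A → ℚ} → (∀ x → f x Q.≤ g x) → mean xs f Q.≤ mean xs g
    mean-mono xs h = *-mono-nonNegˡ (inv-nonNeg (length xs)) (∑ᵠ-mono-∈ xs (λ {x} _ → h x))

    𝔼-mono : ∀ {r} (θs : Vec Twists r) {f g} → (∀ st → f st Q.≤ g st) → 𝔼 θs f Q.≤ 𝔼 θs g
    𝔼-mono [] h = mean-mono (Reserve.colourings edges) (λ c → h _)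
    𝔼-mono (θ ∷ θs) h = 𝔼-mono θs (λ st → mean-mono (Colour.colourings edges) (λ c → h _))

    𝔼-const : ∀ {r} (θs : Vec Twists r) y → 𝔼 θs (λ _ → y) ≡ y
    𝔼-const [] y = Reserve.mean-const edges 0 0∈ y
    𝔼-const (θ ∷ θs) y = trans (Linear.ext (linear-𝔼 θs) (λ _ → Colour.mean-const edges _ blank∈ y)) (𝔼-const θs y)

    -- An edge without conflicts is free at the end with probability u R ≤ δ and reserved with
    -- probability δ. For the others the trivial bound 2 is paid for by the badness.
    lost-mean : ∀ {e} → e ∈ˡ edges → ∀ b → bad e ≡ b → 𝔼 θs (λ st → ι (lost st e)) Q.≤ (δ Q.+ δ) Q.+ ι (2 * b)
    lost-mean {e} m zero eq = begin
      𝔼 θs (λ st → ι (lost st e))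
        ≡⟨ trans (Linear.ext l (λ st → trans (ι-+ (bit (available st e)) (bit (reserved st e))) (sym (cong₂ Q._+_ (⟦⟧≡ι (available st e)) (⟦⟧≡ι (reserved st e)))))) (Linear.add l _ _) ⟩
      𝔼 θs (λ st → ⟦ available st e ⟧) Q.+ 𝔼 θs (λ st → ⟦ reserved st e ⟧)
        ≡⟨ cong₂ Q._+_
             (trans (Linear.ext l (λ st → sym (trans (Q.*-identityʳ (⟦ available st e ⟧ Q.* 1ℚ)) (Q.*-identityʳ ⟦ available st e ⟧))))
               (trans (monomial-mean θs good (e ∷ []) [] ([] ∷ []) [] (λ _ ()) (within ∷ []) []) (trans (Q.*-identityʳ (u R Q.* 1ℚ)) (Q.*-identityʳ (u R)))))
             (trans (Linear.ext l (λ st → sym (trans (Q.*-identityˡ (⟦ reserved st e ⟧ Q.* 1ℚ)) (Q.*-identityʳ ⟦ reserved st e ⟧))))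
               (trans (monomial-mean θs good [] (e ∷ []) [] ([] ∷ []) (λ ()) [] (within ∷ [])) (trans (Q.*-identityˡ (δ Q.* 1ℚ)) (Q.*-identityʳ δ)))) ⟩
      u R Q.+ δ ≤⟨ Q.+-monoˡ-≤ δ u-small ⟩
      δ Q.+ δ ≡⟨ sym (trans (cong ((δ Q.+ δ) Q.+_) ι0) (Q.+-identityʳ (δ Q.+ δ))) ⟩
      (δ Q.+ δ) Q.+ ι 0 ∎
      where
      open Q.≤-Reasoning
      l = linear-𝔼 θs
      good : Good (elements e) θs
      good = badness≡0⇒Good (elements e) θs eq
      within : Within (elements e) e
      within = ∈-subsets⁻ N t m , ∈-elements⁺ e
    lost-mean {e} m (suc b) eq = begin
      𝔼 θs (λ st → ι (lost st e)) ≤⟨ 𝔼-mono θs (λ st → ι-mono (+-mono-≤ (bit≤1 (available st e)) (bit≤1 (reserved st e)))) ⟩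
      𝔼 θs (λ st → ι 2) ≡⟨ 𝔼-const θs (ι 2) ⟩
      ι 2 ≤⟨ ι-mono (*-monoʳ-≤ 2 {1} {suc b} (s≤s z≤n)) ⟩
      ι (2 * suc b) ≡⟨ sym (Q.+-identityˡ _) ⟩
      0ℚ Q.+ ι (2 * suc b) ≤⟨ Q.+-monoˡ-≤ (ι (2 * suc b)) (Q.≤-trans (Q.≤-reflexive (sym (Q.+-identityʳ 0ℚ))) (Q.+-mono-≤ (inv-nonNeg (suc d)) (inv-nonNeg (suc d)))) ⟩
      (δ Q.+ δ) Q.+ ι (2 * suc b) ∎
      where
      open Q.≤-Reasoning
      bit≤1 : ∀ b → bit b ≤ 1
      bit≤1 true = ≤-refl
      bit≤1 false = z≤n

    outcome : ∃ λ st → Invariant θs st × ι (∑ edges (lost st)) Q.≤ ι (length edges) Q.* (δ Q.+ δ) Q.+ ι (2 * S)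
    outcome = 𝔼-≤-witness θs (λ st → ι (∑ edges (lost st))) _ (begin
      𝔼 θs (λ st → ι (∑ edges (lost st))) ≡⟨ trans (Linear.ext l (λ st → ι-∑ edges (lost st))) (Linear.sum l edges (λ e st → ι (lost st e))) ⟩
      ∑ᵠ edges (λ e → 𝔼 θs (λ st → ι (lost st e))) ≤⟨ ∑ᵠ-mono-∈ edges (λ {e} m → lost-mean m (bad e) refl) ⟩
      ∑ᵠ edges (λ e → (δ Q.+ δ) Q.+ ι (2 * bad e)) ≡⟨ ∑ℚ.∑-⊕ edges _ _ ⟩
      ∑ᵠ edges (λ _ → δ Q.+ δ) Q.+ ∑ᵠ edges (λ e → ι (2 * bad e))
        ≡⟨ cong₂ Q._+_ (∑ᵠ-const edges (δ Q.+ δ)) (trans (sym (ι-∑ edges (λ e → 2 * bad e))) (cong ι (sym (*-∑ 2 edges bad)))) ⟩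
      ι (length edges) Q.* (δ Q.+ δ) Q.+ ι (2 * S) ∎)
      where
      open Q.≤-Reasoning
      l = linear-𝔼 θs

    opaque
      final : State
      final = proj₁ outcome

      invariant : Invariant θs final
      invariant = proj₁ (proj₂ outcome)

      final-loses-few : ι (∑ edges (lost final)) Q.≤ ι (length edges) Q.* (δ Q.+ δ) Q.+ ι (2 * S)
      final-loses-few = proj₂ (proj₂ outcome)

    -- Two of the three parts come from δ + δ and one from the bad edges, by `S-small`.
    few-lost : suc d * ∑ edges (lost final) ≤ 3 * length edges
    few-lost = ≤-trans (ι-cancel-≤ (begin
      ι (suc d * X) ≡⟨ ι-* (suc d) X ⟩
      D Q.* ι X ≤⟨ *-mono-nonNegˡ (ι-nonNeg (suc d)) final-loses-few ⟩
      D Q.* (E Q.* (δ Q.+ δ) Q.+ ι (2 * S)) ≡⟨ QSolver.solve 4 (λ D E δ s → D :* (E :* (δ :+ δ) :+ s) := (δ :* D) :* (E :+ E) :+ D :* s) refl D E δ (ι (2 * S)) ⟩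
      (δ Q.* D) Q.* (E Q.+ E) Q.+ D Q.* ι (2 * S) ≡⟨ cong₂ (λ p q → p Q.* (E Q.+ E) Q.+ q) (inv-ι d) (sym (ι-* (suc d) (2 * S))) ⟩
      1ℚ Q.* (E Q.+ E) Q.+ ι (suc d * (2 * S)) ≡⟨ cong (Q._+ ι (suc d * (2 * S))) (trans (Q.*-identityˡ (E Q.+ E)) (sym (ι-+ (length edges) (length edges)))) ⟩
      ι (length edges + length edges) Q.+ ι (suc d * (2 * S)) ≡⟨ sym (ι-+ (length edges + length edges) (suc d * (2 * S))) ⟩
      ι (length edges + length edges + suc d * (2 * S)) ∎))
      (≤-trans (+-monoʳ-≤ (length edges + length edges) (≤-trans (≤-reflexive (rotate (suc d) S)) S-small)) (≤-reflexive (triple (length edges))))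
      where
      open Q.≤-Reasoning
      open QSolver using (_:+_; _:*_; _:=_)
      X = ∑ edges (lost final)
      D = ι (suc d)
      E = ι (length edges)
      rotate : ∀ a b → a * (2 * b) ≡ 2 * a * b
      rotate = solve-∀
      triple : ∀ a → a + a + a ≡ 3 * a
      triple = solve-∀

    covered-by-block? : ∀ e → Dec (available final e ≡ false × reserved final e ≡ false)
    covered-by-block? e = (available final e Bool.≟ false) ×-dec (reserved final e Bool.≟ false)

    covered-few : length (filter covered-by-block? edges) ≤ length (blocks final) * length own
    covered-few = begin
      length (filter covered-by-block? edges) ≤⟨ length-mono-⊆ _ (concatMap (λ x → map (edge x) own) (blocks final)) (Un.filter⁺ covered-by-block? (Unique-subsets N t)) into ⟩
      length (concatMap (λ x → map (edge x) own) (blocks final)) ≡⟨ trans (length≡∑ (concatMap (λ x → map (edge x) own) (blocks final))) (trans (∑-concatMap (λ x → map (edge x) own) (blocks final) (λ _ → 1))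
          (∑-cong (blocks final) (λ x → trans (sym (length≡∑ (map (edge x) own))) (Lp.length-map (edge x) own)))) ⟩
      ∑ (blocks final) (λ _ → length own) ≡⟨ ∑-const (blocks final) (length own) ⟩
      length (blocks final) * length own ∎
      where
      open ≤-Reasoning
      into : ∀ {e} → e ∈ˡ filter covered-by-block? edges → e ∈ˡ concatMap (λ x → map (edge x) own) (blocks final)
      into m with ∈-filter⁻ covered-by-block? {xs = edges} m
      ... | m′ , f , r with Invariant.covers invariant (∈-subsets⁻ N t m′) f r
      ...   | x , mx , T , mT , refl = ∈-concatMap⁺ _ (Any.map (λ { refl → ∈-map⁺ (edge x) mT }) mx)

    -- Every edge is free, reserved or an own edge of a block, and a block has `length own` of
    -- these.
    many-blocks : suc d * (N C t) ≤ 3 * (N C t) + suc d * (length (blocks final) * length own)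
    many-blocks = subst (λ E → suc d * E ≤ 3 * E + suc d * (length (blocks final) * length own)) (length-subsets N t) (begin
      suc d * length edges ≤⟨ *-monoʳ-≤ (suc d) partition ⟩
      suc d * (∑ edges (lost final) + length (filter covered-by-block? edges)) ≡⟨ *-distribˡ-+ (suc d) (∑ edges (lost final)) _ ⟩
      suc d * ∑ edges (lost final) + suc d * length (filter covered-by-block? edges) ≤⟨ +-mono-≤ few-lost (*-monoʳ-≤ (suc d) covered-few) ⟩
      3 * length edges + suc d * (length (blocks final) * length own) ∎)
      where
      open ≤-Reasoning
      each : ∀ e → 1 ≤ lost final e + ind (covered-by-block? e)
      each e with available final e | reserved final e
      ... | true | _ = s≤s z≤n
      ... | false | true = s≤s z≤n
      ... | false | false = s≤s z≤n
      partition : length edges ≤ ∑ edges (lost final) + length (filter covered-by-block? edges)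
      partition = begin
        length edges ≡⟨ length≡∑ edges ⟩
        ∑ edges (λ _ → 1) ≤⟨ ∑-mono edges each ⟩
        ∑ edges (λ e → lost final e + ind (covered-by-block? e)) ≡⟨ ∑-⊕ edges _ _ ⟩
        ∑ edges (lost final) + ∑ edges (λ e → ind (covered-by-block? e)) ≡⟨ cong (∑ edges (lost final) +_) (∑-ind-filter covered-by-block? edges) ⟩
        ∑ edges (lost final) + length (filter covered-by-block? edges) ∎

    packing : ∃ λ (bs : List Block) → (∀ x → x ∈ˡ bs → InjectiveBlock x) × AllPairs (Separated t 𝓑) bs
      × suc d * (N C t) ≤ 3 * (N C t) + suc d * (length bs * length own)
    packing = blocks final , (λ _ → Invariant.injective invariant) , Invariant.separated invariant , many-blocks

-- Binomial estimates and the choice of the parameters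

[n+1]*nCk≡[k+1]*[n+1]C[k+1] : ∀ n k → suc n * (n C k) ≡ suc k * (suc n C suc k)
[n+1]*nCk≡[k+1]*[n+1]C[k+1] n zero = trans (*-identityʳ (suc n)) (sym (trans (*-identityˡ (suc n C 1)) (nC1≡n (suc n))))
[n+1]*nCk≡[k+1]*[n+1]C[k+1] zero (suc k) = trans (cong (1 *_) (k>n⇒nCk≡0 {0} {suc k} (s≤s z≤n)))
  (sym (trans (cong (suc (suc k) *_) (k>n⇒nCk≡0 {1} {suc (suc k)} (s≤s (s≤s z≤n)))) (*-zeroʳ (suc (suc k)))))
[n+1]*nCk≡[k+1]*[n+1]C[k+1] (suc n) (suc k) = begin
  suc (suc n) * (suc n C suc k) ≡⟨ cong (suc (suc n) *_) (sym (nCk+nC[k+1]≡[n+1]C[k+1] n k)) ⟩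
  suc (suc n) * (n C k + n C suc k) ≡⟨ split n (n C k) (n C suc k) ⟩
  (n C k + n C suc k) + (suc n * (n C k) + suc n * (n C suc k))
    ≡⟨ cong₂ _+_ (nCk+nC[k+1]≡[n+1]C[k+1] n k) (cong₂ _+_ ([n+1]*nCk≡[k+1]*[n+1]C[k+1] n k) ([n+1]*nCk≡[k+1]*[n+1]C[k+1] n (suc k))) ⟩
  x + (suc k * x + suc (suc k) * y) ≡⟨ join k x y ⟩
  suc (suc k) * (x + y) ≡⟨ cong (suc (suc k) *_) (nCk+nC[k+1]≡[n+1]C[k+1] (suc n) (suc k)) ⟩
  suc (suc k) * (suc (suc n) C suc (suc k)) ∎
  where
  open ≡-Reasoning
  x = suc n C suc k
  y = suc n C suc (suc k)
  split : ∀ n a b → suc (suc n) * (a + b) ≡ (a + b) + (suc n * a + suc n * b)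
  split = solve-∀
  join : ∀ k x y → x + (suc k * x + suc (suc k) * y) ≡ suc (suc k) * (x + y)
  join = solve-∀

C-mono-suc : ∀ n k → n C k ≤ suc n C k
C-mono-suc n zero = ≤-refl
C-mono-suc n (suc k) = ≤-trans (m≤n+m (n C suc k) (n C k)) (≤-reflexive (nCk+nC[k+1]≡[n+1]C[k+1] n k))

C-mono : ∀ {m n} k → m ≤ n → m C k ≤ n C k
C-mono {m} {n} k le = subst (λ z → m C k ≤ z C k) (m+[n∸m]≡n le) (go (n ∸ m))
  where
  go : ∀ i → m C k ≤ (m + i) C k
  go zero = ≤-reflexive (cong (_C k) (sym (+-identityʳ m)))
  go (suc i) = ≤-trans (go i) (≤-trans (C-mono-suc (m + i) k) (≤-reflexive (cong (_C k) (sym (+-suc m i)))))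

C-increment : ∀ N i n k → N + i ≤ suc n → (N + i) C suc k ≤ N C suc k + i * (n C k)
C-increment N zero n k le = ≤-reflexive (trans (cong (_C suc k) (+-identityʳ N)) (sym (+-identityʳ _)))
C-increment N (suc i) n k le = begin
  (N + suc i) C suc k ≡⟨ cong (_C suc k) (+-suc N i) ⟩
  suc (N + i) C suc k ≡⟨ sym (nCk+nC[k+1]≡[n+1]C[k+1] (N + i) k) ⟩
  (N + i) C k + (N + i) C suc k ≤⟨ +-mono-≤ (C-mono k N+i≤n) (C-increment N i n k (m≤n⇒m≤1+n N+i≤n)) ⟩
  n C k + (N C suc k + i * (n C k)) ≡⟨ swap (n C k) (N C suc k) (i * (n C k)) ⟩
  N C suc k + suc i * (n C k) ∎
  where
  open ≤-Reasoning
  N+i≤n : N + i ≤ n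
  N+i≤n = ℕ.≤-pred (≤-trans (≤-reflexive (sym (+-suc N i))) le)
  swap : ∀ a b c → a + (b + c) ≡ b + (a + c)
  swap = solve-∀

-- The loss is at most i C(n, k), which equals i (k + 1) / (n + 1) times C(n + 1, k + 1), hence at
-- most a fraction 1/a of it.
C-close : ∀ a D N i n k → N + i ≡ suc n → i ≤ D → a * (D * suc k) ≤ suc n → a * (suc n C suc k) ≤ a * (N C suc k) + suc n C suc k
C-close a D N i n k eq i≤D large = ℕ.*-cancelˡ-≤ (suc n) (begin
  suc n * (a * c) ≤⟨ *-monoʳ-≤ (suc n) (*-monoʳ-≤ a (≤-trans (≤-reflexive (cong (_C suc k) (sym eq))) (C-increment N i n k (≤-reflexive eq)))) ⟩
  suc n * (a * (c₀ + i * (n C k))) ≡⟨ split (suc n) a c₀ i (n C k) ⟩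
  suc n * (a * c₀) + a * (i * (suc n * (n C k))) ≡⟨ cong (λ z → suc n * (a * c₀) + a * (i * z)) ([n+1]*nCk≡[k+1]*[n+1]C[k+1] n k) ⟩
  suc n * (a * c₀) + a * (i * (suc k * c)) ≤⟨ +-monoʳ-≤ (suc n * (a * c₀)) (*-monoʳ-≤ a (*-monoˡ-≤ (suc k * c) i≤D)) ⟩
  suc n * (a * c₀) + a * (D * (suc k * c)) ≡⟨ cong (λ z → suc n * (a * c₀) + z) (assoc a D (suc k) c) ⟩
  suc n * (a * c₀) + a * (D * suc k) * c ≤⟨ +-monoʳ-≤ (suc n * (a * c₀)) (*-monoˡ-≤ c large) ⟩
  suc n * (a * c₀) + suc n * c ≡⟨ sym (*-distribˡ-+ (suc n) (a * c₀) c) ⟩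
  suc n * (a * c₀ + c) ∎)
  where
  open ≤-Reasoning
  c = suc n C suc k
  c₀ = N C suc k
  split : ∀ m a c i x → m * (a * (c + i * x)) ≡ m * (a * c) + a * (i * (m * x))
  split = solve-∀
  assoc : ∀ a D s c → a * (D * (s * c)) ≡ a * (D * s) * c
  assoc = solve-∀

-- The points are 0, ..., k - 1 and the gains 1, ..., G. The gains and all differences are at most G
-- in absolute value, hence units unless zero.
residueField : ∀ {k G M} → suc G ! ∣ M → k ≤ G → CodeField k G (suc M)
residueField {k} {G} {M} dvd k≤G = record
  { isCommutativeRing = isCommutativeRing
  ; pt = λ i → ν (toℕ i)
  ; dinv = λ i j → inverse i j (i F.≟ j)
  ; dinv-inverse = λ {i} {j} ne → inverse-spec i j (i F.≟ j) ne
  ; γ = λ g → ν (suc (toℕ g))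
  ; γinv = λ g → proj₁ (gain-unit g)
  ; γ-inverse = λ g → proj₂ (gain-unit g)
  ; γ-diff = λ {g} {g′} ne → unit-diff dvd (suc (toℕ g)) (suc (toℕ g′)) (ne ∘ F.toℕ-injective ∘ suc-injective) (s≤s (F.toℕ<n g)) (s≤s (F.toℕ<n g′)) }
  where
  open Residues M
  gain-unit : ∀ (g : Fin G) → ∃ λ u → ν (suc (toℕ g)) ⊗ u ≡ ν 1
  gain-unit g = unit dvd (suc (toℕ g)) (s≤s z≤n) (m≤n⇒m≤1+n (F.toℕ<n g))
  point< : ∀ (i : Fin k) → toℕ i < suc G
  point< i = <-trans (<-≤-trans (F.toℕ<n i) k≤G) (n<1+n G)
  difference : ∀ {i j : Fin k} → i ≢ j → ∃ λ u → (ν (toℕ i) ⊕ (⊖ ν (toℕ j))) ⊗ u ≡ ν 1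
  difference {i} {j} ne = unit-diff dvd (toℕ i) (toℕ j) (ne ∘ F.toℕ-injective) (point< i) (point< j)
  inverse : (i j : Fin k) → Dec (i ≡ j) → Fin (suc M)
  inverse i j (yes _) = ν 0
  inverse i j (no ne) = proj₁ (difference ne)
  inverse-spec : ∀ i j (d : Dec (i ≡ j)) → i ≢ j → (ν (toℕ i) ⊕ (⊖ ν (toℕ j))) ⊗ inverse i j d ≡ ν 1
  inverse-spec i j (yes e) ne = contradiction e ne
  inverse-spec i j (no ne) _ = proj₂ (difference ne)

module _ {k : ℕ} (t : ℕ) (𝓑 : List (Subset k)) where
  open Own t 𝓑

  own-bound : Unique 𝓑 → All (λ T → ∣ T ∣ ≡ t) 𝓑 → length own ≤ k C t ∸ length 𝓑
  own-bound unique sizes = ℕ.m+n≤o⇒m≤o∸n (length own) (begin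
    length own + length 𝓑 ≡⟨ trans (+-comm (length own) (length 𝓑)) (sym (Lp.length-++ 𝓑)) ⟩
    length (𝓑 ++ own) ≤⟨ length-mono-⊆ (𝓑 ++ own) (subsets k t)
      (Un.++⁺ unique (Un.filter⁺ own? (Unique-subsets k t)) (λ (m , m′) → proj₂ (∈-filter⁻ own? {xs = subsets k t} m′) m)) into ⟩
    length (subsets k t) ≡⟨ length-subsets k t ⟩
    k C t ∎)
    where
    open ≤-Reasoning
    into : ∀ {T} → T ∈ˡ 𝓑 ++ own → T ∈ˡ subsets k t
    into m with ∈-++⁻ 𝓑 m
    ... | inj₁ p = ∈-subsets⁺ _ (All.lookup sizes p)
    ... | inj₂ p = proj₁ (∈-filter⁻ own? {xs = subsets k t} p)

  -- Otherwise 𝓑 would contain all t-sets, and the sets dealt round-robin would cover every point s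
  -- times, against `no-cover`.
  own-inhabited : ∀ {c s lam q} → 1 ≤ lam → lam ≤ c → lam + q * c ≡ s * k → t ≡ suc q → s < c → s * k ≤ t * c →
    DisjointFree lam (s + 1) (c ∸ s + 1) 𝓑 → ∃ λ T → T ∈ˡ own
  own-inhabited {suc c} {s} 1≤λ λ≤c sk≡ t≡ s<c sk≤tc free = nonempty own (λ none →
    Covering.no-cover 1≤λ λ≤c sk≡ t≡ s<c 𝓑 free D.B D.∣B∣≤t (λ j sz → all-in none (D.B j) sz) D.covers)
    where
    module D = Deal {k} {c} {s} {t} sk≤tc (<⇒≤ s<c)
    all-in : (∀ {T} → ¬ T ∈ˡ own) → ∀ T → ∣ T ∣ ≡ t → T ∈ˡ 𝓑
    all-in none T sz with T ∈𝓑? 𝓑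
    ... | yes m = m
    ... | no n = contradiction (∈-filter⁺ own? (∈-subsets⁺ T sz) n) none
    nonempty : ∀ (xs : List (Subset k)) → ¬ (∀ {T} → ¬ T ∈ˡ xs) → ∃ λ T → T ∈ˡ xs
    nonempty [] h = contradiction (λ ()) h
    nonempty (T ∷ _) _ = T , here refl

-- Taking λ in [1, c] rather than in [0, c - 1] makes q equal to ⌈sk/c⌉ - 1 also when c divides sk.
ceiling : ∀ {c s k t lam q} → 1 ≤ lam → lam ≤ c → lam + q * c ≡ s * k → s * k ≤ t * c → t * c < s * k + c → t ≡ suc q
ceiling {c} {s} {k} {t} {lam} {q} 1≤λ λ≤c eq lo hi = ≤-antisym
  (ℕ.≤-pred (ℕ.*-cancelʳ-< c t (suc (suc q)) (<-≤-trans hi (begin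
    s * k + c ≡⟨ cong (_+ c) (sym eq) ⟩
    lam + q * c + c ≤⟨ +-monoˡ-≤ c (+-monoˡ-≤ (q * c) λ≤c) ⟩
    c + q * c + c ≡⟨ +-comm (c + q * c) c ⟩
    suc (suc q) * c ∎))))
  (ℕ.*-cancelʳ-< c q t (<-≤-trans (+-monoˡ-≤ (q * c) 1≤λ) (≤-trans (≤-reflexive eq) lo)))
  where open ≤-Reasoning

scale-down : ∀ q C X ε → inv (suc q) Q.≤ ε → q * C ≤ suc q * X → (1ℚ Q.- ε) Q.* ι C Q.≤ ι X
scale-down q C X ε le bound = begin
  (1ℚ Q.- ε) Q.* ι C ≤⟨ *-mono-nonNegʳ (ι-nonNeg C) (Q.+-monoʳ-≤ 1ℚ (Q.neg-antimono-≤ le)) ⟩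
  (1ℚ Q.- w) Q.* ι C ≡⟨ cong (Q._* ι C) one-minus ⟩
  (w Q.* ι q) Q.* ι C ≡⟨ trans (Q.*-assoc w (ι q) (ι C)) (cong (w Q.*_) (sym (ι-* q C))) ⟩
  w Q.* ι (q * C) ≤⟨ *-mono-nonNegˡ (inv-nonNeg (suc q)) (ι-mono bound) ⟩
  w Q.* ι (suc q * X) ≡⟨ trans (cong (w Q.*_) (ι-* (suc q) X)) (sym (Q.*-assoc w (ι (suc q)) (ι X))) ⟩
  (w Q.* ι (suc q)) Q.* ι X ≡⟨ trans (cong (Q._* ι X) (inv-ι q)) (Q.*-identityˡ (ι X)) ⟩
  ι X ∎
  where
  open Q.≤-Reasoning
  w = inv (suc q)
  one-minus : 1ℚ Q.- w ≡ w Q.* ι q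
  one-minus = trans (cong (Q._- w) (trans (sym (inv-ι q)) (trans (cong (w Q.*_) (trans (ι-+ 1 q) (cong (Q._+ ι q) ι1))) (trans (Q.*-distribˡ-+ w 1ℚ (ι q)) (cong (Q._+ w Q.* ι q) (Q.*-identityʳ w))))))
    (trans (QSolver.solve 3 (λ w x m → (w QSolver.:+ x) QSolver.:+ m QSolver.:= x QSolver.:+ (w QSolver.:+ m)) refl w (w Q.* ι q) (Q.- w))
      (trans (cong ((w Q.* ι q) Q.+_) (Q.+-inverseʳ w)) (Q.+-identityʳ (w Q.* ι q))))

-- Of 4 (q + 1) parts four are lost: three in the packing on N vertices and one in passing from n to
-- N. Division by 4 leaves q out of q + 1.
combine : ∀ q Cn CN b L f L′ → 4 * suc q * Cn ≤ 4 * suc q * CN + Cn → 4 * suc q * CN ≤ 3 * CN + 4 * suc q * (b * L) → CN ≤ Cn →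
  b ≤ f → L ≤ L′ → q * Cn ≤ suc q * (f * L′)
combine q Cn CN b L f L′ close many CN≤Cn b≤f L≤L′ = ≤-trans
  (ℕ.*-cancelˡ-≤ 4 (+-cancelʳ-≤ (4 * Cn) (4 * (q * Cn)) (4 * (suc q * (b * L))) (begin
    4 * (q * Cn) + 4 * Cn ≡⟨ left q Cn ⟩
    4 * suc q * Cn ≤⟨ close ⟩
    4 * suc q * CN + Cn ≤⟨ +-monoˡ-≤ Cn many ⟩
    3 * CN + 4 * suc q * (b * L) + Cn ≤⟨ +-monoˡ-≤ Cn (+-monoˡ-≤ (4 * suc q * (b * L)) (*-monoʳ-≤ 3 CN≤Cn)) ⟩
    3 * Cn + 4 * suc q * (b * L) + Cn ≡⟨ right q Cn (b * L) ⟩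
    4 * (suc q * (b * L)) + 4 * Cn ∎)))
  (*-monoʳ-≤ (suc q) (*-mono-≤ b≤f L≤L′))
  where
  open ≤-Reasoning
  left : ∀ q C → 4 * (q * C) + 4 * C ≡ 4 * suc q * C
  left = solve-∀
  right : ∀ q C x → 3 * C + 4 * suc q * x + C ≡ 4 * (suc q * x) + 4 * C
  right = solve-∀

module Construction (k c s lam q : ℕ) (2≤k : 2 ≤ k) (1≤λ : 1 ≤ lam) (λ≤c : lam ≤ c) (sk≡ : lam + q * c ≡ s * k) (s<c : s < c)
  (𝓑 : List (Subset k)) (unique : Unique 𝓑) (sizes : All (λ T → ∣ T ∣ ≡ suc q) 𝓑) (free : DisjointFree lam (s + 1) (c ∸ s + 1) 𝓑)
  (T₀ : Subset k) (T₀∈ : T₀ ∈ˡ Own.own (suc q) 𝓑) (p : ℕ) where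

  t d : ℕ
  t = suc q
  -- Thus δ = 1 / (4 (p + 1)), and `suc d` computes to `4 * suc p`.
  d = pred (4 * suc p)

  rounds : ∃ λ R → Rates.u t 𝓑 d R Q.≤ inv (suc d)
  rounds = RateBounds.u-decays t 𝓑 d T₀ T₀∈ (fromℕ< (<-≤-trans (s≤s z≤n) 2≤k)) (inv (suc d)) (inv-pos d)

  opaque
    R : ℕ
    R = proj₁ rounds

    u-small : Rates.u t 𝓑 d R Q.≤ inv (suc d)
    u-small = proj₂ rounds

    G : ℕ
    -- The first summand makes bad edges rare; adding k makes room for k distinct points.
    G = 2 * suc d * suc (Bounds.badnessBound k R t) + k

    G-large : 2 * suc d * suc (Bounds.badnessBound k R t) ≤ G
    G-large = m≤m+n (2 * suc d * suc (Bounds.badnessBound k R t)) k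

    k≤G : k ≤ G
    k≤G = m≤n+m k (2 * suc d * suc (Bounds.badnessBound k R t))

    D : ℕ
    D = suc G !

    [1+G]!∣ : ∀ w → suc G ! ∣ w * D
    [1+G]!∣ w = divides w refl

    D≢0 : NonZero D
    D≢0 = suc G !≢0

  -- As N falls short of n by less than D, the term D + G gives N ≥ G, and the last term makes the
  -- gap negligible in `C-close`.
  threshold : ℕ
  threshold = suc (D + G + suc d * (D * t))

  bound : ∀ n f → threshold ≤ n → IsFrameproofMax c s n k f → p * (n C t) ≤ suc p * (f * (k C t ∸ length 𝓑))
  bound (suc n) f (s≤s large) (_ , maximal) = combine p (suc n C t) (N C t) (length blocks) (length own) f (k C t ∸ length 𝓑)
    (C-close (4 * suc p) D N i n q N+i (<⇒≤ i<D) (≤-trans (m≤n+m _ (D + G)) (≤-trans large (n≤1+n n))))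
    (proj₂ (proj₂ (proj₂ packing))) (C-mono t N≤n)
    (≤-trans (≤-reflexive (sym (Lp.length-map P.vertexSet blocks))) (maximal P.family (P.family-uniform , P.family-frameproof {c} {s} {lam} {q} 1≤λ λ≤c sk≡ refl s<c free)))
    (own-bound t 𝓑 unique sizes)
    where
    open Own t 𝓑
    instance
      D-nonZero : NonZero D
      D-nonZero = D≢0
    w = n div D
    i = n % D
    -- The largest number congruent to 1 modulo D that does not exceed the given number of vertices.
    N = suc (w * D)
    i<D : i < D
    i<D = m%n<n n D
    N+i : N + i ≡ suc n
    N+i = cong suc (trans (+-comm (w * D) i) (sym (m≡m%n+[m/n]*n n D)))
    N≤n : N ≤ suc n
    N≤n = ≤-trans (m≤m+n N i) (≤-reflexive N+i)
    G≤N : G ≤ N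
    G≤N = +-cancelʳ-≤ D G N (begin
      G + D ≡⟨ +-comm G D ⟩
      D + G ≤⟨ m≤m+n (D + G) (suc d * (D * t)) ⟩
      D + G + suc d * (D * t) ≤⟨ ≤-trans large (n≤1+n n) ⟩
      suc n ≡⟨ sym N+i ⟩
      N + i ≤⟨ +-monoʳ-≤ N (<⇒≤ i<D) ⟩
      N + D ∎)
      where open ≤-Reasoning
    packing = Process.packing (residueField {k} {G} {w * D} ([1+G]!∣ w) k≤G) t G≤N zero 𝓑 d
      (fromℕ< {0} (<-≤-trans (<-≤-trans (s≤s z≤n) 2≤k) k≤G)) R u-small G-large
    blocks : List (Vec (Fin N) k)
    blocks = proj₁ packing
    module P = Packing N≤n 𝓑 T₀ (∈-subsets⁻ k t (proj₁ (∈-filter⁻ own? {xs = subsets k t} T₀∈))) (proj₂ (∈-filter⁻ own? {xs = subsets k t} T₀∈))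
      blocks (λ {x} → proj₁ (proj₂ packing) x) (proj₁ (proj₂ (proj₂ packing)))

asymptotic-bound : ∀ k c s lam q t → 2 ≤ k → 1 ≤ lam → lam ≤ c → lam + q * c ≡ s * k → s < c → t ≡ suc q →
  (𝓑 : List (Subset k)) → Unique 𝓑 → All (λ T → ∣ T ∣ ≡ t) 𝓑 → DisjointFree lam (s + 1) (c ∸ s + 1) 𝓑 → (∃ λ T → T ∈ˡ Own.own t 𝓑) →
  ∀ ε → (∃ λ p → inv (suc p) Q.≤ ε) →
  ∃ λ N → ∀ n f → N ≤ n → IsFrameproofMax c s n k f → (1ℚ Q.- ε) Q.* ι (n C t) Q.≤ ι (f * (k C t ∸ length 𝓑))
asymptotic-bound k c s lam q .(suc q) 2≤k 1≤λ λ≤c sk≡ s<c refl 𝓑 unique sizes free (T₀ , T₀∈) ε (p , small) =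
  E.threshold , λ n f large isMax → scale-down p (n C suc q) (f * (k C suc q ∸ length 𝓑)) ε small (E.bound n f large isMax)
  where module E = Construction k c s lam q 2≤k 1≤λ λ≤c sk≡ s<c 𝓑 unique sizes free T₀ T₀∈ p

open import Data.Integer using (+_)

theorem2p4 : (k c s t lam m : ℕ) →
    2 ≤ k → 2 ≤ c → 1 ≤ s → s ≤ c ∸ 1 →
    s * k ≤ t * c → t * c < s * k + c →
    1 ≤ lam → lam ≤ c → (∃ λ (q : ℕ) → lam + q * c ≡ s * k) →
    IsDisjointFreeMax k t lam (s + 1) (c ∸ s + 1) m →
    (ε : ℚ) → 0ℚ Q.< ε →
    ∃ λ (N : ℕ) → (n f : ℕ) → N ≤ n → IsFrameproofMax c s n k f →
    (1ℚ Q.- ε) Q.* ((+ (n C t)) / 1)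
    Q.≤ (+ (f * (k C t ∸ m))) / 1
theorem2p4 k c s t lam m 2≤k 2≤c 1≤s s≤c-1 lo hi 1≤λ λ≤c (q , sk≡) ((𝓑 , ((unique , sizes) , free) , length≡) , _) ε ε>0 =
  proj₁ result , λ n f large isMax → subst₂ Q._≤_
    (cong ((1ℚ Q.- ε) Q.*_) (ι≡ (n C t))) (trans (cong (λ z → ι (f * (k C t ∸ z))) length≡) (ι≡ (f * (k C t ∸ m))))
    (proj₂ result n f large isMax)
  where
  s<c : s < c
  s<c = <-≤-trans (s≤s s≤c-1) (≤-reflexive (m+[n∸m]≡n (<⇒≤ 2≤c)))
  t≡ : t ≡ suc q
  t≡ = ceiling {c} {s} {k} {t} {lam} {q} 1≤λ λ≤c sk≡ lo hi
  result = asymptotic-bound k c s lam q t 2≤k 1≤λ λ≤c sk≡ s<c t≡ 𝓑 unique sizes free (own-inhabited t 𝓑 1≤λ λ≤c sk≡ t≡ s<c lo free) ε (archimedean ε ε>0)
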